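{- Let $q$ be an odd prime power, $n\ge1$, and let $G=\operatorname{Sp}(2n,q)$ be the isometry group of a nondegenerate alternating form $B$ on $V=\mathbb{F}_q^{2n}$. Let $C$ be a conjugacy class of $G$ with representative $g$, and let $o(C)$ be the number of orbits of $C_G(g)$ on $V/[g,V]$, where $[g,V]=(I-g)V$. Let $V_1=\ker(g-I)^{2n}$ (the generalized $1$-eigenspace, on which $B$ is nondegenerate and $g$ is unipotent), and let $a_i$ be the number of Jordan blocks of size $i$ of $g$ on $V_1$. Write $V_1$ as a $B$-orthogonal direct sum of $g$-invariant subspaces $W_i$ such that $g|_{W_i}$ has exactly $a_i$ Jordan blocks, all of size $i$. For even $i$, the form $(x,y)\mapsto B(x,(g-I)^{i-1}y)$ induces a nondegenerate symmetric bilinear form on the $a_i$-dimensional space $W_i/(g-I)W_i$; when $a_i=2$, say that the sign attached to $i$ is $+$ if this $2$-dimensional form is isotropic (hyperbolic) and $-$ otherwise. Then \[ o(C)=1+\#\{i\text{ odd}: a_i\neq0\}+\sum_{i\text{ even},\,a_i\ne0} f_i, \] where $f_i=q$ if $a_i>2$; $f_i=q$ if $a_i=2$ and the sign is $+$; $f_i=q-1$ if $a_i=2$ and the sign is $-$; and $f_i=(q-1)/2$ if $a_i=1$.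
   Context: $o(C)$ depends only on the class $C$. The signs are those of the standard parametrization of unipotent classes of symplectic groups in odd characteristic by signed partitions (a sign for each even part size); the isometry type of the form described does not depend on the chosen decomposition. -}

module Defs where

open import Level using (0ℓ)
open import Data.Nat using (ℕ; zero; suc; _∸_) renaming (_+_ to _+ℕ_)
open import Data.Nat.DivMod using (_/_)
open import Data.Bool using (Bool; true; false; if_then_else_)
open import Data.Fin using (Fin; toℕ) renaming (zero to fzero; suc to fsuc)
open import Data.Fin.Properties using () renaming (_≟_ to _≟ᶠ_)
open import Data.Product using (Σ; ∃; _×_; _,_)
open import Relation.Nullary using (¬_; does)
open import Relation.Binary.PropositionalEquality using (_≡_)
open import Algebra.Bundles using (CommutativeRing)

∑ : {A : Set} → (A → A → A) → A → (d : ℕ) → (Fin d → A) → A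
∑ _⊕_ e zero    f = e
∑ _⊕_ e (suc d) f = f fzero ⊕ ∑ _⊕_ e d (λ i → f (fsuc i))

∑ℕ : (d : ℕ) → (Fin d → ℕ) → ℕ
∑ℕ = ∑ _+ℕ_ 0

isEven : ℕ → Bool
isEven zero          = true
isEven (suc zero)    = false
isEven (suc (suc n)) = isEven n

module LinAlg (R : CommutativeRing 0ℓ 0ℓ) where
  open CommutativeRing R

  record IsFiniteFieldOfOrder (q : ℕ) : Set where
    field
      0≉1       : ¬ (0# ≈ 1#)
      inverse   : ∀ x → ¬ (x ≈ 0#) → ∃ λ y → x * y ≈ 1#
      enum      : Fin q → Carrier
      enum-surj : ∀ x → ∃ λ i → enum i ≈ x
      enum-inj  : ∀ i j → enum i ≈ enum j → i ≡ j

  Vect : ℕ → Set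
  Vect d = Fin d → Carrier

  Mat : ℕ → Set
  Mat d = Fin d → Fin d → Carrier

  _≈v_ : ∀ {d} → Vect d → Vect d → Set
  x ≈v y = ∀ i → x i ≈ y i

  0v : ∀ {d} → Vect d
  0v _ = 0#

  _+v_ : ∀ {d} → Vect d → Vect d → Vect d
  (x +v y) i = x i + y i

  _-v_ : ∀ {d} → Vect d → Vect d → Vect d
  (x -v y) i = x i + (- y i)

  _·s_ : ∀ {d} → Carrier → Vect d → Vect d
  (c ·s x) i = c * x i

  ∑F : (d : ℕ) → (Fin d → Carrier) → Carrier
  ∑F = ∑ _+_ 0#

  ∑v : ∀ {d} → (k : ℕ) → (Fin k → Vect d) → Vect d
  ∑v = ∑ _+v_ 0v

  _·_ : ∀ {d} → Mat d → Vect d → Vect d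
  (A · x) i = ∑F _ (λ j → A i j * x j)

  form : ∀ {d} → Mat d → Vect d → Vect d → Carrier
  form {d} M x y = ∑F d (λ i → ∑F d (λ j → x i * M i j * y j))

  Alternating : ∀ {d} → Mat d → Set
  Alternating {d} B = ∀ (x : Vect d) → form B x x ≈ 0#

  Nondegenerate : ∀ {d} → Mat d → Set
  Nondegenerate {d} B = ∀ (x : Vect d) → (∀ y → form B x y ≈ 0#) → x ≈v 0v

  IsIsometry : ∀ {d} → Mat d → Mat d → Set
  IsIsometry {d} B g = ∀ (x y : Vect d) → form B (g · x) (g · y) ≈ form B x y

  InCentralizer : ∀ {d} → Mat d → Mat d → Mat d → Set
  InCentralizer {d} B g h = IsIsometry B h × (∀ (v : Vect d) → (h · (g · v)) ≈v (g · (h · v)))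

  N : ∀ {d} → Mat d → Vect d → Vect d
  N g v = (g · v) -v v

  Npow : ∀ {d} → Mat d → ℕ → Vect d → Vect d
  Npow g zero    v = v
  Npow g (suc k) v = N g (Npow g k v)

  -- v + [g,V] and w + [g,V] lie in the same C_G(g)-orbit on V/[g,V],
  -- where [g,V] = (I - g)V.
  SameOrbit : ∀ {d} → Mat d → Mat d → Vect d → Vect d → Set
  SameOrbit {d} B g v w =
    ∃ λ (h : Mat d) → InCentralizer B g h ×
      (∃ λ (u : Vect d) → ((h · v) -v w) ≈v (u -v (g · u)))

  NumOrbits : ∀ {d} → Mat d → Mat d → ℕ → Set
  NumOrbits {d} B g k =
    Σ (Fin k → Vect d) λ rep →
      (∀ (v : Vect d) → ∃ λ j → SameOrbit B g v (rep j)) ×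
      (∀ j j' → SameOrbit B g (rep j) (rep j') → j ≡ j')

  -- Orthogonal Jordan decomposition of V₁ = ker (g - I)^d.
  -- Jordan sizes are indexed by i : Fin d, block size = suc (toℕ i).
  -- a i = number of Jordan blocks of size (suc (toℕ i)),
  -- e i j (j < a i) = generators of the Jordan chains:
  -- W_i = span { (g-I)^k e i j : j < a i , k < size } .
  record OrthJordanData {d : ℕ} (B : Mat d) (g : Mat d) : Set where
    field
      a : Fin d → ℕ
      e : (i : Fin d) → Fin (a i) → Vect d
    size : Fin d → ℕ
    size i = suc (toℕ i)
    chain : (i : Fin d) → Fin (a i) → ℕ → Vect d
    chain i j k = Npow g k (e i j)
    comb : ((i : Fin d) → Fin (a i) → Fin (size i) → Carrier) → Vect d
    comb c = ∑v d (λ i → ∑v (a i) (λ j → ∑v (size i) (λ k → c i j k ·s chain i j (toℕ k))))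
    field
      chain-end   : ∀ i j → Npow g (size i) (e i j) ≈v 0v
      in-V₁       : ∀ i j → Npow g d (e i j) ≈v 0v
      independent : ∀ c → comb c ≈v 0v → ∀ i j k → c i j k ≈ 0#
      spanning    : ∀ (v : Vect d) → Npow g d v ≈v 0v → ∃ λ c → v ≈v comb c
      orthogonal  : ∀ i i' → ¬ (i ≡ i') → ∀ j j' (k k' : ℕ) →
                      form B (chain i j k) (chain i' j' k') ≈ 0#

    -- For a i = 2: the symmetric form (x,y) ↦ B(x,(g-I)^{size-1} y) on
    -- W_i/(g-I)W_i, in the basis given by the images of e i 0, e i 1,
    -- is isotropic (hyperbolic): some nonzero vector has form value 0.
    Isotropic : (i : Fin d) → a i ≡ 2 → Set
    Isotropic i eq =
      ∃ λ (x : Fin 2 → Carrier) → ¬ (∀ j → x j ≈ 0#) ×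
        (∑F 2 (λ j → ∑F 2 (λ l → x j * form B (e' j) (Npow g (toℕ i) (e' l)) * x l)) ≈ 0#)
      where
        e' : Fin 2 → Vect d
        e' j = e i (cast j)
          where
            cast : Fin 2 → Fin (a i)
            cast j rewrite eq = j

evenContrib : ℕ → ℕ → Bool → ℕ
evenContrib q (suc zero)       _     = (q ∸ 1) / 2
evenContrib q (suc (suc zero)) true  = q
evenContrib q (suc (suc zero)) false = q ∸ 1
evenContrib q _                _     = q

contrib : (q size a : ℕ) → Bool → ℕ
contrib q size zero    plus = 0
contrib q size (suc a) plus = if isEven size then evenContrib q (suc a) plus else 1

{-# OPTIONS --safe #-}
-- Put ν = g − 1.  On ker νⁱ the form B(x, νⁱ⁻¹ y) depends only on the components of x and y at the
-- Jordan blocks of size i; it is symmetric for even i and alternating for odd i.  The elements of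
-- C_G(g) preserve this form and [V, g].  Hence the largest size i at which v + [V, g] has a nonzero
-- component x, and for even i also the value of the form at x, are invariants of the orbit.
--
-- They determine the orbit by Witt's argument.  For even i, C_G(g) contains the reflections in the
-- subspaces spanned by u, νu, ν²u, … for anisotropic u ∈ ker νⁱ, and these act on V/[V, g] as
-- reflections in u.  For odd i it contains the Cayley transforms of skew operators
-- x ↦ Σ B(νʲ x, u) νᵏ u + …, which act on V/[V, g] as transvections along u.  Since u may have
-- components at smaller block sizes, these components of v can be changed at will.
--
-- It remains to count the values of nondegenerate quadratic forms over F_q at nonzero vectors.
module Submission where

-- The adjoint of ν is ν* = g⁻¹ - 1 and not -ν, so naive candidates for symmetric or skew operators
-- fail. This is why the even case meets a triangular Gram matrix and the odd case sums an
-- expression in ν with the same expression in ν*. On ker νᵏ⁺¹, k + 1 being the block size, the two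
-- agree after k steps up to sign: ν*ᵏ = (-1)ᵏ νᵏ. That sign separates symmetric from alternating
-- sizes.
--
-- A transvection of V/[V, g] has no evident lift to C_G(g), whereas a skew operator commuting with
-- g can be written down; its Cayley transform is an isometry whose effect modulo [V, g] is still
-- computable.
--
-- Eigenvalues other than 1 drop out because Fitting's argument moves any v into V₁ modulo [V, g].
-- Linear algebra is done by counting: over q elements the pigeonhole principle yields kernels, and
-- from them inverses and Fitting's lemma, without bases or dimensions. "Nonzero component at size k
-- + 1" is likewise expressed by a nonzero pairing rather than by coordinates.
--
-- The leading 1 of the formula is the orbit of the zero coset; each size then contributes the
-- number of values available to a nonzero top component.

open import Defs
open import Level using (0ℓ)
open import Algebra.Bundles using (CommutativeRing)
open import Data.Bool using (Bool; true; false; if_then_else_)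
open import Data.Fin as Fin using (Fin; zero; suc; toℕ)
import Data.Fin.Properties as Finₚ
open import Data.Integer as ℤ using (ℤ; +_; -[1+_])
import Data.Integer.Properties as ℤₚ
open import Data.Maybe using (Maybe; just; nothing)
open import Data.Nat as ℕ using (ℕ; zero; suc; _%_; _/_)
import Data.Nat.DivMod as ℕ
import Data.Nat.Properties as ℕₚ
open import Data.Product using (Σ; ∃; _×_; _,_; proj₁; proj₂)
open import Data.Sum using (_⊎_; inj₁; inj₂; [_,_]′)
open import Function using (_∘_; id)
open import Function.Bundles using (_⇔_; Equivalence)
open import Function.Construct.Composition using (_⇔-∘_)
open import Relation.Binary.Bundles using (Setoid)
open import Relation.Binary.Definitions using (Decidable; tri<; tri≈; tri>)
open import Relation.Binary.PropositionalEquality as ≡ using (_≡_)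
open import Relation.Nullary using (¬_; yes; no; contradiction)
open import Relation.Nullary.Decidable using (map′; ¬?; decidable-stable)
import Relation.Unary as U

-- OrthJordanData.Isotropic reindexes the generators along a local function Fin 2 → Fin (a i), which
-- cannot be named from outside and on which `with` is ill-typed, since the equation a i ≡ 2 occurs
-- in it twice.  That function ignores the Jordan data, and Agda's conversion disregards such arguments.
-- So it may be read off from Jordan data over a ring of formal terms, where a is an arbitrary
-- constant function and the equation can be matched on.
module Reindexing where
  data Term (A : Set) : Set where
    var     : A → Term A
    null    : Term A
    _⊞_ _⊠_ : Term A → Term A → Term A

  -- An indiscrete equality: ring axioms and the fields of the Jordan data become trivial, while
  -- terms keep their syntax and can be taken apart by matching.
  data Total {A : Set} (x y : A) : Set where
    total : Total x y

  termRing : Set → CommutativeRing 0ℓ 0ℓ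
  termRing A = record
    { Carrier = Term A ; _≈_ = Total ; _+_ = _⊞_ ; _*_ = _⊠_ ; -_ = λ x → x ; 0# = null ; 1# = null
    ; isCommutativeRing = record
      { isRing = record
        { +-isAbelianGroup = record
          { isGroup = record
            { isMonoid = record
              { isSemigroup = record
                { isMagma = record
                  { isEquivalence = record { refl = total ; sym = λ _ → total ; trans = λ _ _ → total }
                  ; ∙-cong = λ _ _ → total }
                ; assoc = λ _ _ _ → total }
              ; identity = (λ _ → total) , (λ _ → total) }
            ; inverse = (λ _ → total) , (λ _ → total)
            ; ⁻¹-cong = λ _ → total }
          ; comm = λ _ _ → total }
        ; *-cong = λ _ _ → total
        ; *-assoc = λ _ _ _ → total
        ; *-identity = (λ _ → total) , (λ _ → total)
        ; distrib = (λ _ _ _ → total) , (λ _ _ _ → total) }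
      ; *-comm = λ _ _ → total } }

  module Generic (n : ℕ) where
    open LinAlg (termRing (Fin n)) public

    null-matrix : Mat 1
    null-matrix _ _ = null

    data′ : OrthJordanData null-matrix null-matrix
    data′ = record
      { a = λ _ → n ; e = λ _ j _ → var j
      ; chain-end = λ _ _ _ → total ; in-V₁ = λ _ _ _ → total
      ; independent = λ _ _ _ _ _ → total ; spanning = λ _ _ → (λ _ _ _ → null) , λ _ → total
      ; orthogonal = λ _ _ _ _ _ _ _ → total }

  -- Unification of the Σ-type `Isotropic` with this shape recovers its quadratic form as a function
  -- `f`, which is otherwise not accessible.
  quadratic-form-of : ∀ {A T : Set} {P : T → Set} {f : T → Term A} (S : Set) →
                      S ≡ (Σ T λ x → P x × Total (f x) null) → T → Term A
  quadratic-form-of {f = f} _ _ = f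

  -- The left factor of the Gram matrix entries (0 , 0) and (1 , 0).
  entry : ∀ {A} → Fin 2 → Term A → Term A
  entry zero       ((((_ ⊠ ((((c ⊠ _) ⊠ _) ⊞ _) ⊞ _)) ⊠ _) ⊞ _) ⊞ _) = c
  entry (suc zero) (_ ⊞ ((((_ ⊠ ((((c ⊠ _) ⊠ _) ⊞ _) ⊞ _)) ⊠ _) ⊞ _) ⊞ _)) = c
  entry _          t = t

  -- The first clause leaves the equation unmatched, so `reindex` computes even while that equation
  -- is a variable. The second clause is a default for terms that the Gram entries never produce.
  index-of : ∀ {n} → n ≡ 2 → Term (Fin n) → Fin n
  index-of _      (var j) = j
  index-of ≡.refl _       = zero

  reindex : (n : ℕ) → n ≡ 2 → Fin 2 → Fin n
  reindex n eq j = index-of eq (entry j (quadratic-form-of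
    (Generic.OrthJordanData.Isotropic n (Generic.data′ n) zero eq) ≡.refl (λ _ → null)))

-- Ring solver with integer coefficients

module IntegerCoefficients (R : CommutativeRing 0ℓ 0ℓ) where
  open CommutativeRing R
  open import Algebra.Solver.Ring.AlmostCommutativeRing
    using (AlmostCommutativeRing; fromCommutativeRing; _-Raw-AlmostCommutative⟶_)
  open import Algebra.Properties.Semiring.Mult.TCOptimised semiring
    using (×-homo-+; ×1-homo-*; 1+×) renaming (_×_ to infixl 8 _⋆_)
  open import Algebra.Properties.Ring ring
    using (-‿distribˡ-*; -‿distribʳ-*; -‿involutive)
  open import Algebra.Properties.AbelianGroup +-abelianGroup using (⁻¹-∙-comm; ε⁻¹≈ε)
  open import Relation.Binary.Reasoning.Setoid setoid

  fromℤ : ℤ → Carrier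
  fromℤ (+ n)    = n ⋆ 1#
  fromℤ -[1+ n ] = - (suc n ⋆ 1#)

  private
    cancel-1 : ∀ x y → x - y ≈ (1# + x) - (1# + y)
    cancel-1 x y = begin
      x - y                       ≈⟨ +-congʳ (+-identityˡ x) ⟨
      (0# + x) - y                ≈⟨ +-congʳ (+-congʳ (-‿inverseʳ 1#)) ⟨
      ((1# - 1#) + x) - y         ≈⟨ +-congʳ (+-assoc _ _ _) ⟩
      (1# + (- 1# + x)) - y       ≈⟨ +-congʳ (+-congˡ (+-comm _ _)) ⟩
      (1# + (x - 1#)) - y         ≈⟨ +-congʳ (+-assoc _ _ _) ⟨
      ((1# + x) - 1#) - y         ≈⟨ +-assoc _ _ _ ⟩
      (1# + x) + (- 1# - y)       ≈⟨ +-congˡ (⁻¹-∙-comm 1# y) ⟩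
      (1# + x) - (1# + y)         ∎

  fromℤ-⊖ : ∀ m n → fromℤ (m ℤ.⊖ n) ≈ m ⋆ 1# - n ⋆ 1#
  fromℤ-⊖ m zero = sym (trans (+-congˡ ε⁻¹≈ε) (+-identityʳ _))
  fromℤ-⊖ zero (suc n) = sym (+-identityˡ _)
  fromℤ-⊖ (suc m) (suc n) = begin
    fromℤ (suc m ℤ.⊖ suc n)            ≡⟨ ≡.cong fromℤ (ℤₚ.[1+m]⊖[1+n]≡m⊖n m n) ⟩
    fromℤ (m ℤ.⊖ n)                    ≈⟨ fromℤ-⊖ m n ⟩
    m ⋆ 1# - n ⋆ 1#                    ≈⟨ cancel-1 _ _ ⟩
    (1# + m ⋆ 1#) - (1# + n ⋆ 1#)      ≈⟨ +-cong (sym (1+× m 1#)) (-‿cong (sym (1+× n 1#))) ⟩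
    suc m ⋆ 1# - suc n ⋆ 1#            ∎

  fromℤ-neg : ∀ i → fromℤ (ℤ.- i) ≈ - fromℤ i
  fromℤ-neg (+ zero)  = sym ε⁻¹≈ε
  fromℤ-neg (+ suc n) = refl
  fromℤ-neg -[1+ n ]  = sym (-‿involutive _)

  fromℤ-+ : ∀ i j → fromℤ (i ℤ.+ j) ≈ fromℤ i + fromℤ j
  fromℤ-+ (+ m)    (+ n)    = ×-homo-+ 1# m n
  fromℤ-+ (+ m)    -[1+ n ] = fromℤ-⊖ m (suc n)
  fromℤ-+ -[1+ m ] (+ n)    = trans (fromℤ-⊖ n (suc m)) (+-comm _ _)
  fromℤ-+ -[1+ m ] -[1+ n ] = begin
    - (suc (suc (m ℕ.+ n)) ⋆ 1#)        ≡⟨ ≡.cong (λ k → - (k ⋆ 1#)) (≡.sym (+-suc′ m n)) ⟩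
    - ((suc m ℕ.+ suc n) ⋆ 1#)          ≈⟨ -‿cong (×-homo-+ 1# (suc m) (suc n)) ⟩
    - (suc m ⋆ 1# + suc n ⋆ 1#)         ≈⟨ ⁻¹-∙-comm _ _ ⟨
    - (suc m ⋆ 1#) + - (suc n ⋆ 1#)     ∎
    where
    open import Data.Nat.Properties using (+-suc)
    +-suc′ : ∀ m n → suc m ℕ.+ suc n ≡.≡ suc (suc (m ℕ.+ n))
    +-suc′ m n = ≡.cong suc (+-suc m n)

  private
    fromℤ-*-+ : ∀ m j → fromℤ (+ m ℤ.* j) ≈ fromℤ (+ m) * fromℤ j
    fromℤ-*-+ m (+ n) = begin
      fromℤ (+ m ℤ.* + n)  ≡⟨ ≡.cong fromℤ (ℤₚ.pos-* m n) ⟨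
      (m ℕ.* n) ⋆ 1#       ≈⟨ ×1-homo-* m n ⟩
      m ⋆ 1# * n ⋆ 1#      ∎
    fromℤ-*-+ m -[1+ n ] = begin
      fromℤ (+ m ℤ.* -[1+ n ])       ≡⟨ ≡.cong fromℤ (ℤₚ.neg-distribʳ-* (+ m) (+ suc n)) ⟨
      fromℤ (ℤ.- (+ m ℤ.* + suc n))  ≈⟨ fromℤ-neg (+ m ℤ.* + suc n) ⟩
      - fromℤ (+ m ℤ.* + suc n)      ≈⟨ -‿cong (fromℤ-*-+ m (+ suc n)) ⟩
      - (m ⋆ 1# * suc n ⋆ 1#)        ≈⟨ -‿distribʳ-* _ _ ⟩
      m ⋆ 1# * - (suc n ⋆ 1#)        ∎

  fromℤ-* : ∀ i j → fromℤ (i ℤ.* j) ≈ fromℤ i * fromℤ j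
  fromℤ-* (+ m)    j = fromℤ-*-+ m j
  fromℤ-* -[1+ m ] j = begin
    fromℤ (-[1+ m ] ℤ.* j)          ≡⟨ ≡.cong fromℤ (ℤₚ.neg-distribˡ-* (+ suc m) j) ⟨
    fromℤ (ℤ.- (+ suc m ℤ.* j))     ≈⟨ fromℤ-neg (+ suc m ℤ.* j) ⟩
    - fromℤ (+ suc m ℤ.* j)         ≈⟨ -‿cong (fromℤ-*-+ (suc m) j) ⟩
    - (suc m ⋆ 1# * fromℤ j)        ≈⟨ -‿distribˡ-* _ _ ⟩
    - (suc m ⋆ 1#) * fromℤ j        ∎

  fromℤ-morphism : ℤ.+-*-rawRing -Raw-AlmostCommutative⟶ fromCommutativeRing R
  fromℤ-morphism = record
    { ⟦_⟧ = fromℤ ; +-homo = fromℤ-+ ; *-homo = fromℤ-* ; -‿homo = fromℤ-neg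
    ; 0-homo = refl ; 1-homo = refl }

  private
    weakDec : ∀ i j → Maybe (fromℤ i ≈ fromℤ j)
    weakDec i j with i ℤ.≟ j
    ... | yes eq = just (reflexive (≡.cong fromℤ eq))
    ... | no _   = nothing

  open import Algebra.Solver.Ring ℤ.+-*-rawRing (fromCommutativeRing R) fromℤ-morphism weakDec public
    using (solve; _:=_; _:+_; _:*_; _:-_; :-_; con)

-- Vectors, linear maps and linear forms

module Vectors (R : CommutativeRing 0ℓ 0ℓ) where
  open CommutativeRing R hiding (zero)
  open IntegerCoefficients R
  open LinAlg R
    renaming (_≈v_ to infix 4 _≈v_; _+v_ to infixl 6 _+v_; _-v_ to infixl 6 _-v_; _·s_ to infixr 7 _·s_; _·_ to infixr 8 _·_)
  open import Relation.Binary.Reasoning.Setoid setoid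

  ≈v-setoid : ℕ → Setoid 0ℓ 0ℓ
  ≈v-setoid d = record
    { Carrier = Vect d ; _≈_ = _≈v_
    ; isEquivalence = record
      { refl = λ _ → refl ; sym = λ e i → sym (e i) ; trans = λ e f i → trans (e i) (f i) } }

  module _ {d : ℕ} where
    open Setoid (≈v-setoid d) public
      using () renaming (refl to ≈v-refl; sym to ≈v-sym; trans to ≈v-trans)

  +v-cong : ∀ {d} {x x′ y y′ : Vect d} → x ≈v x′ → y ≈v y′ → x +v y ≈v x′ +v y′
  +v-cong e f i = +-cong (e i) (f i)

  -v-cong : ∀ {d} {x x′ y y′ : Vect d} → x ≈v x′ → y ≈v y′ → x -v y ≈v x′ -v y′
  -v-cong e f i = +-cong (e i) (-‿cong (f i))

  ·s-cong : ∀ {d} {a b} {x y : Vect d} → a ≈ b → x ≈v y → a ·s x ≈v b ·s y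
  ·s-cong e f i = *-cong e (f i)

  ∑F-cong : ∀ d {f g : Fin d → Carrier} → (∀ i → f i ≈ g i) → ∑F d f ≈ ∑F d g
  ∑F-cong zero    e = refl
  ∑F-cong (suc d) e = +-cong (e zero) (∑F-cong d (e ∘ suc))

  ∑F-zero : ∀ d {f : Fin d → Carrier} → (∀ i → f i ≈ 0#) → ∑F d f ≈ 0#
  ∑F-zero zero    e = refl
  ∑F-zero (suc d) e = trans (+-cong (e zero) (∑F-zero d (e ∘ suc))) (+-identityˡ 0#)

  ∑F-+ : ∀ d (f g : Fin d → Carrier) → ∑F d (λ i → f i + g i) ≈ ∑F d f + ∑F d g
  ∑F-+ zero    f g = sym (+-identityˡ 0#)
  ∑F-+ (suc d) f g = trans (+-congˡ (∑F-+ d (f ∘ suc) (g ∘ suc)))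
    (solve 4 (λ a b s t → (a :+ b) :+ (s :+ t) := (a :+ s) :+ (b :+ t)) refl _ _ _ _)

  ∑F-* : ∀ d c (f : Fin d → Carrier) → ∑F d (λ i → c * f i) ≈ c * ∑F d f
  ∑F-* zero    c f = sym (zeroʳ c)
  ∑F-* (suc d) c f = trans (+-congˡ (∑F-* d c (f ∘ suc))) (sym (distribˡ c _ _))

  ∑F-single : ∀ d (k : Fin d) {f : Fin d → Carrier} → (∀ i → ¬ i ≡ k → f i ≈ 0#) → ∑F d f ≈ f k
  ∑F-single (suc d) zero    e =
    trans (+-congˡ (∑F-zero d (λ i → e (suc i) λ ()))) (+-identityʳ _)
  ∑F-single (suc d) (suc k) e =
    trans (+-cong (e zero λ ()) (∑F-single d k (λ i i≢k → e (suc i) (i≢k ∘ Finₚ.suc-injective))))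
          (+-identityˡ _)

  ∑v-at : ∀ {d} k (f : Fin k → Vect d) i → ∑v k f i ≈ ∑F k (λ j → f j i)
  ∑v-at zero    f i = refl
  ∑v-at (suc k) f i = +-congˡ (∑v-at k (f ∘ suc) i)

  ∑v-cong : ∀ {d} k {f g : Fin k → Vect d} → (∀ i → f i ≈v g i) → ∑v k f ≈v ∑v k g
  ∑v-cong zero    e = ≈v-refl
  ∑v-cong (suc d) e = +v-cong (e zero) (∑v-cong d (e ∘ suc))

  ∑v-zero : ∀ {d} k {f : Fin k → Vect d} → (∀ i → f i ≈v 0v) → ∑v k f ≈v 0v
  ∑v-zero k {f} e i = trans (∑v-at k f i) (∑F-zero k (λ j → e j i))

  ∑v-single : ∀ {d} n (k : Fin n) {f : Fin n → Vect d} → (∀ i → ¬ i ≡ k → f i ≈v 0v) → ∑v n f ≈v f k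
  ∑v-single n k {f} e i = trans (∑v-at n f i) (∑F-single n k (λ j j≢k → e j j≢k i))

  -- Operators are kept as functions, so that composites, powers and inverses need no matrix
  -- product; `matrix` converts back where an element of the group has to be a matrix.
  record Linear {a b} (f : Vect a → Vect b) : Set where
    field
      cong : ∀ {x y} → x ≈v y → f x ≈v f y
      +-homo : ∀ x y → f (x +v y) ≈v f x +v f y
      ·s-homo : ∀ c x → f (c ·s x) ≈v c ·s f x

    0-homo : f 0v ≈v 0v
    0-homo i = trans (cong (λ _ → sym (zeroˡ 0#)) i) (trans (·s-homo 0# 0v i) (zeroˡ _))

    -v-homo : ∀ x y → f (x -v y) ≈v f x -v f y
    -v-homo x y i = begin
      f (x -v y) i
        ≈⟨ cong (λ j → solve 2 (λ p q → p :- q := p :+ con (ℤ.- + 1) :* q) refl (x j) (y j)) i ⟩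
      f (x +v (- 1#) ·s y) i          ≈⟨ +-homo x _ i ⟩
      f x i + f ((- 1#) ·s y) i       ≈⟨ +-congˡ (·s-homo (- 1#) y i) ⟩
      f x i + (- 1#) * f y i
        ≈⟨ solve 2 (λ p q → p :+ con (ℤ.- + 1) :* q := p :- q) refl _ _ ⟩
      f x i - f y i                   ∎

    ∑-homo : ∀ k (h : Fin k → Vect a) → f (∑v k h) ≈v ∑v k (f ∘ h)
    ∑-homo zero    h = 0-homo
    ∑-homo (suc k) h = ≈v-trans (+-homo (h zero) (∑v k (h ∘ suc))) (+v-cong ≈v-refl (∑-homo k (h ∘ suc)))

  record LinearForm {a} (φ : Vect a → Carrier) : Set where
    field
      cong : ∀ {x y} → x ≈v y → φ x ≈ φ y
      +-homo : ∀ x y → φ (x +v y) ≈ φ x + φ y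
      ·s-homo : ∀ c x → φ (c ·s x) ≈ c * φ x

    0-homo : φ 0v ≈ 0#
    0-homo = trans (cong (λ _ → sym (zeroˡ 0#))) (trans (·s-homo 0# 0v) (zeroˡ _))

    zero-homo : ∀ {x} → x ≈v 0v → φ x ≈ 0#
    zero-homo e = trans (cong e) 0-homo

    -v-homo : ∀ x y → φ (x -v y) ≈ φ x - φ y
    -v-homo x y = begin
      φ (x -v y)
        ≈⟨ cong (λ j → solve 2 (λ p q → p :- q := p :+ con (ℤ.- + 1) :* q) refl (x j) (y j)) ⟩
      φ (x +v (- 1#) ·s y)        ≈⟨ +-homo x _ ⟩
      φ x + φ ((- 1#) ·s y)       ≈⟨ +-congˡ (·s-homo (- 1#) y) ⟩
      φ x + (- 1#) * φ y
        ≈⟨ solve 2 (λ p q → p :+ con (ℤ.- + 1) :* q := p :- q) refl _ _ ⟩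
      φ x - φ y                   ∎

    ∑-homo : ∀ k (h : Fin k → Vect a) → φ (∑v k h) ≈ ∑F k (φ ∘ h)
    ∑-homo zero    h = 0-homo
    ∑-homo (suc k) h = trans (+-homo (h zero) (∑v k (h ∘ suc))) (+-congˡ (∑-homo k (h ∘ suc)))

  id-linear : ∀ {d} → Linear (id {A = Vect d})
  id-linear = record { cong = id ; +-homo = λ _ _ → ≈v-refl ; ·s-homo = λ _ _ → ≈v-refl }

  ∘-linear : ∀ {a b c} {f : Vect b → Vect c} {g : Vect a → Vect b} →
             Linear f → Linear g → Linear (λ x → f (g x))
  ∘-linear F G = record
    { cong = F.cong ∘ G.cong
    ; +-homo = λ x y → ≈v-trans (F.cong (G.+-homo x y)) (F.+-homo _ _)
    ; ·s-homo = λ c x → ≈v-trans (F.cong (G.·s-homo c x)) (F.·s-homo _ _) }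
    where
    module F = Linear F
    module G = Linear G

  +-linear : ∀ {a b} {f g : Vect a → Vect b} → Linear f → Linear g → Linear (λ x → f x +v g x)
  +-linear F G = record
    { cong = λ e → +v-cong (F.cong e) (G.cong e)
    ; +-homo = λ x y i → trans (+v-cong (F.+-homo x y) (G.+-homo x y) i)
        (solve 4 (λ a b s t → (a :+ b) :+ (s :+ t) := (a :+ s) :+ (b :+ t)) refl _ _ _ _)
    ; ·s-homo = λ c x i → trans (+v-cong (F.·s-homo c x) (G.·s-homo c x) i) (sym (distribˡ _ _ _)) }
    where
    module F = Linear F
    module G = Linear G

  ·s-linear : ∀ {a b} c {f : Vect a → Vect b} → Linear f → Linear (λ x → c ·s f x)
  ·s-linear c F = record
    { cong = λ e → ·s-cong refl (F.cong e)
    ; +-homo = λ x y i → trans (*-congˡ (F.+-homo x y i)) (distribˡ _ _ _)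
    ; ·s-homo = λ b x i → trans (*-congˡ (F.·s-homo b x i))
        (solve 3 (λ c b t → c :* (b :* t) := b :* (c :* t)) refl _ _ _) }
    where module F = Linear F

  -v-linear : ∀ {a b} {f g : Vect a → Vect b} → Linear f → Linear g → Linear (λ x → f x -v g x)
  -v-linear F G = record
    { cong = λ e → -v-cong (F.cong e) (G.cong e)
    ; +-homo = λ x y i → trans (-v-cong (F.+-homo x y) (G.+-homo x y) i)
        (solve 4 (λ a b s t → (a :+ b) :- (s :+ t) := (a :- s) :+ (b :- t)) refl _ _ _ _)
    ; ·s-homo = λ c x i → trans (-v-cong (F.·s-homo c x) (G.·s-homo c x) i)
        (solve 3 (λ c s t → c :* s :- c :* t := c :* (s :- t)) refl _ _ _) }
    where
    module F = Linear F
    module G = Linear G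

  rank-one-linear : ∀ {a b} {φ : Vect a → Carrier} → LinearForm φ → (w : Vect b) → Linear (λ x → φ x ·s w)
  rank-one-linear Φ w = record
    { cong = λ e → ·s-cong (Φ.cong e) ≈v-refl
    ; +-homo = λ x y i → trans (*-congʳ (Φ.+-homo x y)) (distribʳ _ _ _)
    ; ·s-homo = λ c x i → trans (*-congʳ (Φ.·s-homo c x)) (*-assoc _ _ _) }
    where module Φ = LinearForm Φ

  ∘-form : ∀ {a b} {φ : Vect b → Carrier} {g : Vect a → Vect b} →
           LinearForm φ → Linear g → LinearForm (λ x → φ (g x))
  ∘-form F G = record
    { cong = F.cong ∘ G.cong
    ; +-homo = λ x y → trans (F.cong (G.+-homo x y)) (F.+-homo _ _)
    ; ·s-homo = λ c x → trans (F.cong (G.·s-homo c x)) (F.·s-homo _ _) }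
    where
    module F = LinearForm F
    module G = Linear G

  head-form : ∀ {k} → LinearForm (λ (c : Vect (suc k)) → c zero)
  head-form = record { cong = λ e → e zero ; +-homo = λ _ _ → refl ; ·s-homo = λ _ _ → refl }

  tail-linear : ∀ {k} → Linear (λ (c : Vect (suc k)) → c ∘ suc)
  tail-linear = record { cong = λ e → e ∘ suc ; +-homo = λ _ _ _ → refl ; ·s-homo = λ _ _ _ → refl }

  combination-linear : ∀ {d} k (w : Fin k → Vect d) → Linear (λ c → ∑v k (λ j → c j ·s w j))
  combination-linear zero    w = record
    { cong = λ _ → ≈v-refl ; +-homo = λ _ _ _ → sym (+-identityˡ 0#) ; ·s-homo = λ _ _ _ → sym (zeroʳ _) }
  combination-linear (suc k) w =
    +-linear (rank-one-linear head-form (w zero)) (∘-linear (combination-linear k (w ∘ suc)) tail-linear)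

  pow : ∀ {d} → (Vect d → Vect d) → ℕ → Vect d → Vect d
  pow f zero    v = v
  pow f (suc k) v = f (pow f k v)

  pow-linear : ∀ {d} {f : Vect d → Vect d} → Linear f → ∀ k → Linear (pow f k)
  pow-linear F zero    = id-linear
  pow-linear F (suc k) = ∘-linear F (pow-linear F k)

  pow-+ : ∀ {d} (f : Vect d → Vect d) j k v → pow f (j ℕ.+ k) v ≡ pow f j (pow f k v)
  pow-+ f zero    k v = ≡.refl
  pow-+ f (suc j) k v = ≡.cong f (pow-+ f j k v)

  pow-suc : ∀ {d} (f : Vect d → Vect d) k v → pow f k (f v) ≡ pow f (suc k) v
  pow-suc f zero    v = ≡.refl
  pow-suc f (suc k) v = ≡.cong f (pow-suc f k v)

  pow-commute : ∀ {d} {f h : Vect d → Vect d} → Linear f → (∀ v → h (f v) ≈v f (h v)) →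
                ∀ k v → h (pow f k v) ≈v pow f k (h v)
  pow-commute F c zero    v = ≈v-refl
  pow-commute F c (suc k) v = ≈v-trans (c _) (Linear.cong F (pow-commute F c k v))

  pow-zero-≤ : ∀ {d} {f : Vect d → Vect d} → Linear f → ∀ {j k v} → j ℕ.≤ k → pow f j v ≈v 0v → pow f k v ≈v 0v
  pow-zero-≤ {f = f} F {j} {k} {v} j≤k e with ℕₚ.m≤n⇒∃[o]m+o≡n j≤k
  ... | o , ≡.refl = λ i → trans
    (reflexive (≡.cong (λ t → t i) (≡.trans (≡.cong (λ t → pow f t v) (ℕₚ.+-comm j o)) (pow-+ f o j v))))
    (trans (cong e i) (0-homo i))
    where open Linear (pow-linear F o)

  δ : ∀ {d} → Fin d → Vect d
  δ j i with i Fin.≟ j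
  ... | yes _ = 1#
  ... | no  _ = 0#

  δ-diag : ∀ {d} (j : Fin d) → δ j j ≈ 1#
  δ-diag j with j Fin.≟ j
  ... | yes _ = refl
  ... | no ¬p = contradiction ≡.refl ¬p

  δ-off : ∀ {d} {i j : Fin d} → ¬ i ≡ j → δ j i ≈ 0#
  δ-off {i = i} {j} i≢j with i Fin.≟ j
  ... | yes p = contradiction p i≢j
  ... | no  _ = refl

  δ-expansion : ∀ {d} (x : Vect d) → ∑v d (λ j → x j ·s δ j) ≈v x
  δ-expansion {d} x i = begin
    ∑v d (λ j → x j ·s δ j) i    ≈⟨ ∑v-at d _ i ⟩
    ∑F d (λ j → x j * δ j i)     ≈⟨ ∑F-single d i (λ j j≢i → trans (*-congˡ (δ-off (j≢i ∘ ≡.sym))) (zeroʳ _)) ⟩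
    x i * δ i i                  ≈⟨ *-congˡ (δ-diag i) ⟩
    x i * 1#                     ≈⟨ *-identityʳ _ ⟩
    x i                          ∎

  matrix : ∀ {d} → (Vect d → Vect d) → Mat d
  matrix f i j = f (δ j) i

  matrix-· : ∀ {d} {f : Vect d → Vect d} → Linear f → ∀ x → matrix f · x ≈v f x
  matrix-· {d} {f} F x i = begin
    ∑F d (λ j → f (δ j) i * x j)        ≈⟨ ∑F-cong d (λ j → *-comm _ _) ⟩
    ∑F d (λ j → x j * f (δ j) i)        ≈⟨ ∑v-at d _ i ⟨
    ∑v d (λ j → x j ·s f (δ j)) i       ≈⟨ ∑v-cong d (λ j → F.·s-homo (x j) (δ j)) i ⟨
    ∑v d (λ j → f (x j ·s δ j)) i       ≈⟨ F.∑-homo d _ i ⟨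
    f (∑v d (λ j → x j ·s δ j)) i       ≈⟨ F.cong (δ-expansion x) i ⟩
    f x i                               ∎
    where module F = Linear F

  ·-linear : ∀ {d} (A : Mat d) → Linear (A ·_)
  ·-linear {d} A = record
    { cong = λ e i → ∑F-cong d (λ j → *-congˡ (e j))
    ; +-homo = λ x y i → trans (∑F-cong d (λ j → distribˡ _ _ _)) (∑F-+ d _ _)
    ; ·s-homo = λ c x i → trans
        (∑F-cong d (λ j → solve 3 (λ a c x → a :* (c :* x) := c :* (a :* x)) refl _ _ _)) (∑F-* d c _) }

  form-linearˡ : ∀ {d} (M : Mat d) y → LinearForm (λ x → form M x y)
  form-linearˡ {d} M y = record
    { cong = λ e → ∑F-cong d (λ i → ∑F-cong d (λ j → *-congʳ (*-congʳ (e i))))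
    ; +-homo = λ x x′ → trans
        (∑F-cong d (λ i → trans
          (∑F-cong d (λ j → solve 4 (λ x x′ m y → (x :+ x′) :* m :* y := x :* m :* y :+ x′ :* m :* y) refl _ _ _ _))
          (∑F-+ d _ _)))
        (∑F-+ d _ _)
    ; ·s-homo = λ c x → trans
        (∑F-cong d (λ i → trans
          (∑F-cong d (λ j → solve 4 (λ c x m y → c :* x :* m :* y := c :* (x :* m :* y)) refl _ _ _ _))
          (∑F-* d c _)))
        (∑F-* d c _) }

  form-linearʳ : ∀ {d} (M : Mat d) x → LinearForm (form M x)
  form-linearʳ {d} M x = record
    { cong = λ e → ∑F-cong d (λ i → ∑F-cong d (λ j → *-congˡ (e j)))
    ; +-homo = λ y y′ → trans
        (∑F-cong d (λ i → trans (∑F-cong d (λ j → distribˡ _ _ _)) (∑F-+ d _ _)))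
        (∑F-+ d _ _)
    ; ·s-homo = λ c y → trans
        (∑F-cong d (λ i → trans
          (∑F-cong d (λ j → solve 3 (λ c m y → m :* (c :* y) := c :* (m :* y)) refl _ _ _))
          (∑F-* d c _)))
        (∑F-* d c _) }

-- Linear algebra over a finite field by counting

funToFin-cong : ∀ {m n} {f g : Fin m → Fin n} → (∀ i → f i ≡ g i) → Fin.funToFin f ≡ Fin.funToFin g
funToFin-cong {zero}  e = ≡.refl
funToFin-cong {suc m} e = ≡.cong₂ Fin.combine (e zero) (funToFin-cong (e ∘ suc))

finToFun-injective : ∀ {n m} {k l : Fin (n ℕ.^ m)} →
                     (∀ i → Fin.finToFun {n} {m} k i ≡ Fin.finToFun l i) → k ≡ l
finToFun-injective {n} {m} {k} {l} e = ≡.trans (≡.sym (Finₚ.funToFin-finToFin {m} {n} k))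
  (≡.trans (funToFin-cong e) (Finₚ.funToFin-finToFin {m} {n} l))

Char≢2 : CommutativeRing 0ℓ 0ℓ → Set
Char≢2 R = ¬ 1# + 1# ≈ 0#
  where open CommutativeRing R

module FiniteField (R : CommutativeRing 0ℓ 0ℓ) (q : ℕ) (F : LinAlg.IsFiniteFieldOfOrder R q) where
  open CommutativeRing R hiding (zero)
  open IntegerCoefficients R
  open Vectors R
  open LinAlg R
    renaming (_≈v_ to infix 4 _≈v_; _+v_ to infixl 6 _+v_; _-v_ to infixl 6 _-v_; _·s_ to infixr 7 _·s_; _·_ to infixr 8 _·_)
  open IsFiniteFieldOfOrder F public
  open import Relation.Binary.Reasoning.Setoid setoid

  index : Carrier → Fin q
  index x = proj₁ (enum-surj x)

  enum-index : ∀ x → enum (index x) ≈ x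
  enum-index x = proj₂ (enum-surj x)

  index-cong : ∀ {x y} → x ≈ y → index x ≡ index y
  index-cong {x} {y} e = enum-inj _ _ (trans (enum-index x) (trans e (sym (enum-index y))))

  index-injective : ∀ {x y} → index x ≡ index y → x ≈ y
  index-injective {x} {y} e =
    trans (sym (enum-index x)) (trans (reflexive (≡.cong enum e)) (enum-index y))

  index-enum : ∀ i → index (enum i) ≡ i
  index-enum i = enum-inj _ _ (enum-index (enum i))

  infix 4 _≈?_
  _≈?_ : Decidable _≈_
  x ≈? y = map′ index-injective index-cong (index x Fin.≟ index y)

  -- 0# ⁻¹ is 0#.
  infix 9 _⁻¹
  _⁻¹ : Carrier → Carrier
  x ⁻¹ with x ≈? 0#
  ... | yes _   = 0#
  ... | no x≉0 = proj₁ (inverse x x≉0)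

  ⁻¹-inverseʳ : ∀ {x} → ¬ x ≈ 0# → x * x ⁻¹ ≈ 1#
  ⁻¹-inverseʳ {x} x≉0 with x ≈? 0#
  ... | yes x≈0 = contradiction x≈0 x≉0
  ... | no x≉0′ = proj₂ (inverse x x≉0′)

  *-cancelˡ : ∀ {x y z} → ¬ x ≈ 0# → x * y ≈ x * z → y ≈ z
  *-cancelˡ {x} {y} {z} x≉0 e = begin
    y                  ≈⟨ *-identityˡ y ⟨
    1# * y             ≈⟨ *-congʳ xx⁻¹ ⟨
    x * x⁻¹ * y        ≈⟨ solve 3 (λ x i y → x :* i :* y := i :* (x :* y)) refl x x⁻¹ y ⟩
    x⁻¹ * (x * y)      ≈⟨ *-congˡ e ⟩
    x⁻¹ * (x * z)      ≈⟨ solve 3 (λ x i y → i :* (x :* y) := x :* i :* y) refl x x⁻¹ z ⟩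
    x * x⁻¹ * z        ≈⟨ *-congʳ xx⁻¹ ⟩
    1# * z             ≈⟨ *-identityˡ z ⟩
    z                  ∎
    where x⁻¹ = x ⁻¹ ; xx⁻¹ = ⁻¹-inverseʳ x≉0

  *-integral : ∀ {x y} → x * y ≈ 0# → ¬ x ≈ 0# → y ≈ 0#
  *-integral e x≉0 = *-cancelˡ x≉0 (trans e (sym (zeroʳ _)))

  *-nonzero : ∀ {x y} → ¬ x ≈ 0# → ¬ y ≈ 0# → ¬ x * y ≈ 0#
  *-nonzero x≉0 y≉0 e = y≉0 (*-integral e x≉0)

  -‿nonzero : ∀ {x} → ¬ x ≈ 0# → ¬ - x ≈ 0#
  -‿nonzero {x} x≉0 e = x≉0 (begin
    x        ≈⟨ solve 1 (λ x → x := :- (:- x)) refl x ⟩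
    - (- x)  ≈⟨ -‿cong e ⟩
    - 0#     ≈⟨ solve 0 (:- con (+ 0) := con (+ 0)) refl ⟩
    0#       ∎)

  x-y≈0⇒x≈y : ∀ {x y} → x - y ≈ 0# → x ≈ y
  x-y≈0⇒x≈y {x} {y} e = begin
    x           ≈⟨ solve 2 (λ x y → x := x :- y :+ y) refl x y ⟩
    x - y + y   ≈⟨ +-congʳ e ⟩
    0# + y      ≈⟨ +-identityˡ y ⟩
    y           ∎

  x≈y⇒x-y≈0 : ∀ {x y} → x ≈ y → x - y ≈ 0#
  x≈y⇒x-y≈0 {x} {y} e = trans (+-congʳ e) (-‿inverseʳ y)

  x≈-x⇒x≈0 : Char≢2 R → ∀ {x} → x ≈ - x → x ≈ 0#
  x≈-x⇒x≈0 2≉0 {x} e = *-integral (begin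
    (1# + 1#) * x   ≈⟨ solve 1 (λ x → (con (+ 1) :+ con (+ 1)) :* x := x :+ x) refl x ⟩
    x + x           ≈⟨ +-congˡ e ⟩
    x - x           ≈⟨ -‿inverseʳ x ⟩
    0#              ∎) 2≉0

  2# : Carrier
  2# = 1# + 1#

  zero? : ∀ {d} (x : Vect d) → (∃ λ i → ¬ x i ≈ 0#) ⊎ (x ≈v 0v)
  zero? x with Finₚ.any? (λ i → ¬? (x i ≈? 0#))
  ... | yes p = inj₁ p
  ... | no ¬p = inj₂ (λ i → decidable-stable (x i ≈? 0#) (λ xi≉0 → ¬p (i , xi≉0)))

  nonzero-entry : ∀ {d} {x : Vect d} → ¬ (x ≈v 0v) → ∃ λ i → ¬ x i ≈ 0#
  nonzero-entry {x = x} x≉0 with zero? x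
  ... | inj₁ p = p
  ... | inj₂ e = contradiction e x≉0

  ∑F-nonzero : ∀ {d} {f : Fin d → Carrier} → ¬ ∑F d f ≈ 0# → ∃ λ i → ¬ f i ≈ 0#
  ∑F-nonzero {d} s≉0 = nonzero-entry (s≉0 ∘ ∑F-zero d)

  1<q : 1 ℕ.< q
  1<q = Finₚ.injective⇒≤ {f = f} f-injective
    where
    f : Fin 2 → Fin q
    f zero    = index 0#
    f (suc _) = index 1#
    f-injective : ∀ {i j} → f i ≡ f j → i ≡ j
    f-injective {zero}     {zero}     e = ≡.refl
    f-injective {zero}     {suc zero} e = contradiction (index-injective e) 0≉1
    f-injective {suc zero} {zero}     e = contradiction (index-injective (≡.sym e)) 0≉1
    f-injective {suc zero} {suc zero} e = ≡.refl

  abstract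
    -- There are more source than target vectors, so two source vectors have the same image.
    kernel : ∀ {a m} {L : Vect a → Vect m} → Linear L → m ℕ.< a →
             ∃ λ c → (∃ λ i → ¬ c i ≈ 0#) × L c ≈v 0v
    kernel {a} {m} {L} lin m<a with Finₚ.pigeonhole (ℕₚ.^-monoʳ-< q 1<q m<a) (Fin.funToFin ∘ image)
      where
      image : Fin (q ℕ.^ a) → Fin m → Fin q
      image k = index ∘ L (enum ∘ Fin.finToFun k)
    ... | k , l , k<l , e = vk -v vl , nonzero-entry distinct , λ i → trans (-v-homo vk vl i) (x≈y⇒x-y≈0 (same i))
      where
      open Linear lin
      vk vl : Vect a
      vk = enum ∘ Fin.finToFun k
      vl = enum ∘ Fin.finToFun l
      distinct : ¬ (vk -v vl ≈v 0v)
      distinct z = Finₚ.<⇒≢ k<l (finToFun-injective {q} {a} (λ i → enum-inj _ _ (x-y≈0⇒x≈y (z i))))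
      same : L vk ≈v L vl
      same i = index-injective (≡.trans (≡.sym (Finₚ.finToFun-funToFin {m} _ i))
        (≡.trans (≡.cong (λ t → Fin.finToFun t i) e) (Finₚ.finToFun-funToFin {m} _ i)))

  abstract
    -- The map (c , x) ↦ c v + f x goes from dimension d + 1 to d, so it has a nonzero kernel
    -- vector. Injectivity of f forces its coefficient c to be nonzero, and dividing by -c gives a
    -- preimage of v.
    injective⇒surjective : ∀ {d} {f : Vect d → Vect d} → Linear f → (∀ x → f x ≈v 0v → x ≈v 0v) →
                           ∀ v → ∃ λ u → f u ≈v v
    injective⇒surjective {d} {f} F inj v =
      let c , nz , z = kernel (+-linear (rank-one-linear head-form v) (∘-linear F tail-linear)) (ℕₚ.n<1+n d)
      in preimage c nz z
      where
      preimage : (c : Vect (suc d)) → (∃ λ i → ¬ c i ≈ 0#) → c zero ·s v +v f (c ∘ suc) ≈v 0v → ∃ λ u → f u ≈v v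
      preimage c (i , ci≉0) z with c zero ≈? 0#
      ... | yes c₀≈0 = contradiction (c≈0 i) ci≉0
        where
        c≈0 : ∀ i → c i ≈ 0#
        c≈0 zero    = c₀≈0
        c≈0 (suc i) = inj (c ∘ suc) (λ j → trans
          (trans (sym (+-identityˡ (f (c ∘ suc) j))) (+-congʳ (sym (trans (*-congʳ c₀≈0) (zeroˡ (v j)))))) (z j)) i
      ... | no c₀≉0 = (- c₀⁻¹) ·s (c ∘ suc) , λ j → begin
        f ((- c₀⁻¹) ·s (c ∘ suc)) j           ≈⟨ Linear.·s-homo F (- c₀⁻¹) (c ∘ suc) j ⟩
        - c₀⁻¹ * f (c ∘ suc) j
          ≈⟨ solve 4 (λ k i v t → :- i :* t := k :* i :* v :- i :* (k :* v :+ t)) refl (c zero) c₀⁻¹ (v j) (f (c ∘ suc) j) ⟩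
        c zero * c₀⁻¹ * v j - c₀⁻¹ * (c zero * v j + f (c ∘ suc) j)
          ≈⟨ +-cong (*-congʳ (⁻¹-inverseʳ c₀≉0)) (-‿cong (*-congˡ (z j))) ⟩
        1# * v j - c₀⁻¹ * 0#
          ≈⟨ solve 2 (λ v i → con (+ 1) :* v :- i :* con (+ 0) := v) refl (v j) c₀⁻¹ ⟩
        v j                                   ∎
        where
        c₀⁻¹ : Carrier
        c₀⁻¹ = c zero ⁻¹

  record LinearInverse {d} (f : Vect d → Vect d) : Set where
    field
      f⁻¹ : Vect d → Vect d
      linear : Linear f⁻¹
      inverseʳ : ∀ x → f (f⁻¹ x) ≈v x
      inverseˡ : ∀ x → f⁻¹ (f x) ≈v x

  abstract
    injective⇒inverse : ∀ {d} {f : Vect d → Vect d} → Linear f → (∀ x → f x ≈v 0v → x ≈v 0v) → LinearInverse f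
    injective⇒inverse {d} {f} F inj = inverse-of (λ v → proj₁ (surj v)) (λ v → proj₂ (surj v))
      where
      surj : ∀ v → ∃ λ u → f u ≈v v
      surj = injective⇒surjective F inj
      open Linear F
      f-injective : ∀ x y → f x ≈v f y → x ≈v y
      f-injective x y e i =
        x-y≈0⇒x≈y (inj (x -v y) (λ i → trans (-v-homo x y i) (x≈y⇒x-y≈0 (e i))) i)
      inverse-of : (h : Vect d → Vect d) → (∀ v → f (h v) ≈v v) → LinearInverse f
      inverse-of h right = record
        { f⁻¹ = h
        ; linear = record
          { cong = λ {x} {y} e → f-injective (h x) (h y) (≈v-trans (right x) (≈v-trans e (≈v-sym (right y))))
          ; +-homo = λ x y → f-injective (h (x +v y)) (h x +v h y) (≈v-trans (right (x +v y))
              (≈v-sym (≈v-trans (+-homo (h x) (h y)) (+v-cong (right x) (right y)))))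
          ; ·s-homo = λ c x → f-injective (h (c ·s x)) (c ·s h x) (≈v-trans (right (c ·s x))
              (≈v-sym (≈v-trans (·s-homo c (h x)) (·s-cong refl (right x))))) }
        ; inverseʳ = right
        ; inverseˡ = λ x → f-injective (h (f x)) x (right (f x)) }

  private
    module Polynomial {d} {f : Vect d → Vect d} (F : Linear f) (v : Vect d) where
      open Linear F
      polynomial : ∀ k → Vect k → Vect d
      polynomial zero    c = 0v
      polynomial (suc k) c = c zero ·s v +v f (polynomial k (c ∘ suc))

      polynomial-linear : ∀ k → Linear (polynomial k)
      polynomial-linear zero = record
        { cong = λ _ → ≈v-refl ; +-homo = λ _ _ _ → sym (+-identityˡ 0#) ; ·s-homo = λ _ _ _ → sym (zeroʳ _) }
      polynomial-linear (suc k) =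
        +-linear (rank-one-linear head-form v) (∘-linear F (∘-linear (polynomial-linear k) tail-linear))

      -- `j` counts the vanishing lowest coefficients already split off as factors f. Each one
      -- removed shortens the polynomial by one, so j + k is constant and bounds the exponent
      -- reached at the first nonzero coefficient.
      annihilated : ∀ k j (c : Vect (suc k)) → (∃ λ i → ¬ c i ≈ 0#) → pow f j (polynomial (suc k) c) ≈v 0v →
                    ∃ λ u → pow f (j ℕ.+ k) (v +v f u) ≈v 0v
      annihilated k j c (i , ci≉0) z with c zero ≈? 0#
      annihilated zero    j c (zero , ci≉0) z | yes c₀≈0 = contradiction c₀≈0 ci≉0
      annihilated (suc k) j c (zero , ci≉0) z | yes c₀≈0 = contradiction c₀≈0 ci≉0
      annihilated (suc k) j c (suc i , ci≉0) z | yes c₀≈0 =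
        let u , e = annihilated k (suc j) (c ∘ suc) (i , ci≉0) z′
        in u , ≡.subst (λ t → pow f t (v +v f u) ≈v 0v) (≡.sym (ℕₚ.+-suc j k)) e
        where
        module P = Linear (pow-linear F j)
        t = polynomial (suc k) (c ∘ suc)
        drop-head : c zero ·s v +v f t ≈v f t
        drop-head l = trans (+-congʳ (trans (*-congʳ c₀≈0) (zeroˡ (v l)))) (+-identityˡ (f t l))
        z′ : pow f (suc j) t ≈v 0v
        z′ l = trans (reflexive (≡.cong (λ t → t l) (≡.sym (pow-suc f j t))))
          (trans (sym (P.cong drop-head l)) (z l))
      annihilated k j c (i , ci≉0) z | no c₀≉0 =
        c₀⁻¹ ·s t , pow-zero-≤ F (ℕₚ.m≤m+n j k) (λ l → begin
          pow f j (v +v f (c₀⁻¹ ·s t)) l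
            ≈⟨ P.cong scaled l ⟩
          pow f j (c₀⁻¹ ·s (c zero ·s v +v f t)) l  ≈⟨ P.·s-homo c₀⁻¹ (c zero ·s v +v f t) l ⟩
          c₀⁻¹ * pow f j (c zero ·s v +v f t) l     ≈⟨ *-congˡ (z l) ⟩
          c₀⁻¹ * 0#                                 ≈⟨ zeroʳ _ ⟩
          0#                                        ∎)
        where
        module P = Linear (pow-linear F j)
        c₀⁻¹ : Carrier
        c₀⁻¹ = c zero ⁻¹
        t = polynomial k (c ∘ suc)

        scaled : v +v f (c₀⁻¹ ·s t) ≈v c₀⁻¹ ·s (c zero ·s v +v f t)
        scaled l = begin
          v l + f (c₀⁻¹ ·s t) l               ≈⟨ +-cong (sym (*-identityˡ (v l))) (·s-homo c₀⁻¹ t l) ⟩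
          1# * v l + c₀⁻¹ * f t l             ≈⟨ +-congʳ (*-congʳ (⁻¹-inverseʳ c₀≉0)) ⟨
          c zero * c₀⁻¹ * v l + c₀⁻¹ * f t l
            ≈⟨ solve 4 (λ k i v t → k :* i :* v :+ i :* t := i :* (k :* v :+ t)) refl (c zero) c₀⁻¹ (v l) (f t l) ⟩
          c₀⁻¹ * (c zero * v l + f t l)       ∎

  abstract
    -- A linear relation among v, f v, …, fᵈ v, divided by its lowest nonzero coefficient.
    fitting : ∀ {d} {f : Vect d → Vect d} → Linear f → ∀ v → ∃ λ u → pow f d (v +v f u) ≈v 0v
    fitting {d} F v =
      let open Polynomial F v ; c , nz , z = kernel (polynomial-linear (suc d)) (ℕₚ.n<1+n d)
      in annihilated d 0 c nz z

-- Isometries g, the operators ν and ν*, and congruence modulo [V, g]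

record AlternatingIsometry (R : CommutativeRing 0ℓ 0ℓ) (d : ℕ) : Set where
  open CommutativeRing R
  open Vectors R
  open LinAlg R
  field
    β : Vect d → Vect d → Carrier
    β-linearˡ : ∀ y → LinearForm (λ x → β x y)
    β-linearʳ : ∀ x → LinearForm (β x)
    alternating : ∀ x → β x x ≈ 0#
    nondegenerate : ∀ x → (∀ y → β x y ≈ 0#) → x ≈v 0v
    g : Vect d → Vect d
    g-linear : Linear g
    isometry : ∀ x y → β (g x) (g y) ≈ β x y

module Isometry (R : CommutativeRing 0ℓ 0ℓ) (q : ℕ) (F : LinAlg.IsFiniteFieldOfOrder R q)
                {d : ℕ} (S : AlternatingIsometry R d) where
  open CommutativeRing R hiding (zero)
  open IntegerCoefficients R
  open Vectors R
  open FiniteField R q F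
  open LinAlg R
    renaming (_≈v_ to infix 4 _≈v_; _+v_ to infixl 6 _+v_; _-v_ to infixl 6 _-v_; _·s_ to infixr 7 _·s_; _·_ to infixr 8 _·_)
  open import Relation.Binary.Reasoning.Setoid setoid
  open AlternatingIsometry S

  module βˡ y = LinearForm (β-linearˡ y)
  module βʳ x = LinearForm (β-linearʳ x)
  module g = Linear g-linear

  β-cong : ∀ {x x′ y y′} → x ≈v x′ → y ≈v y′ → β x y ≈ β x′ y′
  β-cong {x} {x′} {y} {y′} e f = trans (βˡ.cong y e) (βʳ.cong x′ f)

  β-skew : ∀ x y → β x y ≈ - β y x
  β-skew x y = begin
    β x y                                   ≈⟨ solve 2 (λ s t → s := (con (+ 0) :+ s) :+ (t :+ con (+ 0)) :- t) refl _ _ ⟩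
    (0# + β x y) + (β y x + 0#) - β y x     ≈⟨ +-congʳ (+-cong (+-congʳ (alternating x)) (+-congˡ (alternating y))) ⟨
    (β x x + β x y) + (β y x + β y y) - β y x
      ≈⟨ +-congʳ (trans (βˡ.+-homo (x +v y) x y) (+-cong (βʳ.+-homo x x y) (βʳ.+-homo y x y))) ⟨
    β (x +v y) (x +v y) - β y x             ≈⟨ +-congʳ (alternating (x +v y)) ⟩
    0# - β y x                              ≈⟨ +-identityˡ _ ⟩
    - β y x                                 ∎

  β-zero-sym : ∀ {x y} → β x y ≈ 0# → β y x ≈ 0#
  β-zero-sym {x} {y} e = trans (β-skew y x) (trans (-‿cong e) (solve 0 (:- con (+ 0) := con (+ 0)) refl))

  g-injective : ∀ x → g x ≈v 0v → x ≈v 0v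
  g-injective x e = nondegenerate x (λ y → trans (sym (isometry x y)) (βˡ.zero-homo (g y) e))

  open LinearInverse (injective⇒inverse g-linear g-injective) public
    renaming (f⁻¹ to g⁻¹; linear to g⁻¹-linear; inverseˡ to g⁻¹-g; inverseʳ to g-g⁻¹)
  module g⁻¹ = Linear g⁻¹-linear

  -- The adjoint of an isometry is its inverse, which makes ν* the adjoint of ν.
  ν ν* : Vect d → Vect d
  ν x = g x -v x
  ν* x = g⁻¹ x -v x

  ν-linear : Linear ν
  ν-linear = -v-linear g-linear id-linear

  ν*-linear : Linear ν*
  ν*-linear = -v-linear g⁻¹-linear id-linear

  module ν = Linear ν-linear
  module ν* = Linear ν*-linear
  module ν^ k = Linear (pow-linear ν-linear k)

  ν-adjoint : ∀ x y → β (ν x) y ≈ β x (ν* y)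
  ν-adjoint x y = begin
    β (ν x) y                 ≈⟨ βˡ.-v-homo y (g x) x ⟩
    β (g x) y - β x y         ≈⟨ +-congʳ (βʳ.cong (g x) (g-g⁻¹ y)) ⟨
    β (g x) (g (g⁻¹ y)) - β x y  ≈⟨ +-congʳ (isometry x (g⁻¹ y)) ⟩
    β x (g⁻¹ y) - β x y       ≈⟨ βʳ.-v-homo x (g⁻¹ y) y ⟨
    β x (ν* y)                ∎

  ν*-adjoint : ∀ x y → β (ν* x) y ≈ β x (ν y)
  ν*-adjoint x y = begin
    β (ν* x) y        ≈⟨ β-skew (ν* x) y ⟩
    - β y (ν* x)      ≈⟨ -‿cong (ν-adjoint y x) ⟨
    - β (ν y) x       ≈⟨ β-skew x (ν y) ⟨
    β x (ν y)         ∎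

  adjoint-pow : ∀ {f f* : Vect d → Vect d} → (∀ x y → β (f x) y ≈ β x (f* y)) →
                ∀ k x y → β (pow f k x) y ≈ β x (pow f* k y)
  adjoint-pow adj zero    x y = refl
  adjoint-pow {f} {f*} adj (suc k) x y = begin
    β (f (pow f k x)) y       ≈⟨ adj (pow f k x) y ⟩
    β (pow f k x) (f* y)      ≈⟨ adjoint-pow adj k x (f* y) ⟩
    β x (pow f* k (f* y))     ≡⟨ ≡.cong (β x) (pow-suc f* k y) ⟩
    β x (pow f* (suc k) y)    ∎

  ν^-adjoint : ∀ k x y → β (pow ν k x) y ≈ β x (pow ν* k y)
  ν^-adjoint = adjoint-pow ν-adjoint

  ν*^-adjoint : ∀ k x y → β (pow ν* k x) y ≈ β x (pow ν k y)
  ν*^-adjoint = adjoint-pow ν*-adjoint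

  g≈id+ν : ∀ x → g x ≈v x +v ν x
  g≈id+ν x i = solve 2 (λ a b → a := b :+ (a :- b)) refl (g x i) (x i)

  g⁻¹≈id+ν* : ∀ x → g⁻¹ x ≈v x +v ν* x
  g⁻¹≈id+ν* x i = solve 2 (λ a b → a := b :+ (a :- b)) refl (g⁻¹ x i) (x i)

  -- The identity g⁻¹ - 1 = -g⁻¹(g - 1). As g⁻¹ is invertible and commutes with ν, whatever a power
  -- of ν kills is killed by the same power of ν*, and both have image in [V, g].
  ν*≈-g⁻¹ν : ∀ x → ν* x ≈v (- 1#) ·s g⁻¹ (ν x)
  ν*≈-g⁻¹ν x i = begin
    g⁻¹ x i - x i                     ≈⟨ solve 2 (λ a b → a :- b := con (ℤ.- + 1) :* (b :- a)) refl (g⁻¹ x i) (x i) ⟩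
    - 1# * (x i - g⁻¹ x i)            ≈⟨ *-congˡ (+-congʳ (g⁻¹-g x i)) ⟨
    - 1# * (g⁻¹ (g x) i - g⁻¹ x i)    ≈⟨ *-congˡ (g⁻¹.-v-homo (g x) x i) ⟨
    - 1# * g⁻¹ (ν x) i                ∎

  scaled-zero : ∀ c {x : Vect d} → x ≈v 0v → c ·s x ≈v 0v
  scaled-zero c e i = trans (*-congˡ (e i)) (zeroʳ c)

  ν-zero⇒ν*-zero : ∀ {x} → ν x ≈v 0v → ν* x ≈v 0v
  ν-zero⇒ν*-zero {x} e =
    ≈v-trans (ν*≈-g⁻¹ν x) (scaled-zero (- 1#) (≈v-trans (g⁻¹.cong e) g⁻¹.0-homo))

  record Centralizing (h : Vect d → Vect d) : Set where
    field
      linear : Linear h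
      preserves : ∀ x y → β (h x) (h y) ≈ β x y
      commutes : ∀ x → h (g x) ≈v g (h x)
    open Linear linear public

    commutes-ν : ∀ x → h (ν x) ≈v ν (h x)
    commutes-ν x = ≈v-trans (-v-homo (g x) x) (-v-cong (commutes x) ≈v-refl)

    commutes-ν^ : ∀ k x → h (pow ν k x) ≈v pow ν k (h x)
    commutes-ν^ = pow-commute ν-linear commutes-ν

  commute-ν : ∀ {h} → Linear h → (∀ x → h (g x) ≈v g (h x)) → ∀ x → h (ν x) ≈v ν (h x)
  commute-ν H c x = ≈v-trans (Linear.-v-homo H (g x) x) (-v-cong (c x) ≈v-refl)

  g⁻¹-commutes-ν : ∀ x → g⁻¹ (ν x) ≈v ν (g⁻¹ x)
  g⁻¹-commutes-ν = commute-ν g⁻¹-linear (λ x → ≈v-trans (g⁻¹-g x) (≈v-sym (g-g⁻¹ x)))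

  ν*-commutes-ν : ∀ x → ν* (ν x) ≈v ν (ν* x)
  ν*-commutes-ν x i = begin
    g⁻¹ (ν x) i - ν x i      ≈⟨ +-congʳ (g⁻¹-commutes-ν x i) ⟩
    ν (g⁻¹ x) i - ν x i      ≈⟨ ν.-v-homo (g⁻¹ x) x i ⟨
    ν (ν* x) i               ∎

  ν^-zero⇒ν*^-zero : ∀ k {x} → pow ν k x ≈v 0v → pow ν* k x ≈v 0v
  ν^-zero⇒ν*^-zero zero    e = e
  ν^-zero⇒ν*^-zero (suc k) {x} e = ≈v-trans (λ i → reflexive (≡.cong (λ t → t i) (≡.sym (pow-suc ν* k x))))
    (ν^-zero⇒ν*^-zero k (≈v-trans (≈v-sym (pow-commute ν-linear ν*-commutes-ν k x)) (ν-zero⇒ν*-zero e)))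

  sign : ℕ → Carrier
  sign zero    = 1#
  sign (suc k) = - sign k

  -- Each ν* acts as -g⁻¹ν, and g⁻¹ fixes ker ν, where νᵏ x lies; only the signs remain.
  ν*^-sign : ∀ k {x} → pow ν (suc k) x ≈v 0v → pow ν* k x ≈v sign k ·s pow ν k x
  ν*^-sign zero    {x} e i = sym (*-identityˡ (x i))
  ν*^-sign (suc k) {x} e i = begin
    pow ν* (suc k) x i                ≡⟨ ≡.cong (λ t → t i) (pow-suc ν* k x) ⟨
    pow ν* k (ν* x) i                 ≈⟨ ν*^-sign k (≈v-trans (≈v-sym (pow-commute ν-linear ν*-commutes-ν (suc k) x)) (ν-zero⇒ν*-zero e)) i ⟩
    sign k * pow ν k (ν* x) i         ≈⟨ *-congˡ (pow-commute ν-linear ν*-commutes-ν k x i) ⟨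
    sign k * ν* w i                   ≈⟨ *-congˡ (ν*≈-g⁻¹ν w i) ⟩
    sign k * (- 1# * g⁻¹ (ν w) i)     ≈⟨ *-congˡ (*-congˡ (fixed i)) ⟩
    sign k * (- 1# * ν w i)           ≈⟨ solve 2 (λ s t → s :* (con (ℤ.- + 1) :* t) := :- s :* t) refl (sign k) (ν w i) ⟩
    - sign k * ν w i                  ∎
    where
    w : Vect d
    w = pow ν k x
    fixed : g⁻¹ (ν w) ≈v ν w
    fixed j = trans (g⁻¹≈id+ν* (ν w) j) (trans (+-congˡ (ν-zero⇒ν*-zero e j)) (+-identityʳ _))

  -- b k induces the form of the paper on the space of Jordan blocks of size k + 1.
  b : ℕ → Vect d → Vect d → Carrier
  b k x y = β x (pow ν k y)

  b-linearˡ : ∀ k y → LinearForm (λ x → b k x y)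
  b-linearˡ k y = β-linearˡ (pow ν k y)

  b-linearʳ : ∀ k x → LinearForm (b k x)
  b-linearʳ k x = ∘-form (β-linearʳ x) (pow-linear ν-linear k)

  module bˡ k y = LinearForm (b-linearˡ k y)
  module bʳ k x = LinearForm (b-linearʳ k x)

  b-zeroˡ : ∀ k {x} y → pow ν k x ≈v 0v → b k x y ≈ 0#
  b-zeroˡ k {x} y e = trans (sym (ν*^-adjoint k x y)) (βˡ.zero-homo y (ν^-zero⇒ν*^-zero k e))

  -- Here k is the block size minus one: `sign k` is -1 for even sizes, where `b k` comes out
  -- symmetric, and 1 for odd sizes, where it comes out skew.
  b-sym : ∀ k {x} y → pow ν (suc k) x ≈v 0v → b k x y ≈ - (sign k * b k y x)
  b-sym k {x} y e = begin
    β x (pow ν k y)               ≈⟨ ν*^-adjoint k x y ⟨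
    β (pow ν* k x) y              ≈⟨ βˡ.cong y (ν*^-sign k e) ⟩
    β (sign k ·s pow ν k x) y     ≈⟨ βˡ.·s-homo y (sign k) _ ⟩
    sign k * β (pow ν k x) y      ≈⟨ *-congˡ (β-skew _ y) ⟩
    sign k * - β y (pow ν k x)    ≈⟨ solve 2 (λ s t → s :* :- t := :- (s :* t)) refl (sign k) _ ⟩
    - (sign k * b k y x)          ∎

  infix 4 _≋_
  record _≋_ (x y : Vect d) : Set where
    constructor _,_
    field
      shift : Vect d
      equal : x ≈v y +v ν shift

  ≋-reflexive : ∀ {x y} → x ≈v y → x ≋ y
  ≋-reflexive {x} {y} e = 0v , λ i → trans (e i) (sym (trans (+-congˡ (ν.0-homo i)) (+-identityʳ (y i))))

  ≋-sym : ∀ {x y} → x ≋ y → y ≋ x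
  ≋-sym {x} {y} (u , e) = (- 1#) ·s u , λ i → begin
    y i                            ≈⟨ solve 2 (λ a b → a := (a :+ b) :+ con (ℤ.- + 1) :* b) refl (y i) (ν u i) ⟩
    (y i + ν u i) + - 1# * ν u i   ≈⟨ +-cong (e i) (ν.·s-homo (- 1#) u i) ⟨
    x i + ν ((- 1#) ·s u) i        ∎

  ≋-trans : ∀ {x y z} → x ≋ y → y ≋ z → x ≋ z
  ≋-trans {x} {y} {z} (u , e) (u′ , e′) = u′ +v u , λ i → begin
    x i                       ≈⟨ e i ⟩
    y i + ν u i               ≈⟨ +-congʳ (e′ i) ⟩
    (z i + ν u′ i) + ν u i    ≈⟨ +-assoc _ _ _ ⟩
    z i + (ν u′ i + ν u i)    ≈⟨ +-congˡ (ν.+-homo u′ u i) ⟨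
    z i + ν (u′ +v u) i       ∎

  ≋-+ : ∀ {x y x′ y′} → x ≋ y → x′ ≋ y′ → x +v x′ ≋ y +v y′
  ≋-+ {x} {y} {x′} {y′} (u , e) (u′ , e′) = u +v u′ , λ i → begin
    x i + x′ i                         ≈⟨ +-cong (e i) (e′ i) ⟩
    (y i + ν u i) + (y′ i + ν u′ i)    ≈⟨ solve 4 (λ a b s t → (a :+ b) :+ (s :+ t) := (a :+ s) :+ (b :+ t)) refl _ _ _ _ ⟩
    (y i + y′ i) + (ν u i + ν u′ i)    ≈⟨ +-congˡ (ν.+-homo u u′ i) ⟨
    (y i + y′ i) + ν (u +v u′) i       ∎

  ≋-·s : ∀ c {x y} → x ≋ y → c ·s x ≋ c ·s y
  ≋-·s c {x} {y} (u , e) = c ·s u , λ i → begin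
    c * x i                 ≈⟨ *-congˡ (e i) ⟩
    c * (y i + ν u i)       ≈⟨ distribˡ c _ _ ⟩
    c * y i + c * ν u i     ≈⟨ +-congˡ (ν.·s-homo c u i) ⟨
    c * y i + ν (c ·s u) i  ∎

  ν≋0 : ∀ u → ν u ≋ 0v
  ν≋0 u = u , λ i → sym (+-identityˡ _)

  ν*≋0 : ∀ u → ν* u ≋ 0v
  ν*≋0 u = ≋-trans (≋-reflexive (λ i → trans (ν*≈-g⁻¹ν u i) (trans (*-congˡ (g⁻¹-commutes-ν u i)) (sym (ν.·s-homo (- 1#) (g⁻¹ u) i)))))
                   (ν≋0 ((- 1#) ·s g⁻¹ u))

  -- As νᵏ y lies in ker ν, it is orthogonal to [V, g]. So `b k` pairs V/[V, g] on the left with ker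
  -- νᵏ⁺¹ on the right.
  b-≋ˡ : ∀ k {x x′ y} → x ≋ x′ → pow ν (suc k) y ≈v 0v → b k x y ≈ b k x′ y
  b-≋ˡ k {x} {x′} {y} (u , e) z = begin
    β x (pow ν k y)                        ≈⟨ βˡ.cong _ e ⟩
    β (x′ +v ν u) (pow ν k y)              ≈⟨ βˡ.+-homo _ x′ (ν u) ⟩
    b k x′ y + β (ν u) (pow ν k y)         ≈⟨ +-congˡ (ν-adjoint u _) ⟩
    b k x′ y + β u (ν* (pow ν k y))        ≈⟨ +-congˡ (βʳ.zero-homo u (ν-zero⇒ν*-zero z)) ⟩
    b k x′ y + 0#                          ≈⟨ +-identityʳ _ ⟩
    b k x′ y                               ∎

  Centralizing-∘ : ∀ {h h′} → Centralizing h → Centralizing h′ → Centralizing (λ x → h (h′ x))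
  Centralizing-∘ H H′ = record
    { linear = ∘-linear H.linear H′.linear
    ; preserves = λ x y → trans (H.preserves _ _) (H′.preserves x y)
    ; commutes = λ x → ≈v-trans (H.cong (H′.commutes x)) (H.commutes _) }
    where
    module H = Centralizing H
    module H′ = Centralizing H′

  Centralizing-id : Centralizing id
  Centralizing-id = record
    { linear = id-linear ; preserves = λ _ _ → refl ; commutes = λ _ → ≈v-refl }

  Centralizing-neg : Centralizing (λ x → (- 1#) ·s x)
  Centralizing-neg = record
    { linear = ·s-linear (- 1#) id-linear
    ; preserves = λ x y → trans (trans (βˡ.·s-homo _ (- 1#) x) (*-congˡ (βʳ.·s-homo x (- 1#) y)))
        (solve 1 (λ t → con (ℤ.- + 1) :* (con (ℤ.- + 1) :* t) := t) refl _)
    ; commutes = λ x → ≈v-sym (g.·s-homo (- 1#) x) }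

  infix 4 _∼_
  record _∼_ (v w : Vect d) : Set where
    field
      map : Vect d → Vect d
      centralizing : Centralizing map
      image : map v ≋ w

  ∼-trans : ∀ {u v w} → u ∼ v → v ∼ w → u ∼ w
  ∼-trans o o′ = record
    { centralizing = Centralizing-∘ O′.centralizing O.centralizing
    ; image = ≋-trans (≋-map O.image) O′.image }
    where
    module O = _∼_ o
    module O′ = _∼_ o′
    open Centralizing O′.centralizing
    ≋-map : ∀ {x y} → x ≋ y → O′.map x ≋ O′.map y
    ≋-map (u , e) = O′.map u , ≈v-trans (cong e) (≈v-trans (+-homo _ _) (+v-cong ≈v-refl (commutes-ν u)))

  ≋⇒∼ : ∀ {v w} → v ≋ w → v ∼ w
  ≋⇒∼ e = record { centralizing = Centralizing-id ; image = e }

  neg-∼ : ∀ v → (- 1#) ·s v ∼ v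
  neg-∼ v = record
    { centralizing = Centralizing-neg
    ; image = ≋-reflexive (λ i → solve 1 (λ t → con (ℤ.- + 1) :* (con (ℤ.- + 1) :* t) := t) refl (v i)) }

-- The involution that is −1 on the span of the νʲ u and 1 on its orthogonal complement.
module Reflection (R : CommutativeRing 0ℓ 0ℓ) (q : ℕ) (F : LinAlg.IsFiniteFieldOfOrder R q)
                  {d : ℕ} (S : AlternatingIsometry R d) where
  open CommutativeRing R hiding (zero)
  open IntegerCoefficients R
  open Vectors R
  open FiniteField R q F
  open LinAlg R
    renaming (_≈v_ to infix 4 _≈v_; _+v_ to infixl 6 _+v_; _-v_ to infixl 6 _-v_; _·s_ to infixr 7 _·s_; _·_ to infixr 8 _·_)
  open import Relation.Binary.Reasoning.Setoid setoid
  open AlternatingIsometry S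
  open Isometry R q F S

  module _ (k : ℕ) (u : Vect d) (u-killed : pow ν (suc k) u ≈v 0v) (anisotropic : ¬ b k u u ≈ 0#) where

    u^ : ℕ → Vect d
    u^ j = pow ν j u

    u^-killed : ∀ {j} → k ℕ.< j → u^ j ≈v 0v
    u^-killed k<j = pow-zero-≤ ν-linear k<j u-killed

    u^-orthogonal : ∀ j l → k ℕ.< j ℕ.+ l → β (u^ j) (u^ l) ≈ 0#
    u^-orthogonal j l k<j+l = trans (ν^-adjoint j u (u^ l)) (βʳ.zero-homo u (ν^-zero⇒ν*^-zero j
      (≈v-trans (λ i → reflexive (≡.cong (λ t → t i) (≡.sym (pow-+ ν j l u)))) (u^-killed k<j+l))))

    -- From ν* = -g⁻¹ν = -(1 + ν*)ν one gets ν = -(ν* + ν*ν). Moving one ν across β therefore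
    -- changes the sign up to a term beyond the antidiagonal, which vanishes, so nonvanishing
    -- propagates along j + l = k from the anisotropic corner.
    u^-pairing : ∀ j l → j ℕ.+ l ≡ k → ¬ β (u^ j) (u^ l) ≈ 0#
    u^-pairing zero    l ≡.refl = anisotropic
    u^-pairing (suc j) l eq e = u^-pairing j (suc l) (≡.trans (ℕₚ.+-suc j l) eq) (begin
      β (u^ j) (ν y)                       ≈⟨ βʳ.cong (u^ j) (λ i → solve 2 (λ a b → a := :- (con (ℤ.- + 1) :* (a :+ b) :+ b)) refl (ν y i) (ν* (ν y) i)) ⟩
      β (u^ j) (λ i → - (- 1# * (ν y i + ν* (ν y) i) + ν* (ν y) i))
        ≈⟨ βʳ.cong (u^ j) (λ i → trans (-‿cong (+-congʳ (trans (*-congˡ (sym (g⁻¹≈id+ν* (ν y) i))) (sym (ν*≈-g⁻¹ν y i)))))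
             (solve 1 (λ a → :- a := con (ℤ.- + 1) :* a) refl _)) ⟩
      β (u^ j) ((- 1#) ·s (ν* y +v ν* (ν y)))  ≈⟨ βʳ.·s-homo (u^ j) (- 1#) _ ⟩
      - 1# * β (u^ j) (ν* y +v ν* (ν y))       ≈⟨ *-congˡ (βʳ.+-homo (u^ j) (ν* y) (ν* (ν y))) ⟩
      - 1# * (β (u^ j) (ν* y) + β (u^ j) (ν* (ν y)))
        ≈⟨ *-congˡ (+-cong (ν-adjoint (u^ j) y) (ν-adjoint (u^ j) (ν y))) ⟨
      - 1# * (β (ν (u^ j)) y + β (ν (u^ j)) (ν y))
        ≈⟨ *-congˡ (+-cong e (u^-orthogonal (suc j) (suc l) (≡.subst (k ℕ.<_) (≡.sym (≡.cong suc (≡.trans (ℕₚ.+-suc j l) eq))) (ℕₚ.n<1+n k)))) ⟩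
      - 1# * (0# + 0#)                         ≈⟨ solve 0 (con (ℤ.- + 1) :* (con (+ 0) :+ con (+ 0)) := con (+ 0)) refl ⟩
      0#                                       ∎)
      where
      y : Vect d
      y = u^ l

    -- The span of the νʲ u as an inductive closure: stability under ν is a constructor instead of a
    -- computation with coefficients.
    data Cyclic : Vect d → Set where
      generator : Cyclic u
      sum       : ∀ {x y} → Cyclic x → Cyclic y → Cyclic (x +v y)
      scaling   : ∀ c {x} → Cyclic x → Cyclic (c ·s x)
      shift     : ∀ {x} → Cyclic x → Cyclic (ν x)
      resp      : ∀ {x y} → x ≈v y → Cyclic x → Cyclic y

    cyclic-pow : ∀ j → Cyclic (u^ j)
    cyclic-pow zero    = generator
    cyclic-pow (suc j) = shift (cyclic-pow j)

    cyclic-0 : Cyclic 0v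
    cyclic-0 = resp (λ i → zeroˡ (u i)) (scaling 0# generator)

    cyclic--v : ∀ {x y} → Cyclic x → Cyclic y → Cyclic (x -v y)
    cyclic--v {x} {y} X Y = resp (λ i → solve 2 (λ a b → a :+ con (ℤ.- + 1) :* b := a :- b) refl (x i) (y i))
      (sum X (scaling (- 1#) Y))

    cyclic-g : ∀ {x} → Cyclic x → Cyclic (g x)
    cyclic-g {x} X = resp (≈v-sym (g≈id+ν x)) (sum X (shift X))

    _⟂u^ : Vect d → Set
    z ⟂u^ = ∀ l → β z (u^ l) ≈ 0#

    ⟂-cyclic : ∀ {z} → z ⟂u^ → ∀ {y} → Cyclic y → ∀ l → β z (pow ν l y) ≈ 0#
    ⟂-cyclic {z} z⟂ generator l = z⟂ l
    ⟂-cyclic {z} z⟂ (sum {x} {y} X Y) l =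
      trans (bʳ.+-homo l z x y) (trans (+-cong (⟂-cyclic z⟂ X l) (⟂-cyclic z⟂ Y l)) (+-identityˡ 0#))
    ⟂-cyclic {z} z⟂ (scaling c {x} X) l =
      trans (bʳ.·s-homo l z c x) (trans (*-congˡ (⟂-cyclic z⟂ X l)) (zeroʳ c))
    ⟂-cyclic {z} z⟂ (shift {x} X) l =
      trans (reflexive (≡.cong (β z) (pow-suc ν l x))) (⟂-cyclic z⟂ X (suc l))
    ⟂-cyclic {z} z⟂ (resp {x} {y} e X) l =
      trans (sym (bʳ.cong l z e)) (⟂-cyclic z⟂ X l)

    -- 0 = β z (νˡ u) = β (g z) (g νˡ u) is the sum of the pairings of g z with νˡ u and νˡ⁺¹ u.
    -- Vanishing thus descends from l > k, where νˡ u is zero; `n` measures the distance left.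
    ⟂-g : ∀ {z} → z ⟂u^ → g z ⟂u^
    ⟂-g {z} z⟂ l = descend (suc k) l (ℕₚ.m≤m+n (suc k) l)
      where
      descend : ∀ n l → k ℕ.< n ℕ.+ l → β (g z) (u^ l) ≈ 0#
      descend zero    l k<l = βʳ.zero-homo (g z) (u^-killed k<l)
      descend (suc n) l k<  = begin
        β (g z) (u^ l)
          ≈⟨ solve 2 (λ s t → s := (s :+ t) :- t) refl _ (β (g z) (u^ (suc l))) ⟩
        (β (g z) (u^ l) + β (g z) (u^ (suc l))) - β (g z) (u^ (suc l))
          ≈⟨ +-cong (trans (sym (βʳ.+-homo (g z) (u^ l) (u^ (suc l)))) (βʳ.cong (g z) (≈v-sym (g≈id+ν (u^ l)))))
                    (-‿cong (descend n (suc l) (≡.subst (k ℕ.<_) (≡.sym (ℕₚ.+-suc n l)) k<))) ⟩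
        β (g z) (g (u^ l)) - 0#     ≈⟨ +-congʳ (trans (isometry z (u^ l)) (z⟂ l)) ⟩
        0# - 0#                     ≈⟨ -‿inverseʳ 0# ⟩
        0#                          ∎

    -- The Gram matrix of the νʲ u is zero beyond the antidiagonal j + l = k and nonzero on it, so
    -- the coefficients of the orthogonal projection are found one at a time.
    coefficient : ℕ → Vect d → Carrier
    coefficient j y = β (u^ j) (u^ (k ℕ.∸ j)) ⁻¹ * β y (u^ (k ℕ.∸ j))

    coefficient-form : ∀ j → LinearForm (coefficient j)
    coefficient-form j = record
      { cong = λ e → *-congˡ (βˡ.cong _ e)
      ; +-homo = λ x y → trans (*-congˡ (βˡ.+-homo _ x y)) (distribˡ _ _ _)
      ; ·s-homo = λ c x → trans (*-congˡ (βˡ.·s-homo _ c x))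
          (solve 3 (λ i c t → i :* (c :* t) := c :* (i :* t)) refl _ c _) }

    project : ℕ → Vect d → Vect d
    project zero    x = 0v
    project (suc j) x = project j x +v coefficient j (x -v project j x) ·s u^ j

    project-linear : ∀ j → Linear (project j)
    project-linear zero = record
      { cong = λ _ → ≈v-refl ; +-homo = λ _ _ _ → sym (+-identityˡ 0#) ; ·s-homo = λ _ _ _ → sym (zeroʳ _) }
    project-linear (suc j) = +-linear (project-linear j)
      (rank-one-linear (∘-form (coefficient-form j) (-v-linear id-linear (project-linear j))) (u^ j))

    project-cyclic : ∀ j x → Cyclic (project j x)
    project-cyclic zero    x = cyclic-0
    project-cyclic (suc j) x = sum (project-cyclic j x) (scaling _ (cyclic-pow j))

    -- The invariant after j steps: the residue is orthogonal to νˡ u for all l > k - j. Step j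
    -- clears l = k - j and keeps the larger l, since νʲ u is orthogonal to those νˡ u.
    project-orthogonal : ∀ j x l → j ℕ.≤ suc k → k ℕ.< j ℕ.+ l → β (x -v project j x) (u^ l) ≈ 0#
    project-orthogonal zero    x l j≤ k<l = βʳ.zero-homo _ (u^-killed k<l)
    project-orthogonal (suc j) x l (ℕ.s≤s j≤k) (ℕ.s≤s k≤j+l) = begin
      β (x -v (p +v c ·s u^ j)) (u^ l)
        ≈⟨ βˡ.cong (u^ l) (λ i → solve 3 (λ x p t → x :- (p :+ t) := (x :- p) :- t) refl (x i) (p i) _) ⟩
      β (y -v c ·s u^ j) (u^ l)                 ≈⟨ βˡ.-v-homo (u^ l) y _ ⟩
      β y (u^ l) - β (c ·s u^ j) (u^ l)         ≈⟨ +-congˡ (-‿cong (βˡ.·s-homo (u^ l) c (u^ j))) ⟩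
      β y (u^ l) - c * β (u^ j) (u^ l)          ≈⟨ cancels (ℕₚ.m≤n⇒m<n∨m≡n k≤j+l) ⟩
      0#                                        ∎
      where
      p y : Vect d
      p = project j x
      y = x -v p
      c : Carrier
      c = coefficient j y
      cancels : k ℕ.< j ℕ.+ l ⊎ k ≡ j ℕ.+ l → β y (u^ l) - c * β (u^ j) (u^ l) ≈ 0#
      cancels (inj₁ k<) = begin
        β y (u^ l) - c * β (u^ j) (u^ l)
          ≈⟨ +-cong (project-orthogonal j x l (ℕₚ.m≤n⇒m≤1+n j≤k) k<) (-‿cong (*-congˡ (u^-orthogonal j l k<))) ⟩
        0# - c * 0#     ≈⟨ solve 1 (λ c → con (+ 0) :- c :* con (+ 0) := con (+ 0)) refl c ⟩
        0#              ∎
      cancels (inj₂ k≡) = begin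
        β y (u^ l) - c * π                    ≡⟨ ≡.cong (λ t → β y (u^ l) - β (u^ j) (u^ t) ⁻¹ * β y (u^ t) * π) k∸j≡l ⟩
        β y (u^ l) - π ⁻¹ * β y (u^ l) * π    ≈⟨ solve 3 (λ s i p → s :- i :* s :* p := s :- p :* i :* s) refl (β y (u^ l)) (π ⁻¹) π ⟩
        β y (u^ l) - π * π ⁻¹ * β y (u^ l)    ≈⟨ +-congˡ (-‿cong (*-congʳ (⁻¹-inverseʳ (u^-pairing j l (≡.sym k≡))))) ⟩
        β y (u^ l) - 1# * β y (u^ l)          ≈⟨ solve 1 (λ s → s :- con (+ 1) :* s := con (+ 0)) refl (β y (u^ l)) ⟩
        0#                                    ∎
        where
        π : Carrier
        π = β (u^ j) (u^ l)
        k∸j≡l : k ℕ.∸ j ≡ l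
        k∸j≡l = ≡.trans (≡.cong (ℕ._∸ j) k≡) (ℕₚ.m+n∸m≡n j l)

    -- All terms but the one along u lie in [V, g]. Hence the involution induces the ordinary
    -- reflection in u on V/[V, g].
    project-top : ∀ j x → project (suc j) x ≋ coefficient 0 x ·s u
    project-top zero    x = ≋-reflexive (λ i → trans (+-identityˡ _)
      (*-congʳ (LinearForm.cong (coefficient-form 0) {x -v 0v} {x} (λ i → solve 1 (λ a → a :- con (+ 0) := a) refl (x i)))))
    project-top (suc j) x = ≋-trans
      (≋-+ (project-top j x) (≋-trans (≋-·s _ (ν≋0 (u^ j))) (≋-reflexive (λ _ → zeroʳ _))))
      (≋-reflexive (λ i → +-identityʳ _))

    P : Vect d → Vect d
    P = project (suc k)

    P-linear : Linear P
    P-linear = project-linear (suc k)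

    P-residue : ∀ x → (x -v P x) ⟂u^
    P-residue x l = project-orthogonal (suc k) x l ℕₚ.≤-refl (ℕₚ.m≤m+n (suc k) l)

    P-residue-cyclic : ∀ x {y} → Cyclic y → β (x -v P x) y ≈ 0#
    P-residue-cyclic x Y = ⟂-cyclic (P-residue x) Y 0

    -- Every x is (x - P x) + P x with the first part orthogonal to the cyclic space and the second
    -- inside it, so such a y is orthogonal to all of V.
    cyclic-nondegenerate : ∀ {y} → Cyclic y → y ⟂u^ → y ≈v 0v
    cyclic-nondegenerate {y} Y y⟂ = nondegenerate y (λ x → begin
      β y x                        ≈⟨ βʳ.cong y (λ i → solve 2 (λ x p → x := (x :- p) :+ p) refl (x i) (P x i)) ⟩
      β y ((x -v P x) +v P x)      ≈⟨ βʳ.+-homo y _ _ ⟩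
      β y (x -v P x) + β y (P x)   ≈⟨ +-cong (β-zero-sym (P-residue-cyclic x Y)) (⟂-cyclic y⟂ (project-cyclic (suc k) x) 0) ⟩
      0# + 0#                      ≈⟨ +-identityˡ 0# ⟩
      0#                           ∎)

    -- The difference P (g x) - g (P x) lies in the cyclic space. It also equals g (x - P x) - (g x
    -- - P (g x)), a difference of vectors orthogonal to that space, so it is zero.
    P-commutes : ∀ x → P (g x) ≈v g (P x)
    P-commutes x i = x-y≈0⇒x≈y (cyclic-nondegenerate
      (cyclic--v (project-cyclic (suc k) (g x)) (cyclic-g (project-cyclic (suc k) x)))
      (λ l → begin
        β (P (g x) -v g (P x)) (u^ l)
          ≈⟨ βˡ.cong (u^ l) (λ i → trans (solve 3 (λ p g q → p :- q := (g :- q) :- (g :- p)) refl (P (g x) i) (g x i) (g (P x) i))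
               (+-congʳ (sym (g.-v-homo x (P x) i)))) ⟩
        β (g (x -v P x) -v (g x -v P (g x))) (u^ l)               ≈⟨ βˡ.-v-homo (u^ l) _ _ ⟩
        β (g (x -v P x)) (u^ l) - β (g x -v P (g x)) (u^ l)
          ≈⟨ +-cong (⟂-g (P-residue x) l) (-‿cong (P-residue (g x) l)) ⟩
        0# - 0#                                                   ≈⟨ -‿inverseʳ 0# ⟩
        0#                                                        ∎) i)

    reflection : Vect d → Vect d
    reflection x = x -v 2# ·s P x

    β-P : ∀ x y → β x (P y) ≈ β (P x) (P y)
    β-P x y = begin
      β x (P y)                          ≈⟨ βˡ.cong (P y) (λ i → solve 2 (λ x p → x := (x :- p) :+ p) refl (x i) (P x i)) ⟩
      β ((x -v P x) +v P x) (P y)        ≈⟨ βˡ.+-homo (P y) _ _ ⟩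
      β (x -v P x) (P y) + β (P x) (P y) ≈⟨ +-congʳ (P-residue-cyclic x (project-cyclic (suc k) y)) ⟩
      0# + β (P x) (P y)                 ≈⟨ +-identityˡ _ ⟩
      β (P x) (P y)                      ∎

    reflection-centralizing : Centralizing reflection
    reflection-centralizing = record
      { linear = -v-linear id-linear (·s-linear 2# P-linear)
      ; preserves = λ x y → begin
          β (x -v 2# ·s P x) (y -v 2# ·s P y)     ≈⟨ βˡ.-v-homo _ x _ ⟩
          β x (y -v 2# ·s P y) - β (2# ·s P x) (y -v 2# ·s P y)
            ≈⟨ +-cong (βʳ.-v-homo x y _) (-‿cong (trans (βˡ.·s-homo _ 2# (P x)) (*-congˡ (βʳ.-v-homo (P x) y _)))) ⟩
          β x y - β x (2# ·s P y) - 2# * (β (P x) y - β (P x) (2# ·s P y))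
            ≈⟨ +-cong (+-congˡ (-‿cong (trans (βʳ.·s-homo x 2# (P y)) (*-congˡ (β-P x y)))))
                 (-‿cong (*-congˡ (+-cong (trans (β-skew (P x) y) (trans (-‿cong (β-P y x)) (sym (β-skew (P x) (P y)))))
                   (-‿cong (βʳ.·s-homo (P x) 2# (P y)))))) ⟩
          β x y - 2# * s x y - 2# * (s x y - 2# * s x y)
            ≈⟨ solve 2 (λ t s → let two = con (+ 1) :+ con (+ 1) in t :- two :* s :- two :* (s :- two :* s) := t) refl (β x y) (s x y) ⟩
          β x y                                   ∎
      ; commutes = λ x i → begin
          g x i - 2# * P (g x) i          ≈⟨ +-congˡ (-‿cong (*-congˡ (P-commutes x i))) ⟩
          g x i - 2# * g (P x) i          ≈⟨ +-congˡ (-‿cong (g.·s-homo 2# (P x) i)) ⟨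
          g x i - g (2# ·s P x) i         ≈⟨ g.-v-homo x _ i ⟨
          g (x -v 2# ·s P x) i            ∎ }
      where
      s : Vect d → Vect d → Carrier
      s x y = β (P x) (P y)

    reflection-∼ : ∀ v → v ∼ v -v (2# * (b k u u ⁻¹ * b k v u)) ·s u
    reflection-∼ v = record
      { centralizing = reflection-centralizing
      ; image = ≋-trans
          (≋-reflexive (λ i → solve 3 (λ v t p → v :- t :* p := v :+ (:- t) :* p) refl (v i) 2# (P v i)))
          (≋-trans (≋-+ (≋-reflexive ≈v-refl) (≋-·s (- 2#) (project-top k v)))
            (≋-reflexive (λ i → solve 4 (λ v t c u → v :+ (:- t) :* (c :* u) := v :- (t :* c) :* u) refl (v i) 2# (coefficient 0 v) (u i)))) }

-- Skew operators commuting with g and their Cayley transforms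

module Transvection (R : CommutativeRing 0ℓ 0ℓ) (q : ℕ) (F : LinAlg.IsFiniteFieldOfOrder R q)
                    {d : ℕ} (S : AlternatingIsometry R d) where
  open CommutativeRing R hiding (zero)
  open IntegerCoefficients R
  open Vectors R
  open FiniteField R q F
  open LinAlg R
    renaming (_≈v_ to infix 4 _≈v_; _+v_ to infixl 6 _+v_; _-v_ to infixl 6 _-v_; _·s_ to infixr 7 _·s_; _·_ to infixr 8 _·_)
  open import Relation.Binary.Reasoning.Setoid setoid
  open AlternatingIsometry S
  open Isometry R q F S


  -- Σ_{i+j=k} β (fⁱ x) u · fʲ u, by Horner's scheme.
  bezout : (Vect d → Vect d) → Vect d → ℕ → Vect d → Vect d
  bezout f u zero    x = β x u ·s u
  bezout f u (suc k) x = f (bezout f u k x) +v β (pow f (suc k) x) u ·s u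

  module Bezout {f : Vect d → Vect d} (f-linear : Linear f) (u : Vect d) where
    module f = Linear f-linear

    bezout-linear : ∀ k → Linear (bezout f u k)
    bezout-linear zero    = rank-one-linear (β-linearˡ u) u
    bezout-linear (suc k) = +-linear (∘-linear f-linear (bezout-linear k))
      (rank-one-linear (∘-form (β-linearˡ u) (pow-linear f-linear (suc k))) u)

    -- The definition splits off the term j = 0; this splits off i = 0. When both end terms vanish,
    -- comparing the two shows that the sum commutes with f.
    bezout-shift : ∀ k x → bezout f u (suc k) x ≈v bezout f u k (f x) +v β x u ·s pow f (suc k) u
    bezout-shift zero    x i = trans (+-congʳ (f.·s-homo (β x u) u i)) (+-comm _ _)
    bezout-shift (suc k) x i = begin
      f (bezout f u (suc k) x) i + t                                   ≈⟨ +-congʳ (f.cong (bezout-shift k x) i) ⟩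
      f (bezout f u k (f x) +v β x u ·s pow f (suc k) u) i + t         ≈⟨ +-congʳ (f.+-homo _ _ i) ⟩
      f (bezout f u k (f x)) i + f (β x u ·s pow f (suc k) u) i + t    ≈⟨ +-congʳ (+-congˡ (f.·s-homo (β x u) _ i)) ⟩
      f (bezout f u k (f x)) i + β x u * pow f (suc (suc k)) u i + t
        ≈⟨ solve 3 (λ a b t → a :+ b :+ t := a :+ t :+ b) refl _ _ t ⟩
      f (bezout f u k (f x)) i + t + β x u * pow f (suc (suc k)) u i
        ≡⟨ ≡.cong (λ z → f (bezout f u k (f x)) i + β z u * u i + β x u * pow f (suc (suc k)) u i) (pow-suc f (suc k) x) ⟨
      f (bezout f u k (f x)) i + β (pow f (suc k) (f x)) u * u i + β x u * pow f (suc (suc k)) u i ∎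
      where
      t : Carrier
      t = β (pow f (suc (suc k)) x) u * u i

    bezout-commutes : ∀ k → pow f (suc k) u ≈v 0v → (∀ x → β (pow f (suc k) x) u ≈ 0#) →
                      ∀ x → bezout f u k (f x) ≈v f (bezout f u k x)
    bezout-commutes k zu zx x i = begin
      bezout f u k (f x) i                                     ≈⟨ +-identityʳ _ ⟨
      bezout f u k (f x) i + 0#                                ≈⟨ +-congˡ (trans (*-congˡ (zu i)) (zeroʳ _)) ⟨
      bezout f u k (f x) i + β x u * pow f (suc k) u i         ≈⟨ bezout-shift k x i ⟨
      f (bezout f u k x) i + β (pow f (suc k) x) u * u i       ≈⟨ +-congˡ (trans (*-congʳ (zx x)) (zeroˡ _)) ⟩
      f (bezout f u k x) i + 0#                                ≈⟨ +-identityʳ _ ⟩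
      f (bezout f u k x) i                                     ∎

    bezout-kernel : ∀ k {x} → f x ≈v 0v → bezout f u k x ≈v β x u ·s pow f k u
    bezout-kernel zero    e = ≈v-refl
    bezout-kernel (suc k) {x} e i = trans (bezout-shift k x i)
      (trans (+-congʳ (trans (B.cong e i) (B.0-homo i))) (+-identityˡ _))
      where module B = Linear (bezout-linear k)

    bezout-killed : ∀ {p} → Linear p → (∀ x → p (f x) ≈v f (p x)) → p u ≈v 0v →
                    ∀ k x → p (bezout f u k x) ≈v 0v
    bezout-killed {p} P c z zero    x i = trans (Linear.·s-homo P (β x u) u i) (trans (*-congˡ (z i)) (zeroʳ _))
    bezout-killed {p} P c z (suc k) x i = begin
      p (f (bezout f u k x) +v β (pow f (suc k) x) u ·s u) i           ≈⟨ P.+-homo _ _ i ⟩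
      p (f (bezout f u k x)) i + p (β (pow f (suc k) x) u ·s u) i
        ≈⟨ +-cong (trans (c _ i) (trans (f.cong (bezout-killed P c z k x) i) (f.0-homo i)))
                  (trans (P.·s-homo _ u i) (trans (*-congˡ (z i)) (zeroʳ _))) ⟩
      0# + 0#                                                          ≈⟨ +-identityˡ 0# ⟩
      0#                                                               ∎
      where module P = Linear P

    bezout-top : (∀ x → f x ≋ 0v) → ∀ k x → bezout f u k x ≋ β (pow f k x) u ·s u
    bezout-top z zero    x = ≋-reflexive ≈v-refl
    bezout-top z (suc k) x = ≋-trans (≋-+ (z _) (≋-reflexive ≈v-refl)) (≋-reflexive (λ i → +-identityˡ _))

  module _ {f f* : Vect d → Vect d} (f-linear : Linear f) (f*-linear : Linear f*)
           (f-adjoint : ∀ x y → β (f x) y ≈ β x (f* y)) (u : Vect d) where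
    module f* = Bezout f*-linear u

    -- Termwise, the adjoint of x ↦ β (fⁱ x) u · fʲ u is the same expression in f* with i and j
    -- exchanged, and skewness of β gives the sign.
    bezout-adjoint : ∀ k x y → β (bezout f u k x) y ≈ - β x (bezout f* u k y)
    bezout-adjoint zero    x y = begin
      β (β x u ·s u) y          ≈⟨ βˡ.·s-homo y (β x u) u ⟩
      β x u * β u y             ≈⟨ *-congˡ (β-skew u y) ⟩
      β x u * - β y u           ≈⟨ solve 2 (λ s t → s :* :- t := :- (t :* s)) refl (β x u) (β y u) ⟩
      - (β y u * β x u)         ≈⟨ -‿cong (βʳ.·s-homo x (β y u) u) ⟨
      - β x (β y u ·s u)        ∎
    bezout-adjoint (suc k) x y = begin
      β (f (bezout f u k x) +v β (pow f (suc k) x) u ·s u) y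
        ≈⟨ trans (βˡ.+-homo y _ _) (+-cong (f-adjoint _ y) (βˡ.·s-homo y _ u)) ⟩
      β (bezout f u k x) (f* y) + β (pow f (suc k) x) u * β u y
        ≈⟨ +-cong (bezout-adjoint k x (f* y)) (*-cong (adjoint-pow f-adjoint (suc k) x u) (β-skew u y)) ⟩
      - β x (bezout f* u k (f* y)) + β x (pow f* (suc k) u) * - β y u
        ≈⟨ solve 3 (λ a s t → :- a :+ s :* :- t := :- (a :+ t :* s)) refl _ _ (β y u) ⟩
      - (β x (bezout f* u k (f* y)) + β y u * β x (pow f* (suc k) u))
        ≈⟨ -‿cong (trans (βʳ.+-homo x _ _) (+-congˡ (βʳ.·s-homo x _ _))) ⟨
      - β x (bezout f* u k (f* y) +v β y u ·s pow f* (suc k) u)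
        ≈⟨ -‿cong (βʳ.cong x (f*.bezout-shift k y)) ⟨
      - β x (bezout f* u (suc k) y) ∎

  module _ (2≉0 : Char≢2 R) (k : ℕ) (sign-even : sign k ≈ 1#)
           (u : Vect d) (u-killed : pow ν (suc k) u ≈v 0v) where

    module B = Bezout ν-linear u
    module B* = Bezout ν*-linear u

    b-skew : ∀ {x} y → pow ν (suc k) x ≈v 0v → b k x y ≈ - b k y x
    b-skew y e = trans (b-sym k y e) (-‿cong (trans (*-congʳ sign-even) (*-identityˡ _)))

    b-alternating : b k u u ≈ 0#
    b-alternating = x≈-x⇒x≈0 2≉0 (b-skew u u-killed)

    -- The adjoint of the first summand is minus the second one.
    σ : Vect d → Vect d
    σ x = bezout ν u k x +v bezout ν* u k x

    σ-linear : Linear σ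
    σ-linear = +-linear (B.bezout-linear k) (B*.bezout-linear k)

    module σ = Linear σ-linear

    σ-skew : ∀ x y → β (σ x) y ≈ - β x (σ y)
    σ-skew x y = begin
      β (σ x) y             ≈⟨ βˡ.+-homo y _ _ ⟩
      β (bezout ν u k x) y + β (bezout ν* u k x) y
        ≈⟨ +-cong (bezout-adjoint ν-linear ν*-linear ν-adjoint u k x y) (bezout-adjoint ν*-linear ν-linear ν*-adjoint u k x y) ⟩
      - β x (bezout ν* u k y) + - β x (bezout ν u k y)
        ≈⟨ solve 2 (λ a b → :- a :+ :- b := :- (b :+ a)) refl _ _ ⟩
      - (β x (bezout ν u k y) + β x (bezout ν* u k y))    ≈⟨ -‿cong (βʳ.+-homo x _ _) ⟨
      - β x (σ y)           ∎

    u-killed* : pow ν* (suc k) u ≈v 0v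
    u-killed* = ν^-zero⇒ν*^-zero (suc k) u-killed

    g-commutes : ∀ x → σ (g x) ≈v g (σ x)
    g-commutes x i = trans (+-cong (first x i) (second x i)) (sym (g.+-homo _ _ i))
      where
      first : ∀ x → bezout ν u k (g x) ≈v g (bezout ν u k x)
      first x i = begin
        D (g x) i              ≈⟨ D.cong (g≈id+ν x) i ⟩
        D (x +v ν x) i         ≈⟨ D.+-homo x (ν x) i ⟩
        D x i + D (ν x) i      ≈⟨ +-congˡ (B.bezout-commutes k u-killed (λ x → trans (ν^-adjoint (suc k) x u) (βʳ.zero-homo x u-killed*)) x i) ⟩
        D x i + ν (D x) i      ≈⟨ g≈id+ν (D x) i ⟨
        g (D x) i              ∎
        where
        D : Vect d → Vect d
        D = bezout ν u k
        module D = Linear (B.bezout-linear k)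
      D* : Vect d → Vect d
      D* = bezout ν* u k
      module D* = Linear (B*.bezout-linear k)
      backward : ∀ x → D* (g⁻¹ x) ≈v g⁻¹ (D* x)
      backward x i = begin
        D* (g⁻¹ x) i             ≈⟨ D*.cong (g⁻¹≈id+ν* x) i ⟩
        D* (x +v ν* x) i         ≈⟨ D*.+-homo x (ν* x) i ⟩
        D* x i + D* (ν* x) i     ≈⟨ +-congˡ (B*.bezout-commutes k u-killed* (λ x → trans (ν*^-adjoint (suc k) x u) (βʳ.zero-homo x u-killed)) x i) ⟩
        D* x i + ν* (D* x) i     ≈⟨ g⁻¹≈id+ν* (D* x) i ⟨
        g⁻¹ (D* x) i             ∎
      second : ∀ x → D* (g x) ≈v g (D* x)
      second x i = begin
        D* (g x) i               ≈⟨ g-g⁻¹ (D* (g x)) i ⟨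
        g (g⁻¹ (D* (g x))) i     ≈⟨ g.cong (backward (g x)) i ⟨
        g (D* (g⁻¹ (g x))) i     ≈⟨ g.cong (D*.cong (g⁻¹-g x)) i ⟩
        g (D* x) i               ∎

    σ-commutes-ν : ∀ x → σ (ν x) ≈v ν (σ x)
    σ-commutes-ν = commute-ν σ-linear g-commutes

    ν^-flip : ∀ x → β (pow ν k x) u ≈ b k x u
    ν^-flip x = begin
      β (pow ν k x) u           ≈⟨ ν^-adjoint k x u ⟩
      β x (pow ν* k u)          ≈⟨ βʳ.cong x (ν*^-sign k u-killed) ⟩
      β x (sign k ·s pow ν k u) ≈⟨ βʳ.·s-homo x (sign k) _ ⟩
      sign k * b k x u          ≈⟨ trans (*-congʳ sign-even) (*-identityˡ _) ⟩
      b k x u                   ∎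

    σ-top : ∀ x → σ x ≋ (2# * b k x u) ·s u
    σ-top x = ≋-trans (≋-+ (B.bezout-top ν≋0 k x) (B*.bezout-top ν*≋0 k x))
      (≋-reflexive (λ i → trans (+-cong (*-congʳ (ν^-flip x)) (*-congʳ (ν*^-adjoint k x u)))
        (solve 2 (λ s u → s :* u :+ s :* u := (con (+ 1) :+ con (+ 1)) :* s :* u) refl (b k x u) (u i))))

    σ-killed : ∀ x → pow ν (suc k) (σ x) ≈v 0v
    σ-killed x i = trans (N.+-homo _ _ i) (trans (+-cong
      (B.bezout-killed N-linear (λ x i → reflexive (≡.cong (λ t → t i) (pow-suc ν (suc k) x))) u-killed k x i)
      (B*.bezout-killed N-linear (λ x → ≈v-sym (pow-commute ν-linear ν*-commutes-ν (suc k) x)) u-killed k x i))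
      (+-identityˡ 0#))
      where
      N-linear = pow-linear ν-linear (suc k)
      module N = Linear N-linear

    σ-kernel : ∀ {y} → ν y ≈v 0v → σ y ≈v (2# * β y u) ·s pow ν k u
    σ-kernel {y} e i = begin
      bezout ν u k y i + bezout ν* u k y i
        ≈⟨ +-cong (B.bezout-kernel k e i) (B*.bezout-kernel k (ν-zero⇒ν*-zero e) i) ⟩
      β y u * pow ν k u i + β y u * pow ν* k u i
        ≈⟨ +-congˡ (*-congˡ (trans (ν*^-sign k u-killed i) (trans (*-congʳ sign-even) (*-identityˡ _)))) ⟩
      β y u * pow ν k u i + β y u * pow ν k u i
        ≈⟨ solve 2 (λ s t → s :* t :+ s :* t := (con (+ 1) :+ con (+ 1)) :* s :* t) refl _ _ ⟩
      2# * β y u * pow ν k u i     ∎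

    -- On ker ν the values of σ lie on the line of νᵏ u, and σ kills that line because `b k u u` is
    -- zero.
    σσ-kernel : ∀ {y} → ν y ≈v 0v → σ (σ y) ≈v 0v
    σσ-kernel {y} e i = begin
      σ (σ y) i                                   ≈⟨ σ.cong (σ-kernel e) i ⟩
      σ ((2# * β y u) ·s pow ν k u) i             ≈⟨ σ.·s-homo _ _ i ⟩
      2# * β y u * σ (pow ν k u) i                ≈⟨ *-congˡ (σ-kernel u-killed i) ⟩
      2# * β y u * (2# * β (pow ν k u) u * pow ν k u i)
        ≈⟨ *-congˡ (*-congʳ (*-congˡ (trans (ν^-flip u) b-alternating))) ⟩
      2# * β y u * (2# * 0# * pow ν k u i)
        ≈⟨ solve 3 (λ s t w → s :* (t :* con (+ 0) :* w) := con (+ 0)) refl (2# * β y u) 2# _ ⟩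
      0#                                          ∎

    -- The Cayley transform (1 + c σ)(1 − c σ)⁻¹ of the skew operator c σ.
    module Cayley (c : Carrier) where
      τ : Vect d → Vect d
      τ x = x -v c ·s σ x

      τ-linear : Linear τ
      τ-linear = -v-linear id-linear (·s-linear c σ-linear)

      -- If x = c σ x, then νᵏ⁺¹ x = 0 as σ maps into ker νᵏ⁺¹. Going down, once νʲ⁺¹ x = 0 the
      -- vector y = νʲ x is in ker ν and y = c σ y = c² σ σ y = 0.
      τ-injective : ∀ x → τ x ≈v 0v → x ≈v 0v
      τ-injective x z = descend (suc k) (≈v-trans (ν^.cong (suc k) fixed)
        (≈v-trans (ν^.·s-homo (suc k) c (σ x)) (scaled-zero c (σ-killed x))))
        where
        fixed : x ≈v c ·s σ x
        fixed i = x-y≈0⇒x≈y (z i)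
        fixed-ν^ : ∀ j → pow ν j x ≈v c ·s σ (pow ν j x)
        fixed-ν^ j i = trans (ν^.cong j fixed i) (trans (ν^.·s-homo j c (σ x) i)
          (*-congˡ (sym (pow-commute ν-linear σ-commutes-ν j x i))))
        descend : ∀ j → pow ν j x ≈v 0v → x ≈v 0v
        descend zero    e = e
        descend (suc j) e = descend j (λ i → begin
          y i                      ≈⟨ fixed-ν^ j i ⟩
          c * σ y i                ≈⟨ *-congˡ (trans (σ.cong (fixed-ν^ j) i) (σ.·s-homo c (σ y) i)) ⟩
          c * (c * σ (σ y) i)      ≈⟨ *-congˡ (*-congˡ (σσ-kernel e i)) ⟩
          c * (c * 0#)             ≈⟨ solve 1 (λ c → c :* (c :* con (+ 0)) := con (+ 0)) refl c ⟩
          0#                       ∎)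
          where
          y : Vect d
          y = pow ν j x

      open LinearInverse (injective⇒inverse τ-linear τ-injective)
        renaming (f⁻¹ to τ⁻¹; linear to τ⁻¹-linear; inverseʳ to τ-τ⁻¹; inverseˡ to τ⁻¹-τ)

      τ-commutes : ∀ x → τ (g x) ≈v g (τ x)
      τ-commutes x i = trans (+-congˡ (-‿cong (trans (*-congˡ (g-commutes x i)) (sym (g.·s-homo c (σ x) i)))))
        (sym (g.-v-homo x _ i))

      τ⁻¹-commutes : ∀ x → τ⁻¹ (g x) ≈v g (τ⁻¹ x)
      τ⁻¹-commutes x = ≈v-trans
        (Linear.cong τ⁻¹-linear (≈v-trans (g.cong (≈v-sym (τ-τ⁻¹ x))) (≈v-sym (τ-commutes (τ⁻¹ x)))))
        (τ⁻¹-τ (g (τ⁻¹ x)))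

      cayley : Vect d → Vect d
      cayley x = τ⁻¹ x +v c ·s σ (τ⁻¹ x)

      numerator-linear : Linear (λ x → x +v c ·s σ x)
      numerator-linear = +-linear id-linear (·s-linear c σ-linear)

      -- Both sides are β x y + c² β (σ x) (σ y), as σ is skew.
      numerator-denominator : ∀ x y → β (x +v c ·s σ x) (y +v c ·s σ y) ≈ β (τ x) (τ y)
      numerator-denominator x y = begin
        β (x +v c ·s σ x) (y +v c ·s σ y)
          ≈⟨ trans (βˡ.+-homo _ x _) (+-cong (expand x) (trans (βˡ.·s-homo _ c (σ x)) (*-congˡ (expand (σ x))))) ⟩
        β x y + c * β x (σ y) + c * (β (σ x) y + c * β (σ x) (σ y))
          ≈⟨ +-congˡ (*-congˡ (+-congʳ (σ-skew x y))) ⟩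
        β x y + c * β x (σ y) + c * (- β x (σ y) + c * β (σ x) (σ y))
          ≈⟨ solve 4 (λ a b e c → a :+ c :* b :+ c :* (:- b :+ c :* e) := a :- c :* b :- c :* (:- b :- c :* e)) refl
               (β x y) (β x (σ y)) (β (σ x) (σ y)) c ⟩
        β x y - c * β x (σ y) - c * (- β x (σ y) - c * β (σ x) (σ y))
          ≈⟨ +-congˡ (-‿cong (*-congˡ (+-congʳ (σ-skew x y)))) ⟨
        β x y - c * β x (σ y) - c * (β (σ x) y - c * β (σ x) (σ y))
          ≈⟨ trans (βˡ.-v-homo _ x _) (+-cong (expand′ x) (-‿cong (trans (βˡ.·s-homo _ c (σ x)) (*-congˡ (expand′ (σ x)))))) ⟨
        β (τ x) (τ y)                       ∎
        where
        expand : ∀ z → β z (y +v c ·s σ y) ≈ β z y + c * β z (σ y)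
        expand z = trans (βʳ.+-homo z y _) (+-congˡ (βʳ.·s-homo z c (σ y)))
        expand′ : ∀ z → β z (y -v c ·s σ y) ≈ β z y - c * β z (σ y)
        expand′ z = trans (βʳ.-v-homo z y _) (+-congˡ (-‿cong (βʳ.·s-homo z c (σ y))))

      cayley-centralizing : Centralizing cayley
      cayley-centralizing = record
        { linear = ∘-linear numerator-linear τ⁻¹-linear
        ; preserves = λ x y → trans (numerator-denominator (τ⁻¹ x) (τ⁻¹ y)) (β-cong (τ-τ⁻¹ x) (τ-τ⁻¹ y))
        ; commutes = λ x i → begin
            τ⁻¹ (g x) i + c * σ (τ⁻¹ (g x)) i       ≈⟨ +-cong (τ⁻¹-commutes x i) (*-congˡ (σ.cong (τ⁻¹-commutes x) i)) ⟩
            g (τ⁻¹ x) i + c * σ (g (τ⁻¹ x)) i       ≈⟨ +-congˡ (trans (*-congˡ (g-commutes (τ⁻¹ x) i)) (sym (g.·s-homo c (σ (τ⁻¹ x)) i))) ⟩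
            g (τ⁻¹ x) i + g (c ·s σ (τ⁻¹ x)) i      ≈⟨ g.+-homo _ _ i ⟨
            g (cayley x) i                          ∎ }

      -- The transform sends v to v + 2c σ v′ with v′ = τ⁻¹ v, and v′ has the same pairing with u as
      -- v, since σ v′ is congruent to a multiple of u and `b k u u` is zero. One factor 2 comes
      -- from the Cayley transform, the other from the two summands of σ.
      cayley-∼ : ∀ v → v ∼ v +v (2# * (c * (2# * b k v u))) ·s u
      cayley-∼ v = record
        { centralizing = cayley-centralizing
        ; image = ≋-trans (≋-reflexive shape) (≋-+ (≋-reflexive ≈v-refl) (≋-trans (≋-·s (2# * c) (σ-top v′))
            (≋-reflexive (λ i → trans (*-congˡ (*-congʳ (*-congˡ top)))
              (solve 4 (λ t c s u → t :* c :* (t :* s :* u) := t :* (c :* (t :* s)) :* u) refl 2# c (b k v u) (u i)))))) }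
        where
        v′ : Vect d
        v′ = τ⁻¹ v
        v≈ : v ≈v v′ +v (- c) ·s σ v′
        v≈ i = trans (sym (τ-τ⁻¹ v i)) (solve 3 (λ a c s → a :- c :* s := a :+ (:- c) :* s) refl (v′ i) c (σ v′ i))
        shape : cayley v ≈v v +v (2# * c) ·s σ v′
        shape i = trans (solve 3 (λ a c s → a :+ c :* s := (a :+ (:- c) :* s) :+ (con (+ 1) :+ con (+ 1)) :* c :* s) refl (v′ i) c (σ v′ i))
          (+-congʳ (sym (v≈ i)))
        top : b k v′ u ≈ b k v u
        top = sym (begin
          b k v u                                        ≈⟨ bˡ.cong k u v≈ ⟩
          b k (v′ +v (- c) ·s σ v′) u                    ≈⟨ bˡ.+-homo k u v′ _ ⟩
          b k v′ u + b k ((- c) ·s σ v′) u               ≈⟨ +-congˡ (bˡ.·s-homo k u (- c) (σ v′)) ⟩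
          b k v′ u + - c * b k (σ v′) u                  ≈⟨ +-congˡ (*-congˡ (b-≋ˡ k (σ-top v′) u-killed)) ⟩
          b k v′ u + - c * b k ((2# * b k v′ u) ·s u) u  ≈⟨ +-congˡ (*-congˡ (trans (bˡ.·s-homo k u _ u) (*-congˡ b-alternating))) ⟩
          b k v′ u + - c * (2# * b k v′ u * 0#)
            ≈⟨ solve 3 (λ s c t → s :+ :- c :* (t :* con (+ 0)) := s) refl (b k v′ u) c _ ⟩
          b k v′ u                                       ∎)

-- Transitivity of C_G(g) and invariants of its orbits

module Orbits (R : CommutativeRing 0ℓ 0ℓ) (q : ℕ) (F : LinAlg.IsFiniteFieldOfOrder R q)
              {d : ℕ} (S : AlternatingIsometry R d)
              (2≉0 : Char≢2 R) where
  open CommutativeRing R hiding (zero)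
  open IntegerCoefficients R
  open Vectors R
  open FiniteField R q F
  open LinAlg R
    renaming (_≈v_ to infix 4 _≈v_; _+v_ to infixl 6 _+v_; _-v_ to infixl 6 _-v_; _·s_ to infixr 7 _·s_; _·_ to infixr 8 _·_)
  open import Relation.Binary.Reasoning.Setoid setoid
  open AlternatingIsometry S
  open Isometry R q F S


  -- v has a nonzero component at the Jordan blocks of size k + 1 and none at larger ones.
  record Top (k : ℕ) (v : Vect d) : Set where
    field
      killed : pow ν (suc k) v ≈v 0v
      partner : Vect d
      partner-killed : pow ν (suc k) partner ≈v 0v
      paired : ¬ b k v partner ≈ 0#

  killed-+ : ∀ k {x y} → pow ν k x ≈v 0v → pow ν k y ≈v 0v → pow ν k (x +v y) ≈v 0v
  killed-+ k e f i = trans (ν^.+-homo k _ _ i) (trans (+-cong (e i) (f i)) (+-identityˡ 0#))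

  killed-·s : ∀ k c {x} → pow ν k x ≈v 0v → pow ν k (c ·s x) ≈v 0v
  killed-·s k c e i = trans (ν^.·s-homo k c _ i) (trans (*-congˡ (e i)) (zeroʳ c))

  killed--v : ∀ k {x y} → pow ν k x ≈v 0v → pow ν k y ≈v 0v → pow ν k (x -v y) ≈v 0v
  killed--v k e f i = trans (ν^.-v-homo k _ _ i) (trans (+-cong (e i) (-‿cong (f i))) (-‿inverseʳ 0#))

  -- A space is not the union of two proper subspaces: if neither given partner pairs with both
  -- vectors, the sum of the partners does.
  common-partner : ∀ {k v w} → Top k v → Top k w →
                   ∃ λ y → pow ν (suc k) y ≈v 0v × ¬ b k v y ≈ 0# × ¬ b k w y ≈ 0#
  common-partner {k} {v} {w} Tv Tw with b k w (Top.partner Tv) ≈? 0# | b k v (Top.partner Tw) ≈? 0#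
  ... | no p  | _     = _ , Top.partner-killed Tv , Top.paired Tv , p
  ... | yes _ | no p  = _ , Top.partner-killed Tw , p , Top.paired Tw
  ... | yes p | yes p′ = y +v y′ , killed-+ (suc k) (Top.partner-killed Tv) (Top.partner-killed Tw)
      , (λ e → Top.paired Tv (trans (sym (trans (bʳ.+-homo k v y y′) (trans (+-congˡ p′) (+-identityʳ _)))) e))
      , (λ e → Top.paired Tw (trans (sym (trans (bʳ.+-homo k w y y′) (trans (+-congʳ p) (+-identityˡ _)))) e))
    where
    y y′ : Vect d
    y = Top.partner Tv
    y′ = Top.partner Tw

  cancel-step : ∀ (v w : Vect d) → v -v 1# ·s (v -v w) ≈v w
  cancel-step v w i = solve 2 (λ v w → v :- con (+ 1) :* (v :- w) := w) refl (v i) (w i)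

  module Even (k : ℕ) (sign-odd : sign k ≈ - 1#) where
    b-symmetric : ∀ {x} y → pow ν (suc k) x ≈v 0v → b k x y ≈ b k y x
    b-symmetric y e = trans (b-sym k y e) (trans (-‿cong (*-congʳ sign-odd))
      (solve 1 (λ t → :- (:- con (+ 1) :* t) := t) refl _))

    -- This makes the factor 2 b(v, u) / b(u, u) in the reflection along u = v - w equal to 1, so
    -- that the reflection carries v to w.
    b-of-difference : ∀ {v w} → pow ν (suc k) v ≈v 0v → b k v v ≈ b k w w →
                      b k (v -v w) (v -v w) ≈ 2# * b k v (v -v w)
    b-of-difference {v} {w} kv eq = begin
      b k (v -v w) (v -v w)                ≈⟨ bˡ.-v-homo k (v -v w) v w ⟩
      b k v (v -v w) - b k w (v -v w)      ≈⟨ +-cong (bʳ.-v-homo k v v w) (-‿cong (bʳ.-v-homo k w v w)) ⟩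
      b k v v - b k v w - (b k w v - b k w w)
        ≈⟨ +-congˡ (-‿cong (+-cong (sym (b-symmetric w kv)) (-‿cong (sym eq)))) ⟩
      b k v v - b k v w - (b k v w - b k v v)
        ≈⟨ solve 2 (λ s t → s :- t :- (t :- s) := (con (+ 1) :+ con (+ 1)) :* (s :- t)) refl (b k v v) (b k v w) ⟩
      2# * (b k v v - b k v w)             ≈⟨ *-congˡ (bʳ.-v-homo k v v w) ⟨
      2# * b k v (v -v w)                  ∎

    reflect : ∀ {v w} → pow ν (suc k) v ≈v 0v → pow ν (suc k) w ≈v 0v → b k v v ≈ b k w w →
              ¬ b k (v -v w) (v -v w) ≈ 0# → v ∼ w
    reflect {v} {w} kv kw eq aniso = ∼-trans
      (Reflection.reflection-∼ R q F S k u (killed--v (suc k) kv kw) aniso v)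
      (≋⇒∼ (≋-reflexive (λ i → trans (+-congˡ (-‿cong (*-congʳ one))) (cancel-step v w i))))
      where
      u : Vect d
      u = v -v w
      one : 2# * (b k u u ⁻¹ * b k v u) ≈ 1#
      one = begin
        2# * (b k u u ⁻¹ * b k v u)    ≈⟨ solve 3 (λ t i s → t :* (i :* s) := t :* s :* i) refl 2# (b k u u ⁻¹) (b k v u) ⟩
        2# * b k v u * b k u u ⁻¹      ≈⟨ *-congʳ (b-of-difference kv eq) ⟨
        b k u u * b k u u ⁻¹           ≈⟨ ⁻¹-inverseʳ aniso ⟩
        1#                             ∎

    -- Reflecting along v + w carries v to -w, and -1 itself belongs to C_G(g).
    reflect-sum : ∀ {v w} → pow ν (suc k) v ≈v 0v → pow ν (suc k) w ≈v 0v → b k v v ≈ b k w w →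
                  ¬ b k v (v +v w) ≈ 0# → v ∼ w
    reflect-sum {v} {w} kv kw eq aniso = ∼-trans (reflect kv k-w eq-w aniso′) (neg-∼ w)
      where
      k-w : pow ν (suc k) ((- 1#) ·s w) ≈v 0v
      k-w = killed-·s (suc k) (- 1#) kw
      eq-w : b k v v ≈ b k ((- 1#) ·s w) ((- 1#) ·s w)
      eq-w = trans eq (sym (trans (bˡ.·s-homo k _ (- 1#) w) (trans (*-congˡ (bʳ.·s-homo k w (- 1#) w))
        (solve 1 (λ t → con (ℤ.- + 1) :* (con (ℤ.- + 1) :* t) := t) refl _))))
      aniso′ : ¬ b k (v -v (- 1#) ·s w) (v -v (- 1#) ·s w) ≈ 0#
      aniso′ e = aniso (trans (bʳ.cong k v (λ i → solve 2 (λ v w → v :+ w := v :- con (ℤ.- + 1) :* w) refl (v i) (w i)))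
        (*-integral (trans (sym (b-of-difference kv eq-w)) e) 2≉0))

    -- If neither v − w nor v + w is anisotropic, v and w are orthogonal isotropic vectors, and the
    -- reflections pass through an isotropic vector orthogonal to neither of them.
    transitive : ∀ {v w} → Top k v → Top k w → b k v v ≈ b k w w → v ∼ w
    transitive {v} {w} Tv Tw eq with b k (v -v w) (v -v w) ≈? 0# | b k v (v +v w) ≈? 0#
    ... | no p  | _    = reflect (Top.killed Tv) (Top.killed Tw) eq p
    ... | yes _ | no p = reflect-sum (Top.killed Tv) (Top.killed Tw) eq p
    ... | yes p | yes p′ = ∼-trans (reflect kv kz (trans v-iso (sym z-iso)) v-z) (reflect kz kw (trans z-iso (sym w-iso)) z-w)
      where
      kv = Top.killed Tv
      kw = Top.killed Tw
      Y = common-partner Tv Tw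
      y : Vect d
      y = proj₁ Y
      ky = proj₁ (proj₂ Y)
      vy = proj₁ (proj₂ (proj₂ Y))
      wy = proj₂ (proj₂ (proj₂ Y))
      difference : b k v v - b k v w ≈ 0#
      difference = trans (sym (bʳ.-v-homo k v v w)) (*-integral (trans (sym (b-of-difference kv eq)) p) 2≉0)
      total : b k v v + b k v w ≈ 0#
      total = trans (sym (bʳ.+-homo k v v w)) p′
      v-iso : b k v v ≈ 0#
      v-iso = *-integral (begin
        2# * b k v v                                       ≈⟨ solve 2 (λ s t → (con (+ 1) :+ con (+ 1)) :* s := (s :- t) :+ (s :+ t)) refl _ (b k v w) ⟩
        (b k v v - b k v w) + (b k v v + b k v w)          ≈⟨ +-cong difference total ⟩
        0# + 0#                                            ≈⟨ +-identityˡ 0# ⟩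
        0#                                                 ∎) 2≉0
      w-iso : b k w w ≈ 0#
      w-iso = trans (sym eq) v-iso
      vw : b k v w ≈ 0#
      vw = trans (sym (x-y≈0⇒x≈y difference)) v-iso
      s : Carrier
      -- The root of b(y, y) + 2 s b(v, y) = 0, which makes z isotropic. Since v is orthogonal to
      -- itself and to w, the pairings of z with v and w are those of y.
      s = - (b k y y * (2# * b k v y) ⁻¹)
      z : Vect d
      z = y +v s ·s v
      kz : pow ν (suc k) z ≈v 0v
      kz = killed-+ (suc k) ky (killed-·s (suc k) s kv)
      b-z : ∀ x → b k x z ≈ b k x y + s * b k x v
      b-z x = trans (bʳ.+-homo k x y (s ·s v)) (+-congˡ (bʳ.·s-homo k x s v))
      vz : ¬ b k v z ≈ 0#
      vz e = vy (trans (sym (trans (b-z v) (trans (+-congˡ (trans (*-congˡ v-iso) (zeroʳ s))) (+-identityʳ _)))) e)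
      wz : ¬ b k w z ≈ 0#
      wz e = wy (trans (sym (trans (b-z w) (trans (+-congˡ (trans (*-congˡ (trans (b-symmetric v kw) vw)) (zeroʳ s))) (+-identityʳ _)))) e)
      z-iso : b k z z ≈ 0#
      z-iso = begin
        b k z z                                        ≈⟨ trans (bˡ.+-homo k z y (s ·s v)) (+-congˡ (bˡ.·s-homo k z s v)) ⟩
        b k y z + s * b k v z                          ≈⟨ +-cong (b-z y) (*-congˡ (b-z v)) ⟩
        b k y y + s * b k y v + s * (b k v y + s * b k v v)
          ≈⟨ +-cong (+-congˡ (*-congˡ (b-symmetric v ky))) (*-congˡ (+-congˡ (*-congˡ v-iso))) ⟩
        b k y y + s * b k v y + s * (b k v y + s * 0#)
          ≈⟨ solve 3 (λ c a i → c :+ :- (c :* i) :* a :+ :- (c :* i) :* (a :+ :- (c :* i) :* con (+ 0))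
                              := c :- c :* ((con (+ 1) :+ con (+ 1)) :* a :* i)) refl (b k y y) (b k v y) ((2# * b k v y) ⁻¹) ⟩
        b k y y - b k y y * (2# * b k v y * (2# * b k v y) ⁻¹)
          ≈⟨ +-congˡ (-‿cong (*-congˡ (⁻¹-inverseʳ (*-nonzero 2≉0 vy)))) ⟩
        b k y y - b k y y * 1#                         ≈⟨ solve 1 (λ c → c :- c :* con (+ 1) := con (+ 0)) refl _ ⟩
        0#                                             ∎
      anisotropic-difference : ∀ {x x′} → pow ν (suc k) x ≈v 0v → b k x x ≈ 0# → b k x′ x′ ≈ 0# →
                               ¬ b k x x′ ≈ 0# → ¬ b k (x -v x′) (x -v x′) ≈ 0#
      anisotropic-difference {x} {x′} kx x-iso x′-iso n e = -‿nonzero n (begin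
        - b k x x′                 ≈⟨ +-identityˡ _ ⟨
        0# - b k x x′              ≈⟨ +-congʳ x-iso ⟨
        b k x x - b k x x′         ≈⟨ bʳ.-v-homo k x x x′ ⟨
        b k x (x -v x′)            ≈⟨ *-integral (trans (sym (b-of-difference kx (trans x-iso (sym x′-iso)))) e) 2≉0 ⟩
        0#                         ∎)
      v-z : ¬ b k (v -v z) (v -v z) ≈ 0#
      v-z = anisotropic-difference kv v-iso z-iso vz
      z-w : ¬ b k (z -v w) (z -v w) ≈ 0#
      z-w = anisotropic-difference kz z-iso w-iso (λ e → wz (trans (b-symmetric z kw) e))

  module Odd (k : ℕ) (sign-even : sign k ≈ 1#) where
    transvect : ∀ {v w} → pow ν (suc k) v ≈v 0v → pow ν (suc k) w ≈v 0v → ¬ b k v w ≈ 0# → v ∼ w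
    transvect {v} {w} kv kw p = ∼-trans
      (T.Cayley.cayley-∼ 2≉0 k sign-even u ku c v)
      (≋⇒∼ (≋-reflexive (λ i → trans (+-congˡ (*-congʳ one)) (solve 2 (λ v w → v :+ con (+ 1) :* (w :- v) := w) refl (v i) (w i)))))
      where
      u : Vect d
      u = w -v v
      module T = Transvection R q F S
      ku = killed--v (suc k) kw kv
      c : Carrier
      -- The Cayley transform moves v by 4 c b(v, u) u. This coefficient has to be 1 for v to reach
      -- v + u = w, and b(v, u) = b(v, w) because b(v, v) = 0.
      c = (2# * (2# * b k v w)) ⁻¹
      bvu : b k v u ≈ b k v w
      bvu = trans (bʳ.-v-homo k v w v) (trans (+-congˡ (trans (-‿cong (T.b-alternating 2≉0 k sign-even v kv))
        (solve 0 (:- con (+ 0) := con (+ 0)) refl))) (+-identityʳ _))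
      one : 2# * (c * (2# * b k v u)) ≈ 1#
      one = begin
        2# * (c * (2# * b k v u))        ≈⟨ *-congˡ (*-congˡ (*-congˡ bvu)) ⟩
        2# * (c * (2# * b k v w))        ≈⟨ solve 3 (λ t c s → t :* (c :* (t :* s)) := t :* (t :* s) :* c) refl 2# c (b k v w) ⟩
        2# * (2# * b k v w) * c          ≈⟨ ⁻¹-inverseʳ (*-nonzero 2≉0 (*-nonzero 2≉0 p)) ⟩
        1#                               ∎

    -- A single transvection needs v and w not orthogonal. A common partner y is orthogonal to
    -- neither, so v → y → w always works; an alternating form leaves no value to match.
    transitive : ∀ {v w} → Top k v → Top k w → v ∼ w
    transitive Tv Tw =
      let y , ky , vy , wy = common-partner Tv Tw
      in ∼-trans (transvect (Top.killed Tv) ky vy)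
           (transvect ky (Top.killed Tw) (λ e → wy (trans (T.b-skew 2≉0 k sign-even _ (Top.killed Tw) y (Top.killed Tw)) (trans (-‿cong e) (solve 0 (:- con (+ 0) := con (+ 0)) refl)))))
      where module T = Transvection R q F S

  killed-image : ∀ {h} → Centralizing h → ∀ k {x} → pow ν k x ≈v 0v → pow ν k (h x) ≈v 0v
  killed-image H k {x} e = ≈v-trans (≈v-sym (commutes-ν^ k x)) (≈v-trans (cong e) 0-homo)
    where open Centralizing H

  b-image : ∀ {h} → Centralizing h → ∀ k x y → b k (h x) (h y) ≈ b k x y
  b-image {h} H k x y = trans (sym (βʳ.cong (h x) (commutes-ν^ k y))) (preserves x (pow ν k y))
    where open Centralizing H

  -- A centralizing h keeps `b k` and ker νᵏ⁺¹, so the image of v still pairs with the image of its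
  -- partner, while a vector of ker νᵏ is in the radical of `b k`.
  Top-∼-killed : ∀ {k v w} → Top k v → pow ν k w ≈v 0v → ¬ v ∼ w
  Top-∼-killed {k} {v} {w} T kw o = Top.paired T (begin
    b k v y                ≈⟨ b-image O.centralizing k v y ⟨
    b k (O.map v) (O.map y)  ≈⟨ b-≋ˡ k O.image (killed-image O.centralizing (suc k) (Top.partner-killed T)) ⟩
    b k w (O.map y)        ≈⟨ b-zeroˡ k (O.map y) kw ⟩
    0#                     ∎)
    where
    module O = _∼_ o
    y : Vect d
    y = Top.partner T

  killed-∼-Top : ∀ {k v w} → pow ν k v ≈v 0v → Top k w → ¬ v ∼ w
  killed-∼-Top {k} {v} {w} kv T o = Top.paired T (begin
    b k w y              ≈⟨ b-≋ˡ k O.image (Top.partner-killed T) ⟨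
    b k (O.map v) y      ≈⟨ b-zeroˡ k y (killed-image O.centralizing k kv) ⟩
    0#                   ∎)
    where
    module O = _∼_ o
    y : Vect d
    y = Top.partner T

  -- The image of v equals w only modulo [V, g], and the congruence can be used only in the left
  -- slot; (skew-)symmetry of `b k` brings the second slot there.
  ∼⇒b≈ : ∀ {k v w} → pow ν (suc k) v ≈v 0v → pow ν (suc k) w ≈v 0v → v ∼ w → b k v v ≈ b k w w
  ∼⇒b≈ {k} {v} {w} kv kw o = begin
    b k v v                      ≈⟨ b-image O.centralizing k v v ⟨
    b k hv hv                    ≈⟨ b-≋ˡ k O.image khv ⟩
    b k w hv                     ≈⟨ b-sym k hv kw ⟩
    - (sign k * b k hv w)        ≈⟨ -‿cong (*-congˡ (b-≋ˡ k O.image kw)) ⟩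
    - (sign k * b k w w)         ≈⟨ b-sym k w kw ⟨
    b k w w                      ∎
    where
    module O = _∼_ o
    hv : Vect d
    hv = O.map v
    khv : pow ν (suc k) hv ≈v 0v
    khv = killed-image O.centralizing (suc k) kv

-- Counting with finite sets and involutions

record Enumeration {n} (P : Fin n → Set) : Set where
  field
    size : ℕ
    element : Fin size → Fin n
    sound : ∀ j → P (element j)
    injective : ∀ {j j′} → element j ≡ element j′ → j ≡ j′
    complete : ∀ i → P i → ∃ λ j → element j ≡ i

enumerate : ∀ {n} {P : Fin n → Set} → U.Decidable P → Enumeration P
enumerate {zero} P? = record
  { size = 0 ; element = λ () ; sound = λ () ; injective = λ {j} → λ { {()} } ; complete = λ () }
enumerate {suc n} {P} P? with P? zero
... | no ¬p = record
  { size = E.size ; element = suc ∘ E.element ; sound = E.sound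
  ; injective = E.injective ∘ Finₚ.suc-injective
  ; complete = λ { zero p → contradiction p ¬p
                 ; (suc i) p → proj₁ (E.complete i p) , ≡.cong suc (proj₂ (E.complete i p)) } }
  where module E = Enumeration (enumerate (P? ∘ suc))
... | yes p₀ = record
  { size = suc E.size
  ; element = λ { zero → zero ; (suc j) → suc (E.element j) }
  ; sound = λ { zero → p₀ ; (suc j) → E.sound j }
  ; injective = λ { {zero} {zero} _ → ≡.refl
                  ; {suc j} {suc j′} e → ≡.cong suc (E.injective (Finₚ.suc-injective e)) }
  ; complete = λ { zero _ → zero , ≡.refl
                 ; (suc i) p → suc (proj₁ (E.complete i p)) , ≡.cong suc (proj₂ (E.complete i p)) } }
  where module E = Enumeration (enumerate (P? ∘ suc))

bijection⇒≡ : ∀ {m n} (f : Fin m → Fin n) → (∀ {i j} → f i ≡ f j → i ≡ j) → (∀ i → ∃ λ j → f j ≡ i) → m ≡ n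
bijection⇒≡ f inj surj = Finₚ.cantor-schröder-bernstein {f = f} {g = proj₁ ∘ surj} inj
  (λ {i} {j} e → ≡.trans (≡.sym (proj₂ (surj i))) (≡.trans (≡.cong f e) (proj₂ (surj j))))

module Involution {n} (ι : Fin n → Fin n) (involutive : ∀ i → ι (ι i) ≡ i) where
  -- One element of each two-element orbit.
  open Enumeration (enumerate (λ i → i Finₚ.<? ι i)) public
    renaming (size to half; element to lower; sound to lower-sound; injective to lower-injective; complete to lower-complete)

  ι-injective : ∀ {i j} → ι i ≡ ι j → i ≡ j
  ι-injective {i} {j} e = ≡.trans (≡.sym (involutive i)) (≡.trans (≡.cong ι e) (involutive j))

  lower≢ι-lower : ∀ j j′ → ¬ lower j ≡ ι (lower j′)
  lower≢ι-lower j j′ e = Finₚ.<-asym (lower-sound j)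
    (≡.subst₂ Fin._<_ (≡.sym (≡.trans (≡.cong ι e) (involutive (lower j′)))) (≡.sym e) (lower-sound j′))

  classify : ∀ i → ¬ ι i ≡ i → (∃ λ j → lower j ≡ i) ⊎ (∃ λ j → ι (lower j) ≡ i)
  classify i moved with Finₚ.<-cmp i (ι i)
  ... | tri< i<ιi _ _ = inj₁ (lower-complete i i<ιi)
  ... | tri≈ _ i≡ιi _ = contradiction (≡.sym i≡ιi) moved
  ... | tri> _ _ ιi<i =
    let j , e = lower-complete (ι i) (≡.subst (ι i Fin.<_) (≡.sym (involutive i)) ιi<i)
    in inj₂ (j , ≡.trans (≡.cong ι e) (involutive i))

  both : Fin (half ℕ.+ half) → Fin n
  both = [ lower , ι ∘ lower ]′ ∘ Fin.splitAt half

  both-injective : ∀ {i j} → both i ≡ both j → i ≡ j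
  both-injective {i} {j} e = ≡.trans (≡.sym (Finₚ.join-splitAt half half i))
    (≡.trans (≡.cong (Fin.join half half) (sides (Fin.splitAt half i) (Fin.splitAt half j) e)) (Finₚ.join-splitAt half half j))
    where
    sides : ∀ s t → [ lower , ι ∘ lower ]′ s ≡ [ lower , ι ∘ lower ]′ t → s ≡ t
    sides (inj₁ x) (inj₁ y) e = ≡.cong inj₁ (lower-injective e)
    sides (inj₁ x) (inj₂ y) e = contradiction e (lower≢ι-lower x y)
    sides (inj₂ x) (inj₁ y) e = contradiction (≡.sym e) (lower≢ι-lower y x)
    sides (inj₂ x) (inj₂ y) e = ≡.cong inj₂ (lower-injective (ι-injective e))

  both-moved : ∀ i → ¬ ι i ≡ i → ∃ λ j → both j ≡ i
  both-moved i moved with classify i moved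
  ... | inj₁ (j , e) = Fin.join half half (inj₁ j) ,
    ≡.trans (≡.cong [ lower , ι ∘ lower ]′ (Finₚ.splitAt-join half half (inj₁ j))) e
  ... | inj₂ (j , e) = Fin.join half half (inj₂ j) ,
    ≡.trans (≡.cong [ lower , ι ∘ lower ]′ (Finₚ.splitAt-join half half (inj₂ j))) e

  both-is-moved : ∀ j → ¬ ι (both j) ≡ both j
  both-is-moved j with Fin.splitAt half j
  ... | inj₁ x = λ e → lower≢ι-lower x x (≡.sym e)
  ... | inj₂ x = λ e → lower≢ι-lower x x (≡.trans (≡.sym (involutive (lower x))) e)

  fixed-point-free : (∀ i → ¬ ι i ≡ i) → half ℕ.+ half ≡ n
  fixed-point-free moved = bijection⇒≡ both both-injective (λ i → both-moved i (moved i))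

  unique-fixed-point : ∀ i₀ → ι i₀ ≡ i₀ → (∀ i → ι i ≡ i → i ≡ i₀) → suc (half ℕ.+ half) ≡ n
  unique-fixed-point i₀ fixed unique = bijection⇒≡ f f-injective f-surjective
    where
    f : Fin (suc (half ℕ.+ half)) → Fin n
    f zero    = i₀
    f (suc j) = both j
    i₀≢both : ∀ j → ¬ i₀ ≡ both j
    i₀≢both j e = both-is-moved j (≡.subst (λ i → ι i ≡ i) e fixed)
    f-injective : ∀ {i j} → f i ≡ f j → i ≡ j
    f-injective {zero}  {zero}  e = ≡.refl
    f-injective {zero}  {suc j} e = contradiction e (i₀≢both j)
    f-injective {suc i} {zero}  e = contradiction (≡.sym e) (i₀≢both i)
    f-injective {suc i} {suc j} e = ≡.cong suc (both-injective e)
    f-surjective : ∀ i → ∃ λ j → f j ≡ i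
    f-surjective i with ι i Fin.≟ i
    ... | yes e = zero , ≡.sym (unique i e)
    ... | no ¬e = let j , e = both-moved i ¬e in suc j , e

k+k≡k*2 : ∀ k → k ℕ.+ k ≡ k ℕ.* 2
k+k≡k*2 k = ≡.trans (≡.cong (k ℕ.+_) (≡.sym (ℕₚ.+-identityʳ k))) (ℕₚ.*-comm 2 k)

-- Squares and values of quadratic forms in odd characteristic

module OddFiniteField (R : CommutativeRing 0ℓ 0ℓ) (q : ℕ) (F : LinAlg.IsFiniteFieldOfOrder R q)
                      (odd : q % 2 ≡ 1) where
  open CommutativeRing R hiding (zero)
  open IntegerCoefficients R
  open Vectors R
  open FiniteField R q F
  open LinAlg R
    renaming (_≈v_ to infix 4 _≈v_; _+v_ to infixl 6 _+v_; _-v_ to infixl 6 _-v_; _·s_ to infixr 7 _·s_; _·_ to infixr 8 _·_)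
  open import Relation.Binary.Reasoning.Setoid setoid

  -- In characteristic 2 the map x ↦ x + 1 pairs off the elements of the field.
  2≉0 : Char≢2 R
  2≉0 2≈0 = contradiction (≡.trans (≡.sym odd) (≡.trans (≡.cong (_% 2)
      (≡.trans (≡.sym (I.fixed-point-free moved)) (k+k≡k*2 I.half))) (ℕ.m*n%n≡0 I.half 2))) λ ()
    where
    ι : Fin q → Fin q
    ι i = index (enum i + 1#)
    involutive : ∀ i → ι (ι i) ≡ i
    involutive i = ≡.trans (index-cong (begin
      enum (ι i) + 1#       ≈⟨ +-congʳ (enum-index _) ⟩
      enum i + 1# + 1#      ≈⟨ +-assoc _ _ _ ⟩
      enum i + (1# + 1#)    ≈⟨ +-congˡ 2≈0 ⟩
      enum i + 0#           ≈⟨ +-identityʳ _ ⟩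
      enum i                ∎)) (index-enum i)
    moved : ∀ i → ¬ ι i ≡ i
    moved i e = 0≉1 (begin
      0#                       ≈⟨ -‿inverseˡ (enum i) ⟨
      - enum i + enum i        ≈⟨ +-congˡ (trans (sym (reflexive (≡.cong enum e))) (enum-index _)) ⟩
      - enum i + (enum i + 1#) ≈⟨ solve 2 (λ x t → :- x :+ (x :+ t) := t) refl (enum i) 1# ⟩
      1#                       ∎)
    module I = Involution ι involutive

  private
    ι : Fin q → Fin q
    ι i = index (- enum i)

    involutive : ∀ i → ι (ι i) ≡ i
    involutive i = ≡.trans (index-cong (trans (-‿cong (enum-index _)) (solve 1 (λ x → :- (:- x) := x) refl (enum i)))) (index-enum i)

    module I = Involution ι involutive

    fixed⇒0 : ∀ i → ι i ≡ i → enum i ≈ 0#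
    fixed⇒0 i e = x≈-x⇒x≈0 2≉0 (trans (sym (reflexive (≡.cong enum e))) (enum-index _))

    -0≈0 : - 0# ≈ 0#
    -0≈0 = solve 0 (:- con (+ 0) := con (+ 0)) refl

    0⇒fixed : ∀ i → enum i ≈ 0# → ι i ≡ i
    0⇒fixed i e = ≡.trans (index-cong (trans (-‿cong e) (trans -0≈0 (sym e)))) (index-enum i)

    q≡ : suc (I.half ℕ.+ I.half) ≡ q
    q≡ = I.unique-fixed-point (index 0#) (0⇒fixed _ (enum-index 0#))
      (λ i e → enum-inj _ _ (trans (fixed⇒0 i e) (sym (enum-index 0#))))

  half-order : I.half ≡ (q ℕ.∸ 1) / 2
  half-order = ≡.sym (≡.trans (≡.cong (λ t → (t ℕ.∸ 1) / 2) (≡.trans (≡.sym q≡) (≡.cong suc (k+k≡k*2 I.half)))) (ℕ.m*n/n≡m I.half 2))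

  -- Representatives of the nonzero elements up to sign.
  root : Fin I.half → Carrier
  root j = enum (I.lower j)

  root-nonzero : ∀ j → ¬ root j ≈ 0#
  root-nonzero j e = Finₚ.<⇒≢ (I.lower-sound j) (≡.sym (0⇒fixed _ e))

  squares⇒± : ∀ {x y} → x * x ≈ y * y → x ≈ y ⊎ x ≈ - y
  squares⇒± {x} {y} e with x - y ≈? 0#
  ... | yes p = inj₁ (x-y≈0⇒x≈y p)
  ... | no ¬p = inj₂ (begin
    x                ≈⟨ solve 2 (λ x y → x := x :+ y :- y) refl x y ⟩
    x + y - y        ≈⟨ +-congʳ (*-integral product ¬p) ⟩
    0# - y           ≈⟨ +-identityˡ _ ⟩
    - y              ∎)
    where
    product : (x - y) * (x + y) ≈ 0#
    product = trans (solve 2 (λ x y → (x :- y) :* (x :+ y) := x :* x :- y :* y) refl x y) (x≈y⇒x-y≈0 e)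

  root²-injective : ∀ {j j′} → root j * root j ≈ root j′ * root j′ → j ≡ j′
  root²-injective {j} {j′} e with squares⇒± e
  ... | inj₁ p = I.lower-injective (enum-inj _ _ p)
  ... | inj₂ p = contradiction (≡.trans (≡.sym (index-enum _)) (index-cong p)) (I.lower≢ι-lower j j′)

  root²-complete : ∀ x → ¬ x ≈ 0# → ∃ λ j → root j * root j ≈ x * x
  root²-complete x x≉0 = square (I.classify (index x) (λ e → x≉0 (trans (sym (enum-index x)) (fixed⇒0 _ e))))
    where
    square : (∃ λ j → I.lower j ≡ index x) ⊎ (∃ λ j → ι (I.lower j) ≡ index x) → ∃ λ j → root j * root j ≈ x * x
    square (inj₁ (j , e)) = j , *-cong r r
      where
      r : root j ≈ x
      r = trans (reflexive (≡.cong enum e)) (enum-index x)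
    square (inj₂ (j , e)) = j , (begin
      root j * root j          ≈⟨ solve 1 (λ r → r :* r := (:- r) :* (:- r)) refl (root j) ⟩
      (- root j) * (- root j)  ≈⟨ *-cong r r ⟩
      x * x                    ∎)
      where
      r : - root j ≈ x
      r = trans (sym (enum-index (- root j))) (trans (reflexive (≡.cong enum e)) (enum-index x))

  -- α x² and γ − β y² take (q + 1) / 2 values each, hence a common one.
  abstract
    binary-universal : ∀ {α β} γ → ¬ α ≈ 0# → ¬ β ≈ 0# → ∃ λ x → ∃ λ y → α * (x * x) + β * (y * y) ≈ γ
    binary-universal {α} {β} γ α≉0 β≉0 = solution (Finₚ.pigeonhole q< (index ∘ value ∘ Fin.splitAt (suc h)))
      where
      h : ℕ
      h = I.half
      s : Fin (suc h) → Carrier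
      s zero    = 0#
      s (suc j) = root j
      s²-injective : ∀ {i j} → s i * s i ≈ s j * s j → i ≡ j
      s²-injective {zero}  {zero}  e = ≡.refl
      s²-injective {zero}  {suc j} e = contradiction (trans (sym e) (zeroˡ 0#)) (*-nonzero (root-nonzero j) (root-nonzero j))
      s²-injective {suc i} {zero}  e = contradiction (trans e (zeroˡ 0#)) (*-nonzero (root-nonzero i) (root-nonzero i))
      s²-injective {suc i} {suc j} e = ≡.cong suc (root²-injective e)
      value : Fin (suc h) ⊎ Fin (suc h) → Carrier
      value (inj₁ i) = α * (s i * s i)
      value (inj₂ j) = γ - β * (s j * s j)
      q< : q ℕ.< suc h ℕ.+ suc h
      q< = ≡.subst (ℕ._< suc h ℕ.+ suc h) q≡ (ℕₚ.≤-reflexive (≡.cong suc (≡.sym (ℕₚ.+-suc h h))))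
      mixed : ∀ i j → value (inj₁ i) ≈ value (inj₂ j) → ∃ λ x → ∃ λ y → α * (x * x) + β * (y * y) ≈ γ
      mixed i j e = s i , s j , trans (+-congʳ e) (solve 2 (λ c t → c :- t :+ t := c) refl γ _)
      distinct : ∀ {a b} → ¬ a ≡ b → value a ≈ value b → ∃ λ x → ∃ λ y → α * (x * x) + β * (y * y) ≈ γ
      distinct {inj₁ i} {inj₁ j} ne e = contradiction (≡.cong inj₁ (s²-injective (*-cancelˡ α≉0 e))) ne
      distinct {inj₁ i} {inj₂ j} ne e = mixed i j e
      distinct {inj₂ j} {inj₁ i} ne e = mixed i j (sym e)
      distinct {inj₂ i} {inj₂ j} ne e = contradiction (≡.cong inj₂ (s²-injective (*-cancelˡ β≉0 (begin
        β * (s i * s i)              ≈⟨ solve 2 (λ c t → t := c :- (c :- t)) refl γ _ ⟩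
        γ - (γ - β * (s i * s i))    ≈⟨ +-congˡ (-‿cong e) ⟩
        γ - (γ - β * (s j * s j))    ≈⟨ solve 2 (λ c t → c :- (c :- t) := t) refl γ _ ⟩
        β * (s j * s j)              ∎)))) ne
      solution : (∃ λ i → ∃ λ j → i Fin.< j × index (value (Fin.splitAt (suc h) i)) ≡ index (value (Fin.splitAt (suc h) j))) →
                 ∃ λ x → ∃ λ y → α * (x * x) + β * (y * y) ≈ γ
      solution (i , j , i<j , e) = distinct {Fin.splitAt (suc h) i} {Fin.splitAt (suc h) j}
        (λ p → Finₚ.<⇒≢ i<j (≡.trans (≡.sym (Finₚ.join-splitAt (suc h) (suc h) i))
          (≡.trans (≡.cong (Fin.join (suc h) (suc h)) p) (Finₚ.join-splitAt (suc h) (suc h) j))))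
        (index-injective e)

  record SymmetricBilinear (n : ℕ) : Set where
    field
      φ : Vect n → Vect n → Carrier
      φ-linearˡ : ∀ y → LinearForm (λ x → φ x y)
      φ-linearʳ : ∀ x → LinearForm (φ x)
      φ-sym : ∀ x y → φ x y ≈ φ y x

  module SymmetricForm {n : ℕ} (Φ : SymmetricBilinear n) where
    open SymmetricBilinear Φ

    module φˡ y = LinearForm (φ-linearˡ y)
    module φʳ x = LinearForm (φ-linearʳ x)

    Nonzero : Vect n → Set
    Nonzero x = ∃ λ i → ¬ x i ≈ 0#

    nonzero-left : ∀ {x y} → ¬ φ x y ≈ 0# → Nonzero x
    nonzero-left {y = y} p = nonzero-entry (λ e → p (φˡ.zero-homo y e))

    Isotropic : Set
    Isotropic = ∃ λ x → Nonzero x × φ x x ≈ 0#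

    -- The number f counts the values of the quadratic form at nonzero vectors; 0 is among them
    -- exactly when the form is isotropic.
    record Values (f : ℕ) : Set where
      field
        rep : Fin f → Vect n
        nonzero : ∀ j → Nonzero (rep j)
        distinct : ∀ {j j′} → φ (rep j) (rep j) ≈ φ (rep j′) (rep j′) → j ≡ j′
        complete : ∀ x → Nonzero x → ∃ λ j → φ (rep j) (rep j) ≈ φ x x

    φ-combination : ∀ a b u v → φ (a ·s u +v b ·s v) (a ·s u +v b ·s v)
                    ≈ φ u u * (a * a) + φ v v * (b * b) + (1# + 1#) * (a * b * φ u v)
    φ-combination a b u v = begin
      φ w w                                        ≈⟨ trans (φˡ.+-homo w _ _) (+-cong (φˡ.·s-homo w a u) (φˡ.·s-homo w b v)) ⟩
      a * φ u w + b * φ v w                        ≈⟨ +-cong (*-congˡ (expand u)) (*-congˡ (expand v)) ⟩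
      a * (a * φ u u + b * φ u v) + b * (a * φ v u + b * φ v v)
        ≈⟨ +-congˡ (*-congˡ (+-congʳ (*-congˡ (φ-sym v u)))) ⟩
      a * (a * φ u u + b * φ u v) + b * (a * φ u v + b * φ v v)
        ≈⟨ solve 5 (λ a b s t r → a :* (a :* s :+ b :* t) :+ b :* (a :* t :+ b :* r)
                     := s :* (a :* a) :+ r :* (b :* b) :+ (con (+ 1) :+ con (+ 1)) :* (a :* b :* t)) refl a b (φ u u) (φ u v) (φ v v) ⟩
      φ u u * (a * a) + φ v v * (b * b) + (1# + 1#) * (a * b * φ u v) ∎
      where
      w : Vect n
      w = a ·s u +v b ·s v
      expand : ∀ x → φ x w ≈ a * φ x u + b * φ x v
      expand x = trans (φʳ.+-homo x _ _) (+-cong (φʳ.·s-homo x a u) (φʳ.·s-homo x b v))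

    orthogonal-combination : ∀ {u v} → φ u v ≈ 0# → ∀ a b →
      φ (a ·s u +v b ·s v) (a ·s u +v b ·s v) ≈ φ u u * (a * a) + φ v v * (b * b)
    orthogonal-combination {u} {v} e a b = trans (φ-combination a b u v)
      (trans (+-congˡ (*-congˡ (*-congˡ e))) (solve 3 (λ s t a → s :+ t :* (a :* con (+ 0)) := s) refl _ _ _))

    orthogonal₁ : 1 ℕ.< n → ∀ u → ∃ λ v → Nonzero v × φ u v ≈ 0#
    orthogonal₁ 1<n u =
      let v , nz , z = kernel {m = 1} {L = λ x _ → φ u x} (record
            { cong = λ e _ → φʳ.cong u e ; +-homo = λ x y _ → φʳ.+-homo u x y ; ·s-homo = λ c x _ → φʳ.·s-homo u c x }) 1<n
      in v , nz , z zero

    orthogonal₂ : 2 ℕ.< n → ∀ u v → ∃ λ w → Nonzero w × φ u w ≈ 0# × φ v w ≈ 0#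
    orthogonal₂ 2<n u v =
      let w , nz , z = kernel {m = 2} {L = λ x i → φ (pair i) x} (record
            { cong = λ e i → φʳ.cong (pair i) e ; +-homo = λ x y i → φʳ.+-homo (pair i) x y
            ; ·s-homo = λ c x i → φʳ.·s-homo (pair i) c x }) 2<n
      in w , nz , z zero , z (suc zero)
      where
      pair : Fin 2 → Vect n
      pair zero    = u
      pair (suc _) = v

    basis-vector : 0 ℕ.< n → ∃ Nonzero
    basis-vector (ℕ.s≤s {n = m} _) = δ zero , zero , λ e → 0≉1 (trans (sym e) (δ-diag {suc m} zero))

    -- Take u, v, w pairwise orthogonal. If none is isotropic, some x in the span of u and v has
    -- value -φ w w, and x + w has value 0. It is nonzero because its pairing with w is φ w w.
    isotropic-3 : 2 ℕ.< n → Isotropic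
    isotropic-3 2<n =
      let u , nu = basis-vector (ℕₚ.<-trans (ℕ.s≤s ℕ.z≤n) 2<n)
          v , nv , uv = orthogonal₁ (ℕₚ.<-trans (ℕ.s≤s (ℕ.s≤s ℕ.z≤n)) 2<n) u
          w , nw , uw , vw = orthogonal₂ 2<n u v
      in search u nu v nv w nw uv uw vw
      where
      search : ∀ u → Nonzero u → ∀ v → Nonzero v → ∀ w → Nonzero w →
               φ u v ≈ 0# → φ u w ≈ 0# → φ v w ≈ 0# → Isotropic
      search u nu v nv w nw uv uw vw with φ u u ≈? 0# | φ v v ≈? 0# | φ w w ≈? 0#
      ... | yes p | _     | _     = u , nu , p
      ... | no _  | yes p | _     = v , nv , p
      ... | no _  | no _  | yes p = w , nw , p
      ... | no p  | no p′ | no p″ =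
        let a , b , e = binary-universal (- φ w w) p p′
            x = a ·s u +v b ·s v
            xw : φ x w ≈ 0#
            xw = trans (trans (φˡ.+-homo w _ _) (+-cong (trans (φˡ.·s-homo w a u) (*-congˡ uw)) (trans (φˡ.·s-homo w b v) (*-congˡ vw))))
                   (solve 2 (λ a b → a :* con (+ 0) :+ b :* con (+ 0) := con (+ 0)) refl a b)
            y = 1# ·s x +v 1# ·s w
            yw : φ y w ≈ φ w w
            yw = trans (trans (φˡ.+-homo w _ _) (+-cong (trans (φˡ.·s-homo w 1# x) (*-congˡ xw)) (φˡ.·s-homo w 1# w)))
                   (solve 1 (λ s → con (+ 1) :* con (+ 0) :+ con (+ 1) :* s := s) refl (φ w w))
        in y , nonzero-left {y = w} (λ z → p″ (trans (sym yw) z)) , (begin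
          φ y y                                        ≈⟨ orthogonal-combination xw 1# 1# ⟩
          φ x x * (1# * 1#) + φ w w * (1# * 1#)        ≈⟨ +-congʳ (*-congʳ (trans (orthogonal-combination uv a b) e)) ⟩
          - φ w w * (1# * 1#) + φ w w * (1# * 1#)
            ≈⟨ solve 1 (λ s → :- s :* (con (+ 1) :* con (+ 1)) :+ s :* (con (+ 1) :* con (+ 1)) := con (+ 0)) refl (φ w w) ⟩
          0#                                           ∎)

    anisotropic-2-universal : 1 ℕ.< n → ¬ Isotropic → ∀ γ → ∃ λ x → φ x x ≈ γ
    anisotropic-2-universal 1<n aniso γ =
      let u , nu = basis-vector (ℕₚ.<-trans (ℕ.s≤s ℕ.z≤n) 1<n)
          v , nv , uv = orthogonal₁ 1<n u
          a , b , e = binary-universal γ (λ z → aniso (u , nu , z)) (λ z → aniso (v , nv , z))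
      in a ·s u +v b ·s v , trans (orthogonal-combination uv a b) e

    -- Along the line c z + y the form is affine in c with slope 2 φ z y ≠ 0, so it takes all q
    -- values once, 0 included. The points of the line are nonzero because they pair with z.
    isotropic-values : (∀ x → Nonzero x → ∃ λ y → ¬ φ x y ≈ 0#) → Isotropic → Values q
    isotropic-values nondeg (z , nz , zz) with nondeg z nz
    ... | y , zy = record
      { rep = rep
      ; nonzero = λ j → nonzero-left {y = z} (λ e → zy (trans (sym (zrep j)) (trans (φ-sym z (rep j)) e)))
      ; distinct = λ {j} {j′} e → enum-inj j j′ (trans (sym (value j)) (trans e (value j′)))
      ; complete = λ x _ → index (φ x x) , trans (value _) (enum-index _) }
      where
      c : Fin q → Carrier
      c j = (enum j - φ y y) * ((1# + 1#) * φ z y) ⁻¹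
      rep : Fin q → Vect n
      rep j = c j ·s z +v 1# ·s y
      zrep : ∀ j → φ z (rep j) ≈ φ z y
      zrep j = trans (φʳ.+-homo z _ _) (trans (+-cong (trans (φʳ.·s-homo z (c j) z) (*-congˡ zz)) (φʳ.·s-homo z 1# y))
        (solve 2 (λ c s → c :* con (+ 0) :+ con (+ 1) :* s := s) refl (c j) (φ z y)))
      value : ∀ j → φ (rep j) (rep j) ≈ enum j
      value j = begin
        φ (rep j) (rep j)             ≈⟨ φ-combination (c j) 1# z y ⟩
        φ z z * (c j * c j) + φ y y * (1# * 1#) + (1# + 1#) * (c j * 1# * φ z y)
          ≈⟨ +-congʳ (+-congʳ (*-congʳ zz)) ⟩
        0# * (c j * c j) + φ y y * (1# * 1#) + (1# + 1#) * (c j * 1# * φ z y)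
          ≈⟨ solve 4 (λ e s i t → let two = con (+ 1) :+ con (+ 1) ; c = (e :- s) :* i in
               con (+ 0) :* (c :* c) :+ s :* (con (+ 1) :* con (+ 1)) :+ two :* (c :* con (+ 1) :* t)
               := s :+ (e :- s) :* (two :* t :* i)) refl (enum j) (φ y y) (((1# + 1#) * φ z y) ⁻¹) (φ z y) ⟩
        φ y y + (enum j - φ y y) * ((1# + 1#) * φ z y * ((1# + 1#) * φ z y) ⁻¹)
          ≈⟨ +-congˡ (*-congˡ (⁻¹-inverseʳ (*-nonzero 2≉0 zy))) ⟩
        φ y y + (enum j - φ y y) * 1#
          ≈⟨ solve 2 (λ e s → s :+ (e :- s) :* con (+ 1) := e) refl (enum j) (φ y y) ⟩
        enum j                        ∎

    -- All values occur, but 0 only at the zero vector, so the index of 0 is skipped in the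
    -- enumeration of the field.
    anisotropic-2-values : 1 ℕ.< n → ¬ Isotropic → Values (q ℕ.∸ 1)
    anisotropic-2-values 1<n aniso = record
      { rep = rep
      ; nonzero = λ j → nonzero-left {y = rep j} (λ e → proj₁ (proj₂ others) j (enum-inj _ _ (trans (sym (value j)) (trans e (sym (enum-index 0#))))))
      ; distinct = λ {j} {j′} e → proj₁ (proj₂ (proj₂ others)) (enum-inj _ _ (trans (sym (value j)) (trans e (value j′))))
      ; complete = λ x nx →
          let j , e = proj₂ (proj₂ (proj₂ others)) (index (φ x x)) (λ e → aniso (x , nx , index-injective e))
          in j , trans (value j) (trans (reflexive (≡.cong enum e)) (enum-index _)) }
      where
      except : ∀ {m} (i₀ : Fin m) → ∃ λ (h : Fin (m ℕ.∸ 1) → Fin m) →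
               (∀ j → ¬ h j ≡ i₀) × (∀ {j j′} → h j ≡ h j′ → j ≡ j′) × (∀ i → ¬ i ≡ i₀ → ∃ λ j → h j ≡ i)
      except {suc m} i₀ = Fin.punchIn i₀ , Finₚ.punchInᵢ≢i i₀ , Finₚ.punchIn-injective i₀ _ _
        , λ i i≢i₀ → Fin.punchOut (i≢i₀ ∘ ≡.sym) , Finₚ.punchIn-punchOut (i≢i₀ ∘ ≡.sym)
      others = except (index 0#)
      rep : Fin (q ℕ.∸ 1) → Vect n
      rep j = proj₁ (anisotropic-2-universal 1<n aniso (enum (proj₁ others j)))
      value : ∀ j → φ (rep j) (rep j) ≈ enum (proj₁ others j)
      value j = proj₂ (anisotropic-2-universal 1<n aniso (enum (proj₁ others j)))

    -- In dimension one the form is c x² with c ≠ 0: one value for each pair ±x of nonzero scalars.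
    line-values : n ≡ 1 → (∀ x → Nonzero x → ∃ λ y → ¬ φ x y ≈ 0#) → Values ((q ℕ.∸ 1) / 2)
    line-values ≡.refl nondeg = ≡.subst Values half-order (record
      { rep = λ j → root j ·s e₀
      ; nonzero = λ j → zero , λ z → root-nonzero j (trans (sym (trans (*-congˡ (δ-diag {1} zero)) (*-identityʳ _))) z)
      ; distinct = λ {j} {j′} e → root²-injective (*-cancelˡ c≉0 (trans (sym (value (root j))) (trans e (value (root j′)))))
      ; complete = λ { x (zero , x₀≉0) →
          let j , e = root²-complete (x zero) x₀≉0
          in j , trans (value (root j)) (trans (*-congˡ e) (trans (sym (value (x zero))) (φ-cong (on-line x)))) } })
      where
      e₀ : Vect 1
      e₀ = δ zero
      c : Carrier
      c = φ e₀ e₀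
      φ-cong : ∀ {x y} → x ≈v y → φ x x ≈ φ y y
      φ-cong {x} {y} e = trans (φˡ.cong x e) (φʳ.cong y e)
      on-line : ∀ x → x zero ·s e₀ ≈v x
      on-line x zero = trans (*-congˡ (δ-diag {1} zero)) (*-identityʳ _)
      value : ∀ a → φ (a ·s e₀) (a ·s e₀) ≈ c * (a * a)
      value a = trans (φˡ.·s-homo _ a e₀) (trans (*-congˡ (φʳ.·s-homo e₀ a e₀))
        (solve 2 (λ a c → a :* (a :* c) := c :* (a :* a)) refl a c))
      c≉0 : ¬ c ≈ 0#
      c≉0 z = let y , p = nondeg e₀ (zero , λ e → 0≉1 (trans (sym e) (δ-diag {1} zero)))
              in p (trans (φʳ.cong e₀ (≈v-sym (on-line y))) (trans (φʳ.·s-homo e₀ (y zero) e₀) (trans (*-congˡ z) (zeroʳ _))))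

-- Numbering a disjoint union of finite sets

decode : ∀ d (f : Fin d → ℕ) → Fin (∑ℕ d f) → Σ (Fin d) (Fin ∘ f)
decode (suc d) f s with Fin.splitAt (f zero) s
... | inj₁ j = zero , j
... | inj₂ s′ = let i , j = decode d (f ∘ suc) s′ in suc i , j

encode : ∀ d (f : Fin d → ℕ) → Σ (Fin d) (Fin ∘ f) → Fin (∑ℕ d f)
encode (suc d) f (zero , j)  = j Fin.↑ˡ _
encode (suc d) f (suc i , j) = f zero Fin.↑ʳ encode d (f ∘ suc) (i , j)

encode-decode : ∀ d f s → encode d f (decode d f s) ≡ s
encode-decode (suc d) f s with Fin.splitAt (f zero) s in eq
... | inj₁ j  = Finₚ.splitAt⁻¹-↑ˡ eq
... | inj₂ s′ = ≡.trans (≡.cong (f zero Fin.↑ʳ_) (encode-decode d (f ∘ suc) s′)) (Finₚ.splitAt⁻¹-↑ʳ eq)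

decode-encode : ∀ d f p → decode d f (encode d f p) ≡ p
decode-encode (suc d) f (zero , j) rewrite Finₚ.splitAt-↑ˡ (f zero) j (∑ℕ d (f ∘ suc)) = ≡.refl
decode-encode (suc d) f (suc i , j)
  rewrite Finₚ.splitAt-↑ʳ (f zero) (∑ℕ d (f ∘ suc)) (encode d (f ∘ suc) (i , j))
        | decode-encode d (f ∘ suc) (i , j) = ≡.refl

-- Generators of the Jordan blocks and classification of the orbits

module JordanFrames (R : CommutativeRing 0ℓ 0ℓ) (q : ℕ) (F : LinAlg.IsFiniteFieldOfOrder R q)
                    {d : ℕ} (S : AlternatingIsometry R d) where
  open CommutativeRing R hiding (zero)
  open Vectors R
  open LinAlg R
    renaming (_≈v_ to infix 4 _≈v_; _+v_ to infixl 6 _+v_; _-v_ to infixl 6 _-v_; _·s_ to infixr 7 _·s_; _·_ to infixr 8 _·_)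
  open Isometry R q F S

  combination : ∀ {n} → (Fin n → Vect d) → Vect n → Vect d
  combination {n} e y = ∑v n (λ j → y j ·s e j)

  -- The e i j generate the Jordan blocks of size i + 1, and only modulo [V, g] need they span.
  record JordanFrame : Set where
    field
      a : Fin d → ℕ
      e : ∀ i → Fin (a i) → Vect d
      killed : ∀ i j → pow ν (suc (toℕ i)) (e i j) ≈v 0v
      paired : ∀ i y → (∃ λ j → ¬ y j ≈ 0#) → ∃ λ j → ¬ b (toℕ i) (combination (e i) y) (e i j) ≈ 0#
      spanning : ∀ v → ∃ λ (x : ∀ i → Vect (a i)) → v ≋ ∑v d (λ i → combination (e i) (x i))

module Classification (R : CommutativeRing 0ℓ 0ℓ) (q : ℕ) (F : LinAlg.IsFiniteFieldOfOrder R q) (odd : q % 2 ≡ 1)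
                      {d : ℕ} (S : AlternatingIsometry R d) (J : JordanFrames.JordanFrame R q F S) where
  open CommutativeRing R hiding (zero)
  open IntegerCoefficients R
  open Vectors R
  open FiniteField R q F
  open LinAlg R
    renaming (_≈v_ to infix 4 _≈v_; _+v_ to infixl 6 _+v_; _-v_ to infixl 6 _-v_; _·s_ to infixr 7 _·s_; _·_ to infixr 8 _·_)
  open import Relation.Binary.Reasoning.Setoid setoid
  open OddFiniteField R q F odd
  open Isometry R q F S
  open Orbits R q F S 2≉0
  open JordanFrames R q F S
  open JordanFrame J

  part : ∀ i → Vect (a i) → Vect d
  part i = combination (e i)

  part-linear : ∀ i → Linear (part i)
  part-linear i = combination-linear (a i) (e i)

  part-killed : ∀ i y → pow ν (suc (toℕ i)) (part i y) ≈v 0v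
  part-killed i y = ≈v-trans (ν^.∑-homo (suc (toℕ i)) (a i) (λ j → y j ·s e i j))
    (∑v-zero (a i) (λ j → killed-·s (suc (toℕ i)) (y j) (killed i j)))

  part-Top : ∀ i y → (∃ λ j → ¬ y j ≈ 0#) → Top (toℕ i) (part i y)
  part-Top i y ny = paired-part (paired i y ny)
    where
    paired-part : (∃ λ j → ¬ b (toℕ i) (part i y) (e i j) ≈ 0#) → Top (toℕ i) (part i y)
    paired-part (j , p) = record { killed = part-killed i y ; partner = e i j ; partner-killed = killed i j ; paired = p }

  -- `complete` speaks of any v with a nonzero top component at size i + 1 and a suitable form
  -- value, not just of vectors in that part, so that components at smaller sizes are absorbed as
  -- well.
  record Representatives (i : Fin d) (f : ℕ) : Set where
    field
      rep : Fin f → Vect (a i)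
      nonzero : ∀ j → ∃ λ l → ¬ rep j l ≈ 0#
      distinct : ∀ {j j′} → part i (rep j) ∼ part i (rep j′) → j ≡ j′
      complete : ∀ y → (∃ λ l → ¬ y l ≈ 0#) → ∀ {v} → Top (toℕ i) v →
                 b (toℕ i) v v ≈ b (toℕ i) (part i y) (part i y) → ∃ λ j → v ∼ part i (rep j)
  empty-representatives : ∀ i → a i ≡ 0 → Representatives i 0
  empty-representatives i eq = record
    { rep = λ () ; nonzero = λ () ; distinct = λ {j} → λ _ → contradiction j Finₚ.¬Fin0
    ; complete = λ y (l , _) → contradiction (≡.subst Fin eq l) Finₚ.¬Fin0 }
  odd-representatives : ∀ i {m} → a i ≡ suc m → sign (toℕ i) ≈ 1# → Representatives i 1
  odd-representatives i eq s = record
    { rep = λ _ → δ l₀ ; nonzero = nz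
    ; distinct = λ { {zero} {zero} _ → ≡.refl }
    ; complete = λ y ny T _ → zero , Odd.transitive (toℕ i) s T (part-Top i (δ l₀) (nz zero)) }
    where
    l₀ : Fin (a i)
    l₀ = ≡.subst Fin (≡.sym eq) zero
    nz : Fin 1 → ∃ λ l → ¬ δ l₀ l ≈ 0#
    nz _ = l₀ , λ e → 0≉1 (trans (sym e) (δ-diag l₀))
  even-form : ∀ i → sign (toℕ i) ≈ - 1# → SymmetricBilinear (a i)
  even-form i s = record
    { φ = λ x y → b (toℕ i) (part i x) (part i y)
    ; φ-linearˡ = λ y → ∘-form (b-linearˡ (toℕ i) (part i y)) (part-linear i)
    ; φ-linearʳ = λ x → ∘-form (b-linearʳ (toℕ i) (part i x)) (part-linear i)
    ; φ-sym = λ x y → Even.b-symmetric (toℕ i) s (part i y) (part-killed i x) }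

  part-δ : ∀ i j → part i (δ j) ≈v e i j
  part-δ i j = ≈v-trans (∑v-single (a i) j (λ l l≢j t → trans (*-congʳ (δ-off l≢j)) (zeroˡ (e i l t))))
    (λ t → trans (*-congʳ (δ-diag j)) (*-identityˡ (e i j t)))

  even-nondegenerate : ∀ i x → (∃ λ j → ¬ x j ≈ 0#) → ∃ λ y → ¬ b (toℕ i) (part i x) (part i y) ≈ 0#
  even-nondegenerate i x nx = basis (paired i x nx)
    where
    basis : (∃ λ j → ¬ b (toℕ i) (part i x) (e i j) ≈ 0#) → ∃ λ y → ¬ b (toℕ i) (part i x) (part i y) ≈ 0#
    basis (j , p) = δ j , λ z → p (trans (sym (bʳ.cong (toℕ i) (part i x) (part-δ i j))) z)

  even-representatives : ∀ i (s : sign (toℕ i) ≈ - 1#) {f} → SymmetricForm.Values (even-form i s) f → Representatives i f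
  even-representatives i s V = record
    { rep = V.rep ; nonzero = V.nonzero
    ; distinct = λ {j} {j′} o → V.distinct (∼⇒b≈ {toℕ i} (part-killed i (V.rep j)) (part-killed i (V.rep j′)) o)
    ; complete = λ y ny T eq → same-value T eq (V.complete y ny) }
    where
    module V = SymmetricForm.Values V
    same-value : ∀ {y v} → Top (toℕ i) v → b (toℕ i) v v ≈ b (toℕ i) (part i y) (part i y) →
                 (∃ λ j → b (toℕ i) (part i (V.rep j)) (part i (V.rep j)) ≈ b (toℕ i) (part i y) (part i y)) →
                 ∃ λ j → v ∼ part i (V.rep j)
    same-value T eq (j , e) = j , Even.transitive (toℕ i) s T (part-Top i (V.rep j) (V.nonzero j)) (trans eq (sym e))

  IsotropicPart : Fin d → Set
  IsotropicPart i = ∃ λ x → (∃ λ j → ¬ x j ≈ 0#) × b (toℕ i) (part i x) (part i x) ≈ 0#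

  even-values : ∀ i (s : sign (toℕ i) ≈ - 1#) m (plus : Bool) → a i ≡ suc m → (a i ≡ 2 → (plus ≡ true) ⇔ IsotropicPart i) →
                SymmetricForm.Values (even-form i s) (evenContrib q (suc m) plus)
  even-values i s zero plus eq _ = SymmetricForm.line-values (even-form i s) eq (even-nondegenerate i)
  even-values i s (suc zero) true eq hyp =
    SymmetricForm.isotropic-values (even-form i s) (even-nondegenerate i) (Equivalence.to (hyp eq) ≡.refl)
  even-values i s (suc zero) false eq hyp =
    SymmetricForm.anisotropic-2-values (even-form i s) (ℕₚ.≤-reflexive (≡.sym eq))
      (λ iso → contradiction (Equivalence.from (hyp eq) iso) λ ())
  even-values i s (suc (suc m)) plus eq _ =
    SymmetricForm.isotropic-values (even-form i s) (even-nondegenerate i)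
      (SymmetricForm.isotropic-3 (even-form i s) (≡.subst (2 ℕ.<_) (≡.sym eq) (ℕ.s≤s (ℕ.s≤s (ℕ.s≤s ℕ.z≤n)))))

  sign-parity : ∀ k → (isEven (suc k) ≡ true × sign k ≈ - 1#) ⊎ (isEven (suc k) ≡ false × sign k ≈ 1#)
  sign-parity zero          = inj₂ (≡.refl , refl)
  sign-parity (suc zero)    = inj₁ (≡.refl , refl)
  sign-parity (suc (suc k)) with sign-parity k
  ... | inj₁ (p , e) = inj₁ (p , trans (solve 1 (λ s → :- (:- s) := s) refl _) e)
  ... | inj₂ (p , e) = inj₂ (p , trans (solve 1 (λ s → :- (:- s) := s) refl _) e)

  representatives : ∀ i (plus : Bool) → (a i ≡ 2 → isEven (suc (toℕ i)) ≡ true → (plus ≡ true) ⇔ IsotropicPart i) →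
                    Representatives i (contrib q (suc (toℕ i)) (a i) plus)
  representatives i plus hyp = cases (a i) ≡.refl
    where
    cases : ∀ n → a i ≡ n → Representatives i (contrib q (suc (toℕ i)) n plus)
    cases zero    eq = empty-representatives i eq
    cases (suc m) eq with sign-parity (toℕ i)
    ... | inj₁ (even , s) = ≡.subst (Representatives i) (≡.cong (λ t → if t then _ else _) (≡.sym even))
      (even-representatives i s (even-values i s m plus eq (λ eq₂ → hyp eq₂ even)))
    ... | inj₂ (odd , s) = ≡.subst (Representatives i) (≡.cong (λ t → if t then _ else _) (≡.sym odd))
      (odd-representatives i eq s)

  module Labels (count : Fin d → ℕ) (reps : ∀ i → Representatives i (count i)) where
    module Rep i = Representatives (reps i)

    label : Vect d → Set
    label v = (v ∼ 0v) ⊎ (∃ λ i → ∃ λ j → v ∼ part i (Rep.rep i j))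
    top : (∀ i → Vect (a i)) → Vect d
    top x = ∑v d (λ i → part i (x i))
    -- The components of smaller size than i are killed by νⁱ, hence lie in the radical of b i.
    label-top : ∀ i x → (∀ i′ → toℕ i ℕ.< toℕ i′ → x i′ ≈v 0v) → (∃ λ j → ¬ x i j ≈ 0#) → label (top x)
    label-top i x above nx =
      found (Rep.complete i (x i) nx topness values)
      where
      found : ∀ {v} → (∃ λ j → v ∼ part i (Rep.rep i j)) → label v
      found (j , o) = inj₂ (i , j , o)
      k : ℕ
      k = toℕ i
      p r : Vect d
      p = part i (x i)
      r = top x -v p
      split : top x ≈v p +v r
      split l = solve 2 (λ t p → t := p :+ (t :- p)) refl (top x l) (p l)
      smaller : ∀ i′ → ¬ i′ ≡ i → pow ν k (part i′ (x i′)) ≈v 0v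
      smaller i′ i′≢i with ℕₚ.<-cmp (toℕ i′) k
      ... | tri< lt _ _ = pow-zero-≤ ν-linear lt (part-killed i′ (x i′))
      ... | tri≈ _ eq _ = contradiction (Finₚ.toℕ-injective eq) i′≢i
      ... | tri> _ _ gt = ≈v-trans (ν^.cong k (≈v-trans (L.cong (above i′ gt)) L.0-homo)) (ν^.0-homo k)
        where module L = Linear (part-linear i′)
      r-killed : pow ν k r ≈v 0v
      r-killed l = trans (ν^.-v-homo k (top x) p l)
        (x≈y⇒x-y≈0 (trans (ν^.∑-homo k d _ l) (∑v-single d i smaller l)))
      P : Top k p
      P = part-Top i (x i) nx
      b-split : ∀ y → b k (top x) y ≈ b k p y
      b-split y = begin
        b k (top x) y          ≈⟨ bˡ.cong k y split ⟩
        b k (p +v r) y         ≈⟨ bˡ.+-homo k y p r ⟩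
        b k p y + b k r y      ≈⟨ +-congˡ (b-zeroˡ k y r-killed) ⟩
        b k p y + 0#           ≈⟨ +-identityʳ _ ⟩
        b k p y                ∎
      topness : Top k (top x)
      topness = record
        { killed = ≈v-trans (ν^.cong (suc k) split) (killed-+ (suc k) (part-killed i (x i)) (pow-zero-≤ ν-linear (ℕₚ.n≤1+n k) r-killed))
        ; partner = Top.partner P ; partner-killed = Top.partner-killed P
        ; paired = λ z → Top.paired P (trans (sym (b-split _)) z) }
      values : b k (top x) (top x) ≈ b k p p
      values = begin
        b k (top x) (top x)    ≈⟨ b-split (top x) ⟩
        b k p (top x)          ≈⟨ bʳ.cong k p split ⟩
        b k p (p +v r)         ≈⟨ bʳ.+-homo k p p r ⟩
        b k p p + b k p r      ≈⟨ +-congˡ (βʳ.zero-homo p r-killed) ⟩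
        b k p p + 0#           ≈⟨ +-identityʳ _ ⟩
        b k p p                ∎
    -- Downward search for the largest i with x i nonzero: components with index at least k are
    -- already known to vanish. Running out of indices leaves the zero coset.
    search : ∀ k → k ℕ.≤ d → ∀ x → (∀ i → k ℕ.≤ toℕ i → x i ≈v 0v) → label (top x)
    search zero    _   x z = inj₁ (≋⇒∼ (≋-reflexive (∑v-zero d (λ i →
      ≈v-trans (Linear.cong (part-linear i) (z i ℕ.z≤n)) (Linear.0-homo (part-linear i))))))
    search (suc k) k<d x z = at (Fin.fromℕ< k<d) (Finₚ.toℕ-fromℕ< k<d)
      where
      at : ∀ i → toℕ i ≡ k → label (top x)
      at i i≡k with zero? (x i)
      ... | inj₁ nx = label-top i x (λ i′ i<i′ → z i′ (≡.subst (ℕ._< toℕ i′) i≡k i<i′)) nx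
      ... | inj₂ x≈0 = search k (ℕₚ.<⇒≤ k<d) x below
        where
        below : ∀ i′ → k ℕ.≤ toℕ i′ → x i′ ≈v 0v
        below i′ k≤ with ℕₚ.m≤n⇒m<n∨m≡n k≤
        ... | inj₁ k< = z i′ k<
        ... | inj₂ eq with ≡.refl ← Finₚ.toℕ-injective (≡.trans i≡k eq) = x≈0
    label-∼ : ∀ {v w} → v ∼ w → label w → label v
    label-∼ o (inj₁ o′) = inj₁ (∼-trans o o′)
    label-∼ o (inj₂ (i , j , o′)) = inj₂ (i , j , ∼-trans o o′)
    every-label : ∀ v → label v
    every-label v = reduced (spanning v)
      where
      reduced : (∃ λ x → v ≋ top x) → label v
      reduced (x , e) = label-∼ (≋⇒∼ e)
        (search d ℕₚ.≤-refl x (λ i d≤i → contradiction (Finₚ.toℕ<n i) (ℕₚ.≤⇒≯ d≤i)))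

    rep′ : Σ (Fin d) (Fin ∘ count) → Vect d
    rep′ (i , j) = part i (Rep.rep i j)

    rep′-Top : ∀ p → Top (toℕ (proj₁ p)) (rep′ p)
    rep′-Top (i , j) = part-Top i (Rep.rep i j) (Rep.nonzero i j)

    rep : Fin (suc (∑ℕ d count)) → Vect d
    rep zero    = 0v
    rep (suc s) = rep′ (decode d count s)

    rep-complete : ∀ v → ∃ λ s → v ∼ rep s
    rep-complete v = found (every-label v)
      where
      found : label v → ∃ λ s → v ∼ rep s
      found (inj₁ o) = zero , o
      found (inj₂ (i , j , o)) = suc (encode d count (i , j)) ,
        ≡.subst (λ p → v ∼ rep′ p) (≡.sym (decode-encode d count (i , j))) o

    -- For different sizes, the power of ν at which the larger part still pairs nontrivially already
    -- kills the smaller part. For equal sizes the representatives of one part decide.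
    rep′-distinct : ∀ p p′ → rep′ p ∼ rep′ p′ → p ≡ p′
    rep′-distinct (i , j) (i′ , j′) o with ℕₚ.<-cmp (toℕ i) (toℕ i′)
    ... | tri< lt _ _ = contradiction o (killed-∼-Top (pow-zero-≤ ν-linear lt (part-killed i (Rep.rep i j))) (rep′-Top (i′ , j′)))
    ... | tri> _ _ gt = contradiction o (Top-∼-killed (rep′-Top (i , j)) (pow-zero-≤ ν-linear gt (part-killed i′ (Rep.rep i′ j′))))
    ... | tri≈ _ eq _ with ≡.refl ← Finₚ.toℕ-injective eq = ≡.cong (i ,_) (Rep.distinct i o)

    rep-distinct : ∀ s s′ → rep s ∼ rep s′ → s ≡ s′
    rep-distinct zero    zero     o = ≡.refl
    rep-distinct zero    (suc s′) o = contradiction o (killed-∼-Top (ν^.0-homo (toℕ (proj₁ (decode d count s′)))) (rep′-Top (decode d count s′)))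
    rep-distinct (suc s) zero     o = contradiction o (Top-∼-killed (rep′-Top (decode d count s)) (ν^.0-homo (toℕ (proj₁ (decode d count s)))))
    rep-distinct (suc s) (suc s′) o = ≡.cong suc (≡.trans (≡.sym (encode-decode d count s))
      (≡.trans (≡.cong (encode d count) (rep′-distinct _ _ o)) (encode-decode d count s′)))

-- From matrices and orthogonal Jordan data to frames

matrixIsometry : (R : CommutativeRing 0ℓ 0ℓ) {d : ℕ} (B : LinAlg.Mat R d) → LinAlg.Alternating R B → LinAlg.Nondegenerate R B →
                 (g : LinAlg.Mat R d) → LinAlg.IsIsometry R B g → AlternatingIsometry R d
matrixIsometry R B alternating nondegenerate g isometry = record
  { β = form B ; β-linearˡ = form-linearˡ B ; β-linearʳ = form-linearʳ B
  ; alternating = alternating ; nondegenerate = nondegenerate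
  ; g = g ·_ ; g-linear = ·-linear g ; isometry = isometry }
  where
  open LinAlg R
  open Vectors R

module MatrixIsometry (R : CommutativeRing 0ℓ 0ℓ) (q : ℕ) (F : LinAlg.IsFiniteFieldOfOrder R q) {d : ℕ}
  (B : LinAlg.Mat R d) (alternating : LinAlg.Alternating R B) (nondegenerate : LinAlg.Nondegenerate R B)
  (gM : LinAlg.Mat R d) (isometry : LinAlg.IsIsometry R B gM) where
  open CommutativeRing R hiding (zero)
  open IntegerCoefficients R
  open Vectors R
  open FiniteField R q F
  open LinAlg R
    renaming (_≈v_ to infix 4 _≈v_; _+v_ to infixl 6 _+v_; _-v_ to infixl 6 _-v_; _·s_ to infixr 7 _·s_; _·_ to infixr 8 _·_)
  open import Relation.Binary.Reasoning.Setoid setoid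

  S : AlternatingIsometry R d
  S = matrixIsometry R B alternating nondegenerate gM isometry

  open AlternatingIsometry S using (β; g)
  open Isometry R q F S
  open JordanFrames R q F S

  Npow≡pow : ∀ k v → Npow gM k v ≡ pow ν k v
  Npow≡pow zero    v = ≡.refl
  Npow≡pow (suc k) v = ≡.cong ν (Npow≡pow k v)

  SameOrbit⇒∼ : ∀ {v w} → SameOrbit B gM v w → v ∼ w
  SameOrbit⇒∼ {v} {w} (h , (h-isometry , h-commutes) , u , e) = record
    { map = h ·_
    ; centralizing = record { linear = ·-linear h ; preserves = h-isometry ; commutes = h-commutes }
    -- [g, V] is presented through u - g u, while ν is g - 1; hence the sign.
    ; image = (- 1#) ·s u , λ i → begin
        (h · v) i                          ≈⟨ solve 2 (λ s t → s := t :+ (s :- t)) refl ((h · v) i) (w i) ⟩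
        w i + ((h · v) i - w i)            ≈⟨ +-congˡ (e i) ⟩
        w i + (u i - g u i)                ≈⟨ +-congˡ (solve 2 (λ s t → s :- t := con (ℤ.- + 1) :* (t :- s)) refl (u i) (g u i)) ⟩
        w i + - 1# * ν u i                 ≈⟨ +-congˡ (ν.·s-homo (- 1#) u i) ⟨
        w i + ν ((- 1#) ·s u) i            ∎ }

  ∼⇒SameOrbit : ∀ {v w} → v ∼ w → SameOrbit B gM v w
  ∼⇒SameOrbit {v} {w} o = M
    , ((λ x y → trans (β-cong (M≈ x) (M≈ y)) (H.preserves x y))
      , (λ x → ≈v-trans (M≈ (g x)) (≈v-trans (H.commutes x) (≈v-sym (g.cong (M≈ x))))))
    , (- 1#) ·s s , λ i → begin
        (M · v) i - w i                    ≈⟨ +-congʳ (trans (M≈ v i) (_≋_.equal O.image i)) ⟩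
        w i + ν s i - w i                  ≈⟨ solve 3 (λ w t s → w :+ (t :- s) :- w := con (ℤ.- + 1) :* s :- con (ℤ.- + 1) :* t) refl (w i) (g s i) (s i) ⟩
        - 1# * s i - - 1# * g s i          ≈⟨ +-congˡ (-‿cong (g.·s-homo (- 1#) s i)) ⟨
        - 1# * s i - g ((- 1#) ·s s) i     ∎
    where
    module O = _∼_ o
    module H = Centralizing O.centralizing
    M : Mat d
    M = matrix O.map
    M≈ : ∀ x → M · x ≈v O.map x
    M≈ = matrix-· H.linear
    s : Vect d
    s = _≋_.shift O.image

  ≋-∑ : ∀ k {f h : Fin k → Vect d} → (∀ i → f i ≋ h i) → ∑v k f ≋ ∑v k h
  ≋-∑ zero    e = ≋-reflexive ≈v-refl
  ≋-∑ (suc k) e = ≋-+ (e zero) (≋-∑ k (e ∘ suc))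

  -- Nondegeneracy alone refutes the absence of a partner; a finite search through the standard
  -- basis produces one.
  β-nonzero : ∀ {x} → ¬ (x ≈v 0v) → ∃ λ y → ¬ β x y ≈ 0#
  β-nonzero {x} x≉0 with Finₚ.any? (λ j → ¬? (β x (δ j) ≈? 0#))
  ... | yes (j , p) = δ j , p
  ... | no ¬p = contradiction (nondegenerate x (λ y → begin
    β x y                                ≈⟨ βʳ.cong x (δ-expansion y) ⟨
    β x (∑v d (λ j → y j ·s δ j))        ≈⟨ βʳ.∑-homo x d _ ⟩
    ∑F d (λ j → β x (y j ·s δ j))        ≈⟨ ∑F-zero d (λ j → trans (βʳ.·s-homo x (y j) (δ j))
                                              (trans (*-congˡ (decidable-stable (_ ≈? _) (λ n → ¬p (j , n)))) (zeroʳ _))) ⟩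
    0#                                   ∎)) x≉0

  b-expansion : ∀ k n (e : Fin n → Vect d) (x : Vect n) →
    b k (∑v n (λ j → x j ·s e j)) (∑v n (λ j → x j ·s e j))
    ≈ ∑F n (λ j → ∑F n (λ l → x j * form B (e j) (Npow gM k (e l)) * x l))
  b-expansion k n e x = begin
    b k v v                                        ≈⟨ bˡ.∑-homo k v n _ ⟩
    ∑F n (λ j → b k (x j ·s e j) v)                ≈⟨ ∑F-cong n (λ j → trans (bʳ.∑-homo k (x j ·s e j) n _) (∑F-cong n (λ l → entry j l))) ⟩
    ∑F n (λ j → ∑F n (λ l → x j * form B (e j) (Npow gM k (e l)) * x l)) ∎
    where
    v : Vect d
    v = ∑v n (λ j → x j ·s e j)
    entry : ∀ j l → b k (x j ·s e j) (x l ·s e l) ≈ x j * form B (e j) (Npow gM k (e l)) * x l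
    entry j l = begin
      b k (x j ·s e j) (x l ·s e l)     ≈⟨ trans (bˡ.·s-homo k _ (x j) (e j)) (*-congˡ (bʳ.·s-homo k (e j) (x l) (e l))) ⟩
      x j * (x l * b k (e j) (e l))     ≈⟨ solve 3 (λ s t r → s :* (t :* r) := s :* r :* t) refl (x j) (x l) _ ⟩
      x j * b k (e j) (e l) * x l       ≡⟨ ≡.cong (λ t → x j * β (e j) t * x l) (Npow≡pow k (e l)) ⟨
      x j * form B (e j) (Npow gM k (e l)) * x l ∎

  -- The isotropy condition with the number of blocks and its equation as variables. Matching on the
  -- equation then turns `reindex` into the identity of `Fin 2`.
  IsotropicPair : (n : ℕ) → n ≡ 2 → (Fin n → Vect d) → ℕ → Set
  IsotropicPair n eq e k = ∃ λ (x : Fin 2 → Carrier) → ¬ (∀ j → x j ≈ 0#) ×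
    (∑F 2 (λ j → ∑F 2 (λ l →
      x j * form B (e (Reindexing.reindex n eq j)) (Npow gM k (e (Reindexing.reindex n eq l))) * x l)) ≈ 0#)

  IsotropicPair⇔ : ∀ {n} (eq : n ≡ 2) (e : Fin n → Vect d) k → IsotropicPair n eq e k ⇔
    (∃ λ (x : Vect n) → (∃ λ j → ¬ x j ≈ 0#) × b k (∑v n (λ j → x j ·s e j)) (∑v n (λ j → x j ·s e j)) ≈ 0#)
  IsotropicPair⇔ ≡.refl e k = record
    { to = λ (x , x≉0 , z) → x , nonzero-entry x≉0 , trans (b-expansion k 2 e x) z
    ; from = λ (x , (j , xj≉0) , z) → x , (λ x≈0 → xj≉0 (x≈0 j)) , trans (sym (b-expansion k 2 e x)) z
    ; to-cong = λ { ≡.refl → ≡.refl } ; from-cong = λ { ≡.refl → ≡.refl } }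

  module _ (J : OrthJordanData B gM) where
    open OrthJordanData J

    part : ∀ i → Vect (a i) → Vect d
    part i = combination (e i)

    e-killed : ∀ i j → pow ν (size i) (e i j) ≈v 0v
    e-killed i j = ≡.subst (_≈v 0v) (Npow≡pow (size i) (e i j)) (chain-end i j)

    ν^-part : ∀ k i y → pow ν k (part i y) ≈v ∑v (a i) (λ j → y j ·s pow ν k (e i j))
    ν^-part k i y = ≈v-trans (ν^.∑-homo k (a i) _) (∑v-cong (a i) (λ j → ν^.·s-homo k (y j) (e i j)))

    part-killed : ∀ i y → pow ν (size i) (part i y) ≈v 0v
    part-killed i y = ≈v-trans (ν^-part (size i) i y) (∑v-zero (a i) (λ j → scaled-zero (y j) (e-killed i j)))

    -- The coefficients, in the basis of all chains, of the combination with weights y of the last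
    -- chain vectors at size i₀ + 1. It brings `independent` to bear on ν^i₀ applied to `part i₀ y`.
    socle : ∀ i₀ → Vect (a i₀) → (i : Fin d) → Fin (a i) → Fin (size i) → Carrier
    socle i₀ y i j k with i Fin.≟ i₀
    ... | no _       = 0#
    ... | yes ≡.refl = y j * δ (Fin.fromℕ (toℕ i₀)) k

    socle-off : ∀ {i₀ i} y j k → ¬ i ≡ i₀ → socle i₀ y i j k ≈ 0#
    socle-off {i₀} {i} y j k i≢i₀ with i Fin.≟ i₀
    ... | no _  = refl
    ... | yes p = contradiction p i≢i₀

    socle-diag : ∀ i₀ y j k → socle i₀ y i₀ j k ≈ y j * δ (Fin.fromℕ (toℕ i₀)) k
    socle-diag i₀ y j k with i₀ Fin.≟ i₀
    ... | no p       = contradiction ≡.refl p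
    ... | yes ≡.refl = refl

    comb-socle : ∀ i₀ y → comb (socle i₀ y) ≈v pow ν (toℕ i₀) (part i₀ y)
    comb-socle i₀ y = ≈v-trans
      (∑v-single d i₀ {λ i → ∑v (a i) (λ j → inner i j)} (λ i i≢i₀ → ∑v-zero (a i) (λ j → ∑v-zero (size i) (λ k →
        zero-·s (chain i j (toℕ k)) (socle-off y j k i≢i₀)))))
      (≈v-trans (∑v-cong (a i₀) block) (≈v-sym (ν^-part (toℕ i₀) i₀ y)))
      where
      last : Fin (size i₀)
      last = Fin.fromℕ (toℕ i₀)
      zero-·s : ∀ {c} (x : Vect d) → c ≈ 0# → c ·s x ≈v 0v
      zero-·s x e l = trans (*-congʳ e) (zeroˡ (x l))
      inner : ∀ i → Fin (a i) → Vect d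
      inner i j = ∑v (size i) (λ k → socle i₀ y i j k ·s chain i j (toℕ k))
      coefficient-last : ∀ j → socle i₀ y i₀ j last ≈ y j
      coefficient-last j = trans (socle-diag i₀ y j last) (trans (*-congˡ (δ-diag last)) (*-identityʳ (y j)))
      chain-last : ∀ j → chain i₀ j (toℕ last) ≡ pow ν (toℕ i₀) (e i₀ j)
      chain-last j = ≡.trans (Npow≡pow (toℕ last) (e i₀ j)) (≡.cong (λ t → pow ν t (e i₀ j)) (Finₚ.toℕ-fromℕ (toℕ i₀)))
      block : ∀ j → inner i₀ j ≈v y j ·s pow ν (toℕ i₀) (e i₀ j)
      block j = ≈v-trans
        (∑v-single (size i₀) last {λ k → socle i₀ y i₀ j k ·s chain i₀ j (toℕ k)} (λ k k≢last → zero-·s (chain i₀ j (toℕ k))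
          (trans (socle-diag i₀ y j k) (trans (*-congˡ (δ-off k≢last)) (zeroʳ (y j))))))
        (λ l → *-cong (coefficient-last j) (reflexive (≡.cong (λ t → t l) (chain-last j))))

    socle-nonzero : ∀ i y → (∃ λ j → ¬ y j ≈ 0#) → ¬ (pow ν (toℕ i) (part i y) ≈v 0v)
    socle-nonzero i y (j , yj≉0) z = yj≉0 (begin
      y j                         ≈⟨ *-identityʳ _ ⟨
      y j * 1#                    ≈⟨ *-congˡ (δ-diag last) ⟨
      y j * δ last last           ≈⟨ socle-diag i y j last ⟨
      socle i y i j last          ≈⟨ independent (socle i y) (≈v-trans (comb-socle i y) z) i j last ⟩
      0#                          ∎)
      where
      last : Fin (size i)
      last = Fin.fromℕ (toℕ i)

    orthogonal-parts : ∀ {i i′} → ¬ i ≡ i′ → ∀ k y j k′ → β (pow ν k (part i y)) (chain i′ j k′) ≈ 0#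
    orthogonal-parts {i} {i′} i≢i′ k y j k′ = begin
      β (pow ν k (part i y)) c                            ≈⟨ βˡ.cong c (ν^-part k i y) ⟩
      β (∑v (a i) (λ l → y l ·s pow ν k (e i l))) c       ≈⟨ βˡ.∑-homo c (a i) _ ⟩
      ∑F (a i) (λ l → β (y l ·s pow ν k (e i l)) c)
        ≈⟨ ∑F-zero (a i) (λ l → trans (βˡ.·s-homo c (y l) _) (trans (*-congˡ (trans
             (reflexive (≡.cong (λ t → β t c) (≡.sym (Npow≡pow k (e i l))))) (orthogonal i i′ i≢i′ l j k k′))) (zeroʳ _))) ⟩
      0#                                                  ∎
      where
      c : Vect d
      c = chain i′ j k′

    -- A vector paired with νⁱ (part i y) may be moved into the generalized 1-eigenspace, and then
    -- only its components along the e i j matter.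
    part-paired : ∀ i y → (∃ λ j → ¬ y j ≈ 0#) → ∃ λ j → ¬ b (toℕ i) (part i y) (e i j) ≈ 0#
    part-paired i y ny = move (β-nonzero (socle-nonzero i y ny))
      where
      w : Vect d
      w = pow ν (toℕ i) (part i y)
      Result : Set
      Result = ∃ λ j → ¬ b (toℕ i) (part i y) (e i j) ≈ 0#
      -- As ν w = 0, w is orthogonal to [V, g]. This permits shifting z into the generalized
      -- 1-eigenspace and discards every chain vector after the generator.
      w⟂ν : ∀ u → β w (ν u) ≈ 0#
      w⟂ν u = trans (sym (ν*-adjoint w u)) (βˡ.zero-homo u (ν-zero⇒ν*-zero (part-killed i y)))
      along : ∀ i′ j (k : ℕ) → ¬ β w (chain i′ j k) ≈ 0# → Result
      along i′ j k p with i Fin.≟ i′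
      ... | no i≢i′ = contradiction (orthogonal-parts i≢i′ (toℕ i) y j k) p
      along i′ j (suc k) p | yes ≡.refl = contradiction (w⟂ν (chain i j k)) p
      along i′ j zero    p | yes ≡.refl = j , λ z → p (β-zero-sym (trans
        (b-sym (toℕ i) (part i y) (e-killed i j)) (trans (-‿cong (*-congˡ z)) (solve 1 (λ s → :- (s :* con (+ 0)) := con (+ 0)) refl _))))
      extract₃ : ∀ i′ j (c : Fin (size i′) → Carrier) →
                 (∃ λ k → ¬ β w (c k ·s chain i′ j (toℕ k)) ≈ 0#) → Result
      extract₃ i′ j c (k , p) = along i′ j (toℕ k)
        (λ z → p (trans (βʳ.·s-homo w (c k) (chain i′ j (toℕ k))) (trans (*-congˡ z) (zeroʳ (c k)))))
      extract₂ : ∀ i′ (c : Fin (a i′) → Fin (size i′) → Carrier) →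
                 (∃ λ j → ¬ β w (∑v (size i′) (λ k → c j k ·s chain i′ j (toℕ k))) ≈ 0#) → Result
      extract₂ i′ c (j , p) = extract₃ i′ j (c j) (∑F-nonzero (λ z → p (trans (βʳ.∑-homo w (size i′) (λ k → c j k ·s chain i′ j (toℕ k))) z)))
      extract₁ : ∀ (c : ∀ i → Fin (a i) → Fin (size i) → Carrier) →
                 (∃ λ i → ¬ β w (∑v (a i) (λ j → ∑v (size i) (λ k → c i j k ·s chain i j (toℕ k)))) ≈ 0#) → Result
      extract₁ c (i′ , p) = extract₂ i′ (c i′) (∑F-nonzero (λ z → p (trans (βʳ.∑-homo w (a i′) (λ j → ∑v (size i′) (λ k → c i′ j k ·s chain i′ j (toℕ k)))) z)))
      expand : ∀ {z} → ¬ β w z ≈ 0# → (∃ λ c → z ≈v comb c) → Result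
      expand p (c , e) = extract₁ c (∑F-nonzero (λ z → p (trans (βʳ.cong w e) (trans (βʳ.∑-homo w d _) z))))
      localize : ∀ z → ¬ β w z ≈ 0# → (∃ λ u → pow ν d (z +v ν u) ≈v 0v) → Result
      localize z p (u , zu) = expand
        (λ e → p (trans (sym (trans (βʳ.+-homo w z (ν u)) (trans (+-congˡ (w⟂ν u)) (+-identityʳ (β w z))))) e))
        (spanning (z +v ν u) (≡.subst (_≈v 0v) (≡.sym (Npow≡pow d (z +v ν u))) zu))
      move : (∃ λ z → ¬ β w z ≈ 0#) → Result
      move (z , p) = localize z p (fitting ν-linear z)

    -- In each chain all vectors after the generator lie in [V, g].
    comb≋top : ∀ c → comb c ≋ ∑v d (λ i → part i (λ j → c i j zero))
    comb≋top c = ≋-∑ d (λ i → ≋-∑ (a i) (λ j → ≋-trans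
      (≋-+ (≋-reflexive ≈v-refl) (≋-trans (≋-∑ (toℕ i) (λ k → ≋-trans (≋-·s (c i j (suc k)) (ν≋0 (chain i j (toℕ k))))
        (≋-reflexive (λ _ → zeroʳ _)))) (≋-reflexive (∑v-zero (toℕ i) (λ k → ≈v-refl)))))
      (≋-reflexive (λ l → +-identityʳ _))))
    spans : ∀ v → ∃ λ (x : ∀ i → Vect (a i)) → v ≋ ∑v d (λ i → part i (x i))
    spans v = localized (fitting ν-linear v)
      where
      expanded : ∀ {w} → v ≋ w → (∃ λ c → w ≈v comb c) → ∃ λ (x : ∀ i → Vect (a i)) → v ≋ ∑v d (λ i → part i (x i))
      expanded v≋w (c , e) = (λ i j → c i j zero) , ≋-trans v≋w (≋-trans (≋-reflexive e) (comb≋top c))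
      localized : (∃ λ u → pow ν d (v +v ν u) ≈v 0v) → ∃ λ (x : ∀ i → Vect (a i)) → v ≋ ∑v d (λ i → part i (x i))
      localized (u , z) = expanded (≋-sym (u , ≈v-refl))
        (spanning (v +v ν u) (≡.subst (_≈v 0v) (≡.sym (Npow≡pow d (v +v ν u))) z))

    frame : JordanFrame
    frame = record { a = a ; e = e ; killed = e-killed ; paired = part-paired ; spanning = spans }

-- Assembly of the orbit count

orbit-count : (R : CommutativeRing 0ℓ 0ℓ) (let open LinAlg R) (q : ℕ) → q % 2 ≡ 1 → IsFiniteFieldOfOrder q →
  ∀ {d} (B : Mat d) → Alternating B → Nondegenerate B → (g : Mat d) → IsIsometry B g →
  (J : OrthJordanData B g) (plus : Fin d → Bool) →
  (∀ i → (eq : OrthJordanData.a J i ≡ 2) → isEven (OrthJordanData.size J i) ≡ true →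
    (plus i ≡ true) ⇔ OrthJordanData.Isotropic J i eq) →
  NumOrbits B g (suc (∑ℕ d (λ i → contrib q (OrthJordanData.size J i) (OrthJordanData.a J i) (plus i))))
orbit-count R q odd F {d} B alternating nondegenerate g isometry J plus plus-isotropic =
  L.rep
  , (λ v → let s , o = L.rep-complete v in s , M.∼⇒SameOrbit o)
  , λ s s′ o → L.rep-distinct s s′ (M.SameOrbit⇒∼ o)
  where
  open LinAlg R
  module M = MatrixIsometry R q F B alternating nondegenerate g isometry
  module C = Classification R q F odd M.S (M.frame J)
  open OrthJordanData J
  isotropic : ∀ i → a i ≡ 2 → isEven (size i) ≡ true → (plus i ≡ true) ⇔ C.IsotropicPart i
  -- `Isotropic J i eq` and the corresponding `IsotropicPair` agree by computation, since `reindex`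
  -- unfolds to the same local reindexing function; hence no transport between them.
  isotropic i eq even = M.IsotropicPair⇔ eq (e i) (toℕ i) ⇔-∘ plus-isotropic i eq even
  module L = C.Labels (λ i → contrib q (size i) (a i) (plus i)) (λ i → C.representatives i (plus i) (isotropic i))

open import Data.Nat using (_+_; _*_; _≤_)

theorem5p1 : (R : CommutativeRing 0ℓ 0ℓ) → let open LinAlg R in
    (q : ℕ) → q % 2 ≡ 1 → IsFiniteFieldOfOrder q →
    (n : ℕ) → 1 ≤ n →
    (B : Mat (2 * n)) → Alternating B → Nondegenerate B →
    (g : Mat (2 * n)) → IsIsometry B g →
    (J : OrthJordanData B g) →
    (σ : Fin (2 * n) → Bool) →
    (∀ i → (eq : OrthJordanData.a J i ≡ 2) → isEven (OrthJordanData.size J i) ≡ true →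
    (σ i ≡ true) ⇔ OrthJordanData.Isotropic J i eq) →
    NumOrbits B g
    (1 + ∑ℕ (2 * n) (λ i → contrib q (OrthJordanData.size J i) (OrthJordanData.a J i) (σ i)))
theorem5p1 R q odd F n _ = orbit-count R q odd F
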